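{- Consider any instance of the Colored Knapsack Problem (ColKP) with $w_i\le b$ and $-p_{\max}<p_i\le p_{\max}$ for all items $i\in\mathcal I$, where $p_{\max}=\max\{p_i:i\in\mathcal I\}>0$. For every $\varepsilon\in(0,1)$, the item-by-item scaling algorithm (Algorithm F1 described in the context) returns a feasible ColKP solution of value at least $(1-\varepsilon)\,\mathrm{OPT}$.
   Context: ColKP instance: items $\mathcal I=\{1,\dots,n\}$, capacity $b\in\mathbb Z_{>0}$, colors $\mathcal C=\{1,\dots,m\}$; each item $i$ has weight $w_i\in\mathbb Z_{>0}$, profit $p_i\in\mathbb Z$ and color $\kappa_i\in\mathcal C$. For $S\subseteq\mathcal I$: $w(S)=\sum_{i\in S}w_i$, $p(S)=\sum_{i\in S}p_i$, $\mathcal I_c=\{i\in\mathcal I:\kappa_i=c\}$, $k_c(S)=|S\cap\mathcal I_c|$, $d(S)=\max_{c\in\mathcal C}k_c(S)$. A color $c$ is dominant in $S$ if $k_c(S)=d(S)$. $S$ is color-feasible if $2d(S)\le|S|+1$, and feasible if moreover $w(S)\le b$. $\mathrm{OPT}=\max\{p(S):S\subseteq\mathcal I\text{ feasible}\}$. Algorithm LP-Round: (1) compute an optimal basic solution $x^*$ (an optimal extreme point) of the linear program: maximize $\sum_{i}p_ix_i$ subject to $\sum_{i}w_ix_i\le b$, $\sum_{i\in\mathcal I_c}x_i-\sum_{i\in\mathcal I\setminus\mathcal I_c}x_i\le1$ for all $c\in\mathcal C$, $x_i\in[0,1]$ for all $i$; (2) set $S_0=\{i:x_i^*=1\}$; (3)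 if $S_0$ is not color-feasible, let $c$ be its unique dominant color and remove from $S_0$ an item of $S_0\cap\mathcal I_c$ of minimum profit; (4) return the more profitable of $S_0$ and $\{r\}$, where $r$ is an item with $p_r=p_{\max}$. Algorithm F1 (input: the instance and $\varepsilon$): (1) Run LP-Round, let $\mathrm{LB}$ be the profit of the set it returns, and let $\mathrm{UB}=3\,\mathrm{LB}$. (2) Set $\lambda=\varepsilon\,\mathrm{LB}/n$ and $\hat p_i=\lfloor p_i/\lambda\rfloor$ for all $i$; write $\hat p(S)=\sum_{i\in S}\hat p_i$. (3) If all $p_i\ge0$, set $z_{\min}=0$, $z_{\max}=\lceil\mathrm{UB}/\lambda\rceil$; otherwise set $z_{\min}=\lfloor -n\,p_{\max}/\lambda\rfloor$, $z_{\max}=\lceil(\mathrm{UB}+n\,p_{\max})/\lambda\rceil$. (4) Sort (re-index) the items by color, so that each color class is a contiguous block of indices. (5) Run the following dynamic program. Set $g(0,0,0,0,0)=0$ and every other table entry $g(i,t,d,a,z)=+\infty$, where $i,t,d,a\in\{0,\dots,n\}$ and $z\in\{z_{\min},\dots,z_{\max}\}$. For $i=1,\dots,n$ and every $(t,d,a,z)$ with $g(i-1,t,d,a,z)<+\infty$: let $a'=a$ if $i>1$ and $\kappa_i=\kappa_{i-1}$, and $a'=0$ otherwise; set $g(i,t,d,a',z)\leftarrow\min\{g(i,t,d,a',z),\,g(i-1,t,d,a,z)\}$ (do not pack $i$); let $d'=d+1$ if $a'=d$ and $d'=d$ otherwise; and set $g(i,t+1,d',a'+1,z+\hat p_i)\leftarrow\min\{g(i,t+1,d',a'+1,z+\hat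 p_i),\,g(i-1,t,d,a,z)+w_i\}$ (pack $i$), the latter only if $z+\hat p_i\in[z_{\min},z_{\max}]$ and $g(i-1,t,d,a,z)+w_i\le b$. (6) Among all terminal entries with $g(n,t,d,a,z)\le b$ and $2d\le t+1$, choose one with maximum $z$, and return the set $\hat S$ recovered by backtracking the transitions leading to it.
   Formalization: The accuracy parameter ε is taken to be a rational number in (0,1) rather than an arbitrary real number. -}

module Defs where

open import Data.Bool using (Bool; false; if_then_else_)
open import Data.Fin as Fin using (Fin; zero; suc; fromℕ<; inject₁)
open import Data.Fin.Permutation using (Permutation′; _⟨$⟩ʳ_)
open import Data.Fin.Properties using (all?)
open import Data.Fin.Subset using (Subset; inside; outside; ⊥; ⁅_⁆; ∁; _∩_; _∪_; _-_; _∈_; ∣_∣)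
open import Data.Integer as ℤ using (ℤ; +_; 0ℤ)
import Data.Integer.Properties as ℤₚ
open import Data.List as List using (List; []; _∷_; _++_; upTo; cartesianProduct; foldl)
import Data.List.Extrema
open import Data.Maybe using (Maybe; just; nothing)
open import Data.Nat as ℕ using (ℕ; zero; suc)
import Data.Nat.Properties as ℕₚ
open import Data.Product using (∃-syntax; _×_; _,_)
open import Data.Product.Properties using (≡-dec)
open import Data.Rational as ℚ using (ℚ; 0ℚ; 1ℚ; floor; ceiling)
open import Data.Rational.Literals using (fromℤ)
import Data.Rational.Properties as ℚₚ
open import Data.Vec using ([]; _∷_; tabulate; lookup)
import Data.Vec.Functional as Fn
open import Function using (_∘_)
open import Relation.Binary using (DecidableEquality)
open import Relation.Binary.PropositionalEquality using (_≡_)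
open import Relation.Nullary using (¬_; Dec; does; _×-dec_)
open import Relation.Unary using (Decidable)
open import Algebra.Definitions.RawMonoid ℕ.+-0-rawMonoid using () renaming (sum to sumℕ) public
open import Algebra.Definitions.RawMonoid ℤ.+-0-rawMonoid using () renaming (sum to sumℤ) public
open import Algebra.Definitions.RawMonoid ℚ.+-0-rawMonoid using () renaming (sum to sumℚ) public

maximumℤ : ∀ {n} → .{{ℕ.NonZero n}} → (Fin n → ℤ) → ℤ
maximumℤ {suc zero}    f = f zero
maximumℤ {suc (suc n)} f = f zero ℤ.⊔ maximumℤ (f ∘ suc)

allSubsets : ∀ n → List (Subset n)
allSubsets zero    = [] ∷ []
allSubsets (suc n) = List.map (inside ∷_) (allSubsets n) ++ List.map (outside ∷_) (allSubsets n)

------------------------------------------------------------------------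
-- The Colored Knapsack Problem

record Instance : Set where
  field
    n m     : ℕ
    {{n≢0}} : ℕ.NonZero n
    b       : ℕ
    0<b     : 0 ℕ.< b
    w       : Fin n → ℕ
    0<w     : ∀ i → 0 ℕ.< w i
    p       : Fin n → ℤ
    κ       : Fin n → Fin m

module ColKP (I : Instance) where
  open Instance I public

  weight : Subset n → ℕ
  weight S = sumℕ λ i → if lookup S i then w i else 0

  profit : Subset n → ℤ
  profit S = sumℤ λ i → if lookup S i then p i else 0ℤ

  pmax : ℤ
  pmax = maximumℤ p

  colorClass : Fin m → Subset n
  colorClass c = tabulate λ i → does (κ i Fin.≟ c)

  k : Fin m → Subset n → ℕ
  k c S = ∣ S ∩ colorClass c ∣

  d : Subset n → ℕ
  d S = Fn.foldr ℕ._⊔_ 0 (λ c → k c S)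

  Dominant : Fin m → Subset n → Set
  Dominant c S = k c S ≡ d S

  ColorFeasible : Subset n → Set
  ColorFeasible S = 2 ℕ.* d S ℕ.≤ ∣ S ∣ ℕ.+ 1

  Feasible : Subset n → Set
  Feasible S = ColorFeasible S × weight S ℕ.≤ b

  feasible? : Decidable Feasible
  feasible? S = (2 ℕ.* d S ℕ.≤? ∣ S ∣ ℕ.+ 1) ×-dec (weight S ℕ.≤? b)

  -- The seed 0 is harmless: it is the profit of the empty set, which is feasible.
  OPT : ℤ
  OPT = Data.List.Extrema.max ℤₚ.≤-totalOrder 0ℤ
          (List.map profit (List.filter feasible? (allSubsets n)))

  ----------------------------------------------------------------------
  -- LP-Round

  sumOver : Subset n → (Fin n → ℚ) → ℚ
  sumOver S x = sumℚ λ i → if lookup S i then x i else 0ℚ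

  record LPFeasible (x : Fin n → ℚ) : Set where
    field
      capacity : sumℚ (λ i → fromℤ (+ w i) ℚ.* x i) ℚ.≤ fromℤ (+ b)
      color    : ∀ c → sumOver (colorClass c) x ℚ.- sumOver (∁ (colorClass c)) x ℚ.≤ 1ℚ
      bounds   : ∀ i → 0ℚ ℚ.≤ x i × x i ℚ.≤ 1ℚ

  objective : (Fin n → ℚ) → ℚ
  objective x = sumℚ λ i → fromℤ (p i) ℚ.* x i

  record OptimalExtremePoint (x : Fin n → ℚ) : Set where
    field
      feasible : LPFeasible x
      optimal  : ∀ y → LPFeasible y → objective y ℚ.≤ objective x
      extreme  : ∀ y z → LPFeasible y → LPFeasible z →
                 ∀ t → 0ℚ ℚ.< t → t ℚ.< 1ℚ →
                 (∀ i → x i ≡ t ℚ.* y i ℚ.+ (1ℚ ℚ.- t) ℚ.* z i) →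
                 ∀ i → y i ≡ z i

  onesOf : (Fin n → ℚ) → Subset n
  onesOf x = tabulate λ i → does (x i ℚ.≟ 1ℚ)

  data Repair (S : Subset n) : Subset n → Set where
    keep : ColorFeasible S → Repair S S
    drop : ∀ c i → ¬ ColorFeasible S → Dominant c S →
           i ∈ S ∩ colorClass c →
           (∀ j → j ∈ S ∩ colorClass c → p i ℤ.≤ p j) →
           Repair S (S - i)

  data MoreProfitable (S T : Subset n) : Subset n → Set where
    left  : profit T ℤ.≤ profit S → MoreProfitable S T S
    right : profit S ℤ.≤ profit T → MoreProfitable S T T

  -- LPRound S: S is a possible output. The choices left open (the optimal
  -- vertex, the removed item, r, ties) make this a relation.
  record LPRound (S : Subset n) : Set where
    field
      x*        : Fin n → ℚ
      x*-vertex : OptimalExtremePoint x*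
      S₀        : Subset n
      repair    : Repair (onesOf x*) S₀
      r         : Fin n
      r-max     : p r ≡ pmax
      result    : MoreProfitable S₀ ⁅ r ⁆ S

  ----------------------------------------------------------------------
  -- The dynamic program

  -- nothing is +∞
  ℕ∞ : Set
  ℕ∞ = Maybe ℕ

  _⊓∞_ : ℕ∞ → ℕ∞ → ℕ∞
  nothing ⊓∞ y       = y
  just x  ⊓∞ nothing = just x
  just x  ⊓∞ just y  = just (x ℕ.⊓ y)

  -- (t , d , a , z)
  State : Set
  State = ℕ × ℕ × ℕ × ℤ

  _≟ₛ_ : DecidableEquality State
  _≟ₛ_ = ≡-dec ℕ._≟_ (≡-dec ℕ._≟_ (≡-dec ℕ._≟_ ℤ._≟_))

  Layer : Set
  Layer = State → ℕ∞

  relax : State → ℕ → Layer → Layer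
  relax s v g s′ = if does (s′ ≟ₛ s) then g s′ ⊓∞ just v else g s′

  sameAsPrevious : ∀ {k} → (Fin k → Fin m) → Fin k → Bool
  sameAsPrevious col zero    = false
  sameAsPrevious col (suc i) = does (col (suc i) Fin.≟ col (inject₁ i))

  intervalℤ : ℤ → ℤ → List ℤ
  intervalℤ lo hi = List.filter (ℤ._≤? hi) (List.map (λ j → lo ℤ.+ + j) (upTo (suc ℤ.∣ hi ℤ.- lo ∣)))

  -- item lists the items in processing order; p̂ is indexed by items.
  module DP (item : Fin n → Fin n) (p̂ : Fin n → ℤ) (zmin zmax : ℤ) where

    states : List State
    states = cartesianProduct idx (cartesianProduct idx (cartesianProduct idx (intervalℤ zmin zmax)))
      where idx = upTo (suc n)

    blockCount : Fin n → ℕ → ℕ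
    blockCount i a = if sameAsPrevious (κ ∘ item) i then a else 0

    skipTo : Fin n → State → State
    skipTo i (t , d , a , z) = t , d , blockCount i a , z

    packTo : Fin n → State → State
    packTo i (t , d , a , z) = suc t , d′ , suc a′ , z ℤ.+ p̂ (item i)
      where
      a′ = blockCount i a
      d′ = if does (a′ ℕ.≟ d) then suc d else d

    CanPack : Fin n → State → ℕ → Set
    CanPack i (_ , _ , _ , z) v =
      (zmin ℤ.≤ z ℤ.+ p̂ (item i) × z ℤ.+ p̂ (item i) ℤ.≤ zmax) × v ℕ.+ w (item i) ℕ.≤ b

    canPack? : ∀ i s v → Dec (CanPack i s v)
    canPack? i (_ , _ , _ , z) v =
      ((zmin ℤ.≤? z ℤ.+ p̂ (item i)) ×-dec (z ℤ.+ p̂ (item i) ℤ.≤? zmax)) ×-dec (v ℕ.+ w (item i) ℕ.≤? b)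

    visit : Fin n → State → ℕ∞ → Layer → Layer
    visit i s nothing  g = g
    visit i s (just v) g =
      if does (canPack? i s v) then relax (packTo i s) (v ℕ.+ w (item i)) g′ else g′
      where g′ = relax (skipTo i s) v g

    origin : State
    origin = 0 , 0 , 0 , 0ℤ

    -- table j is g(j,·). Processing an item only reads the previous layer
    -- and only writes the current one, so layers can be built one by one.
    table : ∀ j → .(j ℕ.≤ n) → Layer
    table zero    _   s = if does (s ≟ₛ origin) then just 0 else nothing
    table (suc j) j<n   = foldl (λ g s → visit (fromℕ< j<n) s (table j (ℕₚ.<⇒≤ j<n) s) g)
                                (λ _ → nothing) states

    -- Backtrack j _ s S: S can be recovered from entry s of layer j by
    -- following, at each layer, some transition that attains the entry.
    data Backtrack : ∀ j → .(j ℕ.≤ n) → State → Subset n → Set where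
      start : Backtrack 0 ℕ.z≤n origin ⊥
      skip  : ∀ {j s S v} .(j<n : j ℕ.< n) → let i = fromℕ< j<n in
              Backtrack j (ℕₚ.<⇒≤ j<n) s S →
              table j (ℕₚ.<⇒≤ j<n) s ≡ just v →
              table (suc j) j<n (skipTo i s) ≡ just v →
              Backtrack (suc j) j<n (skipTo i s) S
      pack  : ∀ {j s S v} .(j<n : j ℕ.< n) → let i = fromℕ< j<n in
              Backtrack j (ℕₚ.<⇒≤ j<n) s S →
              table j (ℕₚ.<⇒≤ j<n) s ≡ just v →
              CanPack i s v →
              table (suc j) j<n (packTo i s) ≡ just (v ℕ.+ w (item i)) →
              Backtrack (suc j) j<n (packTo i s) (S ∪ ⁅ item i ⁆)

    Terminal : State → Set
    Terminal s@(t , d , _ , _) =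
      (∃[ v ] table n ℕₚ.≤-refl s ≡ just v × v ℕ.≤ b) × 2 ℕ.* d ℕ.≤ t ℕ.+ 1

    -- Returns S: S is a possible output of the dynamic program.
    record Returns (S : Subset n) : Set where
      field
        {t* d* a*} : ℕ
        {z*}       : ℤ
        terminal   : Terminal (t* , d* , a* , z*)
        maximal    : ∀ {t d a z} → Terminal (t , d , a , z) → z ℤ.≤ z*
        backtrack  : Backtrack n ℕₚ.≤-refl (t* , d* , a* , z*) S

  ----------------------------------------------------------------------
  -- Algorithm F1

  GroupedByColor : Permutation′ n → Set
  GroupedByColor π = ∀ i j l → i Fin.< j → j Fin.< l →
    κ (π ⟨$⟩ʳ i) ≡ κ (π ⟨$⟩ʳ l) → κ (π ⟨$⟩ʳ j) ≡ κ (π ⟨$⟩ʳ i)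

  module Scaling (ε : ℚ) (LB : ℤ) where

    UB : ℤ
    UB = + 3 ℤ.* LB

    scale : ℚ
    scale = ε ℚ.* (LB ℚ./ n)

    module _ .{{scale≢0 : ℚ.NonZero scale}} where

      p̂ : Fin n → ℤ
      p̂ i = floor (fromℤ (p i) ℚ.÷ scale)

      allNonneg? : Dec (∀ i → 0ℤ ℤ.≤ p i)
      allNonneg? = all? λ i → 0ℤ ℤ.≤? p i

      zmin zmax : ℤ
      zmin = if does allNonneg? then 0ℤ
             else floor (fromℤ (ℤ.- (+ n ℤ.* pmax)) ℚ.÷ scale)
      zmax = if does allNonneg? then ceiling (fromℤ UB ℚ.÷ scale)
             else ceiling (fromℤ (UB ℤ.+ + n ℤ.* pmax) ℚ.÷ scale)

  -- F1 ε Ŝ: Ŝ is a possible output on input ε. The field scale≢0 says that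
  -- the divisions by the scaling factor are defined in this run.
  record F1 (ε : ℚ) (Ŝ : Subset n) : Set where
    field
      L       : Subset n
      lpRound : LPRound L
    open Scaling ε (profit L)
    field
      {{scale≢0}} : ℚ.NonZero scale
      π           : Permutation′ n
      grouped     : GroupedByColor π
      returns     : DP.Returns (π ⟨$⟩ʳ_) p̂ zmin zmax Ŝ

{-# OPTIONS --safe #-}

-- LP-Round: the left-hand sides of two color constraints have sum ≤ 0, so at
-- most one of them is tight at a feasible point. Hence a vertex of the linear
-- program has at most two fractional entries, and two only if some color is
-- tight. This bounds the optimal value by p(S₀) + 2 pmax ≤ 3 LB, so OPT ≤ 3 LB.
-- An optimal vertex exists by Fourier–Motzkin elimination with the objective
-- eliminated last, giving every variable its greatest value on the way back.
--
-- Dynamic program: since the colors form blocks, the counter a' is the number of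
-- packed items of the current color, so a state (t, d, a, z) records |S|, d(S)
-- and p̂(S) of the packed set S. The program therefore maximizes p̂ over the
-- feasible sets whose prefixes stay within [zmin, zmax], and every feasible set
-- does. Rounding costs at most λ per item, that is ε LB ≤ ε OPT in total.

module Submission where

open import Defs
import Algebra
open import Data.Bool using (Bool; true; false; if_then_else_)
open import Data.Empty using (⊥-elim)
open import Data.Fin as Fin using (Fin; zero; suc; fromℕ<; inject₁; toℕ; punchIn)
open import Data.Fin.Permutation as Perm using (Permutation′; _⟨$⟩ʳ_)
import Data.Fin.Properties as Finₚ
open import Data.Fin.Subset as Sub using (Subset; inside; outside; ⁅_⁆; ∁; _∩_; _∪_; _∈_; _∉_; _⊆_; ∣_∣)
import Data.Fin.Subset.Properties as Subₚ
open import Data.Integer as ℤ using (ℤ; +_; 0ℤ)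
import Data.Integer.DivMod as ℤDM
import Data.Integer.Properties as ℤₚ
import Data.Integer.Tactic.RingSolver as ℤSolver
open import Data.List as List using (List; []; _∷_; cartesianProductWith)
import Data.List.Extrema
import Data.List.Membership.Propositional as Mem
import Data.List.Membership.Propositional.Properties as Memₚ
import Data.List.Relation.Unary.All as All
open import Data.List.Relation.Unary.Any using (here; there)
open import Data.Maybe using (Maybe; just; nothing)
open import Data.Maybe.Properties using (just-injective)
open import Data.Nat as ℕ using (ℕ; zero; suc)
import Data.Nat.Properties as ℕₚ
open import Data.Product using (∃; ∃₂; _×_; _,_; proj₁; proj₂)
open import Data.Rational as ℚ using (ℚ; 0ℚ; 1ℚ)
open import Data.Rational.Literals using (fromℤ)
import Data.Rational.Properties as ℚₚ
import Data.Rational.Unnormalised.Base as ℚᵘ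
import Data.Rational.Unnormalised.Properties as ℚᵘₚ
open import Data.Sum using (_⊎_; inj₁; inj₂)
open import Data.Vec using ([]; _∷_; lookup)
import Data.Vec.Functional as Fn
import Data.Vec.Properties as Vecₚ
open import Function using (_∘_; id; case_of_)
open import Relation.Binary using (tri<; tri≈; tri>)
open import Relation.Binary.PropositionalEquality using (_≡_; _≢_; refl; sym; trans; cong; cong₂; subst; subst₂)
open import Relation.Nullary using (¬_; Dec; yes; no; does)
import Relation.Nullary.Decidable as Decidable
open import Tactic.RingSolver using (solve-∀)
import Tactic.RingSolver.Core.AlmostCommutativeRing as ACR

-- Assigning greatest values one variable at a time gives a lexicographically greatest point. Such a
-- point is extreme: if two ends of a segment through it agree on the coordinates fixed so far, the
-- next coordinate is already at its maximum over that fibre, so the ends agree there too. The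
-- repair in LP-Round may cost an item worth up to `pmax`, which on top of two fractional items
-- would give only a factor 4. The factor 3 survives because a repair is needed only when the
-- fractional entries sum to 1 and are together worth at most one `pmax`. The range of `z` is
-- delicate because a prefix of a feasible set in color order need not be color-feasible, and with
-- negative profits it may be worth more than the whole set. From above, a prefix is therefore
-- compared with the whole set, whose profit is at most `UB`; from below, it is compared with the
-- set `L` of LP-Round.

ℚ-ring : ACR.AlmostCommutativeRing _ _
ℚ-ring = ACR.fromCommutativeRing ℚₚ.+-*-commutativeRing λ x → Decidable.dec⇒maybe (0ℚ ℚₚ.≟ x)

-- Order arithmetic on the rationals.

module RationalOrder where

  open import Data.Rational using (_+_; _*_; _-_; -_; _≤_; _<_)

  +-congʳ : ∀ p {q r} → q ≡ r → p + q ≡ p + r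
  +-congʳ p = cong (λ e → p + e)

  0≤⇒≤ : ∀ {p q} → 0ℚ ≤ q - p → p ≤ q
  0≤⇒≤ {p} {q} h = subst₂ _≤_ (ℚₚ.+-identityˡ p) (lemma p q) (ℚₚ.+-monoˡ-≤ p h)
    where
    lemma : ∀ p q → q - p + p ≡ q
    lemma = solve-∀ ℚ-ring

  0<⇒< : ∀ {p q} → 0ℚ < q - p → p < q
  0<⇒< {p} {q} h = subst₂ _<_ (ℚₚ.+-identityˡ p) (lemma p q) (ℚₚ.+-monoˡ-< p h)
    where
    lemma : ∀ p q → q - p + p ≡ q
    lemma = solve-∀ ℚ-ring

  ≤⇒0≤ : ∀ {p q} → p ≤ q → 0ℚ ≤ q - p
  ≤⇒0≤ {p} {q} h = subst (_≤ q - p) (ℚₚ.+-inverseʳ p) (ℚₚ.+-monoˡ-≤ (- p) h)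

  <⇒0< : ∀ {p q} → p < q → 0ℚ < q - p
  <⇒0< {p} {q} h = subst (_< q - p) (ℚₚ.+-inverseʳ p) (ℚₚ.+-monoˡ-< (- p) h)

  0≤+ : ∀ {p q} → 0ℚ ≤ p → 0ℚ ≤ q → 0ℚ ≤ p + q
  0≤+ {p} {q} h k = subst (_≤ p + q) (ℚₚ.+-identityˡ 0ℚ) (ℚₚ.+-mono-≤ h k)

  0<+ : ∀ {p q} → 0ℚ < p → 0ℚ ≤ q → 0ℚ < p + q
  0<+ {p} {q} h k = subst (_< p + q) (ℚₚ.+-identityˡ 0ℚ) (ℚₚ.+-mono-<-≤ h k)

  0≤* : ∀ {p q} → 0ℚ ≤ p → 0ℚ ≤ q → 0ℚ ≤ p * q
  0≤* {p} {q} h k = subst (_≤ p * q) (ℚₚ.*-zeroʳ p) (ℚₚ.*-monoˡ-≤-nonNeg p {{ℚ.nonNegative h}} k)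

  0<* : ∀ {p q} → 0ℚ < p → 0ℚ < q → 0ℚ < p * q
  0<* {p} {q} h k = subst (_< p * q) (ℚₚ.*-zeroʳ p) (ℚₚ.*-monoʳ-<-pos p {{ℚ.positive h}} k)

  0≤*-cancel : ∀ {p q} → 0ℚ < p → 0ℚ ≤ p * q → 0ℚ ≤ q
  0≤*-cancel {p} {q} h k = ℚₚ.*-cancelˡ-≤-pos p {{ℚ.positive h}} (subst (_≤ p * q) (sym (ℚₚ.*-zeroʳ p)) k)

  -- Linear inequalities are proved by certificates: a combination e of nonnegative
  -- quantities that the ring solver identifies with q − p.
  by≤ : ∀ {e p q} → 0ℚ ≤ e → e ≡ q - p → p ≤ q
  by≤ h eq = 0≤⇒≤ (subst (0ℚ ≤_) eq h)

  neg⇒0< : ∀ {p} → p < 0ℚ → 0ℚ < - p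
  neg⇒0< {p} h = subst (0ℚ <_) (ℚₚ.+-identityˡ (- p)) (<⇒0< h)

  <⊎≥ : ∀ p q → p < q ⊎ q ≤ p
  <⊎≥ p q with p ℚₚ.<? q
  ... | yes h = inj₁ h
  ... | no  h = inj₂ (ℚₚ.≮⇒≥ h)

  root : ∀ (a c : ℚ) → a < 0ℚ → ∃ λ v → a * v + c ≡ 0ℚ
  root a c a<0 = let instance nz = ℚₚ.neg⇒nonZero a {{ℚ.negative a<0}} in
    - c * ℚ.1/ a ,
    trans (lemma₁ a c (ℚ.1/ a)) (trans (cong (λ e → - c * e + c) (ℚₚ.*-inverseʳ a)) (lemma₂ c))
    where
    lemma₁ : ∀ a c i → a * (- c * i) + c ≡ - c * (a * i) + c
    lemma₁ = solve-∀ ℚ-ring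
    lemma₂ : ∀ c → - c * 1ℚ + c ≡ 0ℚ
    lemma₂ = solve-∀ ℚ-ring

  -- The gaps `c - a` and `c - b` are nonnegative, and their combination with the positive weights
  -- `t` and `1ℚ - t` is zero, so both vanish.
  convex-extreme : ∀ {t a b c} → 0ℚ < t → t < 1ℚ → a ≤ c → b ≤ c →
                   c ≡ t * a + (1ℚ - t) * b → a ≡ c × b ≡ c
  convex-extreme {t} {a} {b} {c} 0<t t<1 a≤c b≤c eq =
    ℚₚ.≤-antisym a≤c (0≤⇒≤ (0≤*-cancel 0<t (subst (0ℚ ≤_) eq₁ (0≤* (ℚₚ.<⇒≤ (<⇒0< t<1)) (≤⇒0≤ b≤c))))) ,
    ℚₚ.≤-antisym b≤c (0≤⇒≤ (0≤*-cancel (<⇒0< t<1) (subst (0ℚ ≤_) eq₂ (0≤* (ℚₚ.<⇒≤ 0<t) (≤⇒0≤ a≤c)))))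
    where
    r₁ : ∀ t a b c → (1ℚ - t) * (c - b) ≡ t * (a - c) + (c - (t * a + (1ℚ - t) * b))
    r₁ = solve-∀ ℚ-ring
    r₂ : ∀ t a b c → t * (c - a) ≡ (1ℚ - t) * (b - c) + (c - (t * a + (1ℚ - t) * b))
    r₂ = solve-∀ ℚ-ring
    zero-gap : c - (t * a + (1ℚ - t) * b) ≡ 0ℚ
    zero-gap = trans (cong (λ e → c - e) (sym eq)) (ℚₚ.+-inverseʳ c)
    eq₁ : (1ℚ - t) * (c - b) ≡ t * (a - c)
    eq₁ = trans (r₁ t a b c) (trans (+-congʳ (t * (a - c)) zero-gap) (ℚₚ.+-identityʳ _))
    eq₂ : t * (c - a) ≡ (1ℚ - t) * (b - c)
    eq₂ = trans (r₂ t a b c) (trans (+-congʳ ((1ℚ - t) * (b - c)) zero-gap) (ℚₚ.+-identityʳ _))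

open RationalOrder

-- Fourier-Motzkin elimination and maximal vertices.

module FourierMotzkin where

  open import Data.Rational using (_+_; _*_; _-_; -_; _≤_; _<_)
  open Mem using () renaming (_∈_ to _∈ˡ_)

  -- Coefficients of an affine functional on ℚⁿ × ℚ; the last coordinate is the
  -- one to be maximized and is eliminated last.
  Affine : ℕ → Set
  Affine zero    = ℚ × ℚ
  Affine (suc n) = ℚ × Affine n

  eval : ∀ {n} → Affine n → ℚ → (Fin n → ℚ) → ℚ
  eval {zero}  (a , c) v x = a * v + c
  eval {suc n} (a , f) v x = a * x zero + eval f v (x ∘ suc)

  eval-cong : ∀ {n} (f : Affine n) {v x y} → (∀ i → x i ≡ y i) → eval f v x ≡ eval f v y
  eval-cong {zero}  f       h = refl
  eval-cong {suc n} (a , f) h = cong₂ (λ p q → a * p + q) (h zero) (eval-cong f (h ∘ suc))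

  comb : ∀ {n} → ℚ → ℚ → Affine n → Affine n → Affine n
  comb {zero}  α β (a , c) (a′ , c′) = α * a + β * a′ , α * c + β * c′
  comb {suc n} α β (a , f) (a′ , f′) = α * a + β * a′ , comb α β f f′

  eval-comb : ∀ {n} α β (f g : Affine n) v x →
              eval (comb α β f g) v x ≡ α * eval f v x + β * eval g v x
  eval-comb {zero} α β (a , c) (a′ , c′) v x = lemma α β a a′ c c′ v
    where
    lemma : ∀ α β a a′ c c′ v → (α * a + β * a′) * v + (α * c + β * c′) ≡ α * (a * v + c) + β * (a′ * v + c′)
    lemma = solve-∀ ℚ-ring
  eval-comb {suc n} α β (a , f) (a′ , f′) v x =
    trans (+-congʳ ((α * a + β * a′) * x zero) (eval-comb α β f f′ v (x ∘ suc))) (lemma α β a a′ (x zero) _ _)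
    where
    lemma : ∀ α β a a′ x p q → (α * a + β * a′) * x + (α * p + β * q) ≡ α * (a * x + p) + β * (a′ * x + q)
    lemma = solve-∀ ℚ-ring

  affine : ∀ {n} → (Fin n → ℚ) → ℚ → ℚ → Affine n
  affine {zero}  q a c = a , c
  affine {suc n} q a c = q zero , affine (q ∘ suc) a c

  eval-affine : ∀ {n} (q : Fin n → ℚ) a c v x →
                eval (affine q a c) v x ≡ sumℚ (λ i → q i * x i) + (a * v + c)
  eval-affine {zero}  q a c v x = sym (ℚₚ.+-identityˡ _)
  eval-affine {suc n} q a c v x =
    trans (+-congʳ (q zero * x zero) (eval-affine (q ∘ suc) a c v (x ∘ suc))) (sym (ℚₚ.+-assoc (q zero * x zero) _ _))

  constant : ∀ {n} → ℚ → Affine n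
  constant c = affine (λ _ → 0ℚ) 0ℚ c

  eval-constant : ∀ {n} c v (x : Fin n → ℚ) → eval (constant c) v x ≡ c
  eval-constant {zero}  c v x = trans (cong (_+ c) (ℚₚ.*-zeroˡ v)) (ℚₚ.+-identityˡ c)
  eval-constant {suc n} c v x =
    trans (cong₂ _+_ (ℚₚ.*-zeroˡ (x zero)) (eval-constant {n} c v (x ∘ suc))) (ℚₚ.+-identityˡ c)

  -- The largest v ≤ u allowed by the constraints a v + c ≥ 0 with a < 0.
  record Greatest {A : Set} (h : A → ℚ × ℚ) (u : ℚ) (cs : List A) : Set where
    field
      v        : ℚ
      v≤u      : v ≤ u
      negative : ∀ {f} → f ∈ˡ cs → proj₁ (h f) < 0ℚ → 0ℚ ≤ proj₁ (h f) * v + proj₂ (h f)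
      greatest : ∀ w → w ≤ u → (∀ {f} → f ∈ˡ cs → 0ℚ ≤ proj₁ (h f) * w + proj₂ (h f)) → w ≤ v
      attained : v ≡ u ⊎ ∃ λ f → f ∈ˡ cs × proj₁ (h f) < 0ℚ × proj₁ (h f) * v + proj₂ (h f) ≡ 0ℚ

  greatest-solution : ∀ {A : Set} (h : A → ℚ × ℚ) u cs → Greatest h u cs
  greatest-solution h u [] = record
    { v = u ; v≤u = ℚₚ.≤-refl ; negative = λ () ; greatest = λ _ w≤u _ → w≤u ; attained = inj₁ refl }
  greatest-solution h u (f ∷ cs) with greatest-solution h u cs
  ... | record { v = v ; v≤u = v≤u ; negative = neg ; greatest = gr ; attained = att }
      with <⊎≥ (proj₁ (h f)) 0ℚ | <⊎≥ (proj₁ (h f) * v + proj₂ (h f)) 0ℚ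
  ...    | inj₂ a≥0 | _ = record
           { v = v ; v≤u = v≤u
           ; negative = λ { (here refl) a<0 → ⊥-elim (ℚₚ.<-irrefl refl (ℚₚ.<-≤-trans a<0 a≥0)) ; (there g∈) → neg g∈ }
           ; greatest = λ w w≤u sat → gr w w≤u (sat ∘ there)
           ; attained = Data.Sum.map₂ (λ (g , g∈ , r) → g , there g∈ , r) att }
  ...    | inj₁ a<0 | inj₂ ok = record
           { v = v ; v≤u = v≤u
           ; negative = λ { (here refl) _ → ok ; (there g∈) → neg g∈ }
           ; greatest = λ w w≤u sat → gr w w≤u (sat ∘ there)
           ; attained = Data.Sum.map₂ (λ (g , g∈ , r) → g , there g∈ , r) att }
  -- The new constraint fails at `v`, so its root `v′` lies below `v` and becomes the bound. Earlier
  -- upper bounds survive the decrease because their coefficients are negative.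
  ...    | inj₁ a<0 | inj₁ bad = record
           { v = v′
           ; v≤u = ℚₚ.≤-trans v′≤v v≤u
           ; negative = λ { (here refl) _ → ℚₚ.≤-reflexive (sym v′-root)
                          ; {g} (there g∈) b<0 → by≤ (0≤+ (neg g∈ b<0) (0≤* (ℚₚ.<⇒≤ (neg⇒0< b<0)) (≤⇒0≤ v′≤v)))
                                                     (r₁ (proj₁ (h g)) (proj₂ (h g)) v v′) }
           ; greatest = λ w w≤u sat → 0≤⇒≤ (0≤*-cancel (neg⇒0< a<0)
                          (subst (0ℚ ≤_) (trans (cong (λ e → a * w + c - e) (sym v′-root)) (r₂ a c w v′))
                            (subst (0ℚ ≤_) (sym (ℚₚ.+-identityʳ _)) (sat (here refl)))))
           ; attained = inj₂ (f , here refl , a<0 , v′-root) }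
    where
    a = proj₁ (h f)
    c = proj₂ (h f)
    v′ = proj₁ (root a c a<0)
    v′-root = proj₂ (root a c a<0)
    r₁ : ∀ b d v v′ → b * v + d + (- b) * (v - v′) ≡ b * v′ + d - 0ℚ
    r₁ = solve-∀ ℚ-ring
    r₂ : ∀ a c w v′ → a * w + c - (a * v′ + c) ≡ - a * (v′ - w)
    r₂ = solve-∀ ℚ-ring
    r₃ : ∀ a c v v′ → (a * v′ + c) - (a * v + c) ≡ - a * (v - v′)
    r₃ = solve-∀ ℚ-ring
    v′≤v : v′ ≤ v
    v′≤v = 0≤⇒≤ (0≤*-cancel (neg⇒0< a<0)
             (subst (0ℚ ≤_) (trans (cong (_- (a * v + c)) (sym v′-root)) (r₃ a c v v′)) (ℚₚ.<⇒≤ (<⇒0< bad))))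

  Satisfies : ∀ {n} → List (Affine n) → ℚ → (Fin n → ℚ) → Set
  Satisfies cs v x = ∀ {f} → f ∈ˡ cs → 0ℚ ≤ eval f v x

  module _ {n : ℕ} where

    negatives nonnegatives : List (Affine (suc n)) → List (Affine (suc n))
    negatives    = List.filter (λ f → proj₁ f ℚₚ.<? 0ℚ)
    nonnegatives = List.filter (λ f → 0ℚ ℚₚ.≤? proj₁ f)

    resolve : Affine (suc n) → Affine (suc n) → Affine n
    resolve (a , f) (b , g) = comb b (- a) f g

    -- The bound `x zero ≤ 1`. It keeps the list of upper bounds nonempty, so that a constraint with
    -- coefficient 0, which counts among the `nonnegatives`, survives the elimination up to a
    -- positive factor.
    cap : Affine (suc n)
    cap = - 1ℚ , constant 1ℚ

    eliminate : List (Affine (suc n)) → List (Affine n)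
    eliminate cs = cartesianProductWith resolve (negatives (cap ∷ cs)) (nonnegatives cs)

    eval-cap : ∀ v x → eval cap v x ≡ 1ℚ - x zero
    eval-cap v x = trans (+-congʳ (- 1ℚ * x zero) (eval-constant {n} 1ℚ v (x ∘ suc))) (lemma (x zero))
      where
      lemma : ∀ y → - 1ℚ * y + 1ℚ ≡ 1ℚ - y
      lemma = solve-∀ ℚ-ring

    eliminate-sound : ∀ cs v x → Satisfies cs v x → x zero ≤ 1ℚ → Satisfies (eliminate cs) v (x ∘ suc)
    eliminate-sound cs v x sat x≤1 f∈
      with Memₚ.∈-cartesianProductWith⁻ resolve (negatives (cap ∷ cs)) (nonnegatives cs) f∈
    ... | (a , f) , (b , g) , f∈′ , g∈′ , refl
        with Memₚ.∈-filter⁻ (λ f → proj₁ f ℚₚ.<? 0ℚ) {xs = cap ∷ cs} f∈′ | Memₚ.∈-filter⁻ (λ f → 0ℚ ℚₚ.≤? proj₁ f) {xs = cs} g∈′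
    ...   | f∈ , a<0 | g∈ , 0≤b =
            subst (0ℚ ≤_) (trans (lemma a b (x zero) _ _) (sym (eval-comb b (- a) f g v (x ∘ suc))))
              (0≤+ (0≤* 0≤b (sat′ f∈)) (0≤* (ℚₚ.<⇒≤ (neg⇒0< a<0)) (sat g∈)))
      where
      lemma : ∀ a b y p q → b * (a * y + p) + (- a) * (b * y + q) ≡ b * p + (- a) * q
      lemma = solve-∀ ℚ-ring
      sat′ : Satisfies (cap ∷ cs) v x
      sat′ (here refl) = subst (0ℚ ≤_) (sym (eval-cap v x)) (≤⇒0≤ x≤1)
      sat′ (there f∈)  = sat f∈

    module Fibre (cs : List (Affine (suc n))) (v : ℚ) (x : Fin n → ℚ) where

      at : Affine (suc n) → ℚ × ℚ
      at (a , f) = a , eval f v x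

      open Greatest (greatest-solution at 1ℚ cs) public renaming (v to x₀)

      -- Some upper bound, possibly `cap`, is tight at `x₀`. Resolving a constraint `g` with
      -- coefficient `b ≥ 0` against it leaves `- a` times the value of `g` at `x₀`, because the
      -- other summand vanishes.
      complete : Satisfies (eliminate cs) v x → Satisfies cs v (x₀ Fn.∷ x)
      complete sat {b , g} g∈ with <⊎≥ b 0ℚ
      ... | inj₁ b<0 = negative g∈ b<0
      ... | inj₂ 0≤b = 0≤*-cancel (neg⇒0< a<0)
              (subst (0ℚ ≤_) (trans (eval-comb b (- a) f g v x)
                (trans (lemma a b x₀ _ _) (trans (cong (λ e → - a * (b * x₀ + eval g v x) + b * e) tight) (drop b _))))
                (sat (Memₚ.∈-cartesianProductWith⁺ resolve
                  (Memₚ.∈-filter⁺ (λ f → proj₁ f ℚₚ.<? 0ℚ) {xs = cap ∷ cs} f∈ a<0)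
                  (Memₚ.∈-filter⁺ (λ f → 0ℚ ℚₚ.≤? proj₁ f) {xs = cs} g∈ 0≤b))))
        where
        lemma : ∀ a b y p q → b * p + (- a) * q ≡ - a * (b * y + q) + b * (a * y + p)
        lemma = solve-∀ ℚ-ring
        drop : ∀ b p → p + b * 0ℚ ≡ p
        drop = solve-∀ ℚ-ring
        tightConstraint : ∃ λ h → h ∈ˡ (cap ∷ cs) × proj₁ h < 0ℚ × proj₁ h * x₀ + eval (proj₂ h) v x ≡ 0ℚ
        tightConstraint with attained
        ... | inj₂ (h , h∈ , r) = h , there h∈ , r
        ... | inj₁ eq = cap , here refl , ℚ.*<* ℤ.-<+ ,
                        trans (eval-cap v (x₀ Fn.∷ x)) (trans (cong (λ e → 1ℚ - e) eq) (ℚₚ.+-inverseʳ 1ℚ))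
        a = proj₁ (proj₁ tightConstraint)
        f = proj₂ (proj₁ tightConstraint)
        f∈ = proj₁ (proj₂ tightConstraint)
        a<0 = proj₁ (proj₂ (proj₂ tightConstraint))
        tight = proj₂ (proj₂ (proj₂ tightConstraint))

  record Member {n} (cs : List (Affine n)) (u v : ℚ) (x : Fin n → ℚ) : Set where
    constructor member
    field
      satisfies : Satisfies cs v x
      x≤1       : ∀ i → x i ≤ 1ℚ
      v≤u       : v ≤ u

  -- `isExtreme` compares only points with the same value `v`; this restriction is removed in
  -- `optimal-vertex`, by optimality.
  record MaximalVertex {n} (cs : List (Affine n)) (u : ℚ) : Set where
    field
      {v}       : ℚ
      {x}       : Fin n → ℚ
      isMember  : Member cs u v x
      isMaximal : ∀ {v′ x′} → Member cs u v′ x′ → v′ ≤ v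
      isExtreme : ∀ {y z} → Member cs u v y → Member cs u v z →
                  ∀ {t} → 0ℚ < t → t < 1ℚ →
                  (∀ i → x i ≡ t * y i + (1ℚ - t) * z i) → ∀ i → y i ≡ z i

  maximal-vertex : ∀ {n} (cs : List (Affine n)) u {v x} → Member cs u v x → MaximalVertex cs u
  maximal-vertex {zero} cs u {w} {x} (member sat _ w≤u) = record
    { v = v ; x = x
    ; isMember = member sat′ (λ ()) v≤u
    ; isMaximal = λ (member s _ v′≤u) → greatest _ v′≤u s
    ; isExtreme = λ _ _ _ _ _ () }
    where
    open Greatest (greatest-solution id u cs)
    sat′ : Satisfies cs v x
    sat′ {a , c} f∈ with <⊎≥ a 0ℚ
    ... | inj₁ a<0 = negative f∈ a<0
    -- A constraint that bounds `v` from below holds at the `w` of the given member, and `v` is at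
    -- least `w`.
    ... | inj₂ 0≤a = by≤ (0≤+ (sat f∈) (0≤* 0≤a (≤⇒0≤ (greatest w w≤u sat)))) (lemma a c v w)
      where
      lemma : ∀ a c v w → a * w + c + a * (v - w) ≡ a * v + c - 0ℚ
      lemma = solve-∀ ℚ-ring
  maximal-vertex {suc n} cs u {_} {x̂} (member sat x≤1 v≤u) = record
    { v = v ; x = x₀ Fn.∷ x
    ; isMember = member (complete (Member.satisfies isMember))
                        (λ { zero → x₀≤1 ; (suc i) → Member.x≤1 isMember i })
                        (Member.v≤u isMember)
    ; isMaximal = isMaximal ∘ project
    ; isExtreme = extreme }
    where
    project : ∀ {v} {x : Fin (suc n) → ℚ} → Member cs u v x → Member (eliminate cs) u v (x ∘ suc)
    project {x = x} (member s le v≤) = member (eliminate-sound cs _ x s (le zero)) (le ∘ suc) v≤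
    open MaximalVertex (maximal-vertex (eliminate cs) u (project {x = x̂} (member sat x≤1 v≤u)))
    open Fibre cs v x renaming (v≤u to x₀≤1)
    extreme : ∀ {y z} → Member cs u v y → Member cs u v z →
              ∀ {t} → 0ℚ < t → t < 1ℚ →
              (∀ i → (x₀ Fn.∷ x) i ≡ t * y i + (1ℚ - t) * z i) → ∀ i → y i ≡ z i
    extreme {y} {z} my mz {t} 0<t t<1 eq = λ
      { zero → let (p , q) = convex-extreme 0<t t<1 (head≤ my y≈x) (head≤ mz z≈x) (eq zero) in trans p (sym q)
      ; (suc i) → y≈z i }
      where
      y≈z : ∀ i → y (suc i) ≡ z (suc i)
      y≈z = isExtreme (project my) (project mz) 0<t t<1 (eq ∘ suc)
      lemma : ∀ t a → t * a + (1ℚ - t) * a ≡ a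
      lemma = solve-∀ ℚ-ring
      z≈x : ∀ i → z (suc i) ≡ x i
      z≈x i = sym (trans (eq (suc i)) (trans (cong (λ e → t * e + (1ℚ - t) * z (suc i)) (y≈z i)) (lemma t _)))
      y≈x : ∀ i → y (suc i) ≡ x i
      y≈x i = trans (y≈z i) (z≈x i)
      head≤ : ∀ {y} → Member cs u v y → (∀ i → y (suc i) ≡ x i) → y zero ≤ x₀
      head≤ {y} (member s le _) y≈x = greatest (y zero) (le zero)
        λ {f} f∈ → subst (0ℚ ≤_) (+-congʳ (proj₁ f * y zero) (eval-cong (proj₂ f) y≈x)) (s f∈)

-- Sums over subsets.

module SetSum {c} (M : Algebra.CommutativeMonoid c c) where

  open Algebra.CommutativeMonoid M hiding (refl; sym; trans)
  private module ≈ = Algebra.CommutativeMonoid M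
  open import Algebra.Properties.CommutativeMonoid.Sum M public
  open import Relation.Binary.Reasoning.Setoid setoid

  -- `weight`, `profit` and `sumOver` unfold to this over ℕ, ℤ and ℚ, so one insertion law serves
  -- all of them, and cardinalities as well.
  setSum : ∀ {n} → Subset n → (Fin n → Carrier) → Carrier
  setSum S f = sum λ i → if lookup S i then f i else ε

  setSum-⊥ : ∀ n (f : Fin n → Carrier) → setSum Sub.⊥ f ≈ ε
  setSum-⊥ zero    f = ≈.refl
  setSum-⊥ (suc n) f = ≈.trans (identityˡ _) (setSum-⊥ n (f ∘ suc))

  setSum-insert : ∀ {n} {S : Subset n} {i} f → i ∉ S → setSum (S ∪ ⁅ i ⁆) f ≈ setSum S f ∙ f i
  setSum-insert {S = inside  ∷ S} {zero} f i∉S = ⊥-elim (i∉S Data.Vec.here)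
  setSum-insert {S = outside ∷ S} {zero} f i∉S = begin
    f zero ∙ setSum (S ∪ Sub.⊥) (f ∘ suc) ≡⟨ cong (λ T → f zero ∙ setSum T (f ∘ suc)) (Subₚ.∪-identityʳ S) ⟩
    f zero ∙ setSum S (f ∘ suc)           ≈⟨ comm _ _ ⟩
    setSum S (f ∘ suc) ∙ f zero           ≈⟨ ∙-congʳ (identityˡ _) ⟨
    (ε ∙ setSum S (f ∘ suc)) ∙ f zero     ∎
  setSum-insert {S = inside  ∷ S} {suc i} f i∉S =
    ≈.trans (∙-congˡ (setSum-insert {S = S} {i} (f ∘ suc) (i∉S ∘ Data.Vec.there))) (≈.sym (assoc _ _ _))
  setSum-insert {S = outside ∷ S} {suc i} f i∉S =
    ≈.trans (∙-congˡ (setSum-insert {S = S} {i} (f ∘ suc) (i∉S ∘ Data.Vec.there))) (≈.sym (assoc _ _ _))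

  setSum-⁅⁆ : ∀ {n} i (f : Fin n → Carrier) → setSum ⁅ i ⁆ f ≈ f i
  setSum-⁅⁆ {n} i f = begin
    setSum ⁅ i ⁆ f           ≡⟨ cong (λ T → setSum T f) (Subₚ.∪-identityˡ ⁅ i ⁆) ⟨
    setSum (Sub.⊥ ∪ ⁅ i ⁆) f ≈⟨ setSum-insert f Subₚ.∉⊥ ⟩
    setSum Sub.⊥ f ∙ f i     ≈⟨ ∙-congʳ (setSum-⊥ n f) ⟩
    ε ∙ f i                  ≈⟨ identityˡ _ ⟩
    f i                      ∎

module ℕΣ = SetSum ℕₚ.+-0-commutativeMonoid
module ℤΣ = SetSum ℤₚ.+-0-commutativeMonoid
module ℚΣ = SetSum ℚₚ.+-0-commutativeMonoid

remove-insert : ∀ {n} {S : Subset n} {i} → i ∈ S → (S Sub.- i) ∪ ⁅ i ⁆ ≡ S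
remove-insert {S = S} {i} i∈S = Subₚ.⊆-antisym
  (λ {x} x∈ → case Subₚ.x∈p∪q⁻ (S Sub.- i) ⁅ i ⁆ x∈ of λ
    { (inj₁ h) → Subₚ.p─q⊆p S ⁅ i ⁆ h
    ; (inj₂ h) → subst (_∈ S) (sym (Subₚ.x∈⁅y⁆⇒x≡y i h)) i∈S })
  (λ {x} x∈ → Subₚ.x∈p∪q⁺ (case x Fin.≟ i of λ
    { (yes refl) → inj₂ (Subₚ.x∈⁅x⁆ i)
    ; (no  x≢i)  → inj₁ (Subₚ.x∈p∧x≢y⇒x∈p-y x∈ x≢i) }))

removed∉ : ∀ {n} (S : Subset n) i → i ∉ S Sub.- i
removed∉ (_ ∷ S) zero    ()
removed∉ (_ ∷ S) (suc i) (Data.Vec.there h) = removed∉ S i h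

∈⇒lookup : ∀ {n} {S : Subset n} {i} → i ∈ S → lookup S i ≡ true
∈⇒lookup = Vecₚ.[]=⇒lookup

∉⇒lookup : ∀ {n} {S : Subset n} {i} → i ∉ S → lookup S i ≡ false
∉⇒lookup {S = S} {i} i∉S with lookup S i in eq
... | true  = ⊥-elim (i∉S (Vecₚ.lookup⇒[]= i S eq))
... | false = refl

∣∣≡setSum : ∀ {n} (S : Subset n) → ∣ S ∣ ≡ ℕΣ.setSum S (λ _ → 1)
∣∣≡setSum []            = refl
∣∣≡setSum (inside  ∷ S) = cong suc (∣∣≡setSum S)
∣∣≡setSum (outside ∷ S) = ∣∣≡setSum S

indicator : Bool → ℕ
indicator b = if b then 1 else 0

∣∩∣≡setSum : ∀ {n} (S C : Subset n) → ∣ S ∩ C ∣ ≡ ℕΣ.setSum S (λ i → indicator (lookup C i))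
∣∩∣≡setSum []            []            = refl
∣∩∣≡setSum (inside  ∷ S) (inside  ∷ C) = cong suc (∣∩∣≡setSum S C)
∣∩∣≡setSum (inside  ∷ S) (outside ∷ C) = ∣∩∣≡setSum S C
∣∩∣≡setSum (outside ∷ S) (_       ∷ C) = ∣∩∣≡setSum S C

sumℕ-mono : ∀ {n} {f g : Fin n → ℕ} → (∀ i → f i ℕ.≤ g i) → sumℕ f ℕ.≤ sumℕ g
sumℕ-mono {zero}  h = ℕ.z≤n
sumℕ-mono {suc n} h = ℕₚ.+-mono-≤ (h zero) (sumℕ-mono (h ∘ suc))

sumℚ-mono : ∀ {n} {f g : Fin n → ℚ} → (∀ i → f i ℚ.≤ g i) → sumℚ f ℚ.≤ sumℚ g
sumℚ-mono {zero}  h = ℚₚ.≤-refl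
sumℚ-mono {suc n} h = ℚₚ.+-mono-≤ (h zero) (sumℚ-mono (h ∘ suc))

setSumℕ-⊆ : ∀ {n} {S T : Subset n} f → S ⊆ T → ℕΣ.setSum S f ℕ.≤ ℕΣ.setSum T f
setSumℕ-⊆ {S = S} {T} f S⊆T = sumℕ-mono λ i → lemma i (i Subₚ.∈? S)
  where
  lemma : ∀ i → Dec (i ∈ S) → (if lookup S i then f i else 0) ℕ.≤ (if lookup T i then f i else 0)
  lemma i (yes h) rewrite ∈⇒lookup h | ∈⇒lookup (S⊆T h) = ℕₚ.≤-refl
  lemma i (no  h) rewrite ∉⇒lookup h = ℕ.z≤n

-- Integers inside the rationals, linear forms and small steps.

module _ where

  open import Data.Rational using (_+_; _*_; _-_; -_; _≤_; _<_)

  fromℤ-+ : ∀ a b → fromℤ (a ℤ.+ b) ≡ fromℤ a + fromℤ b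
  fromℤ-+ a b = ℚₚ.toℚᵘ-injective (ℚᵘₚ.≃-trans
    (ℚᵘ.*≡* (cong₂ (λ x y → (x ℤ.+ y) ℤ.* + 1) (sym (ℤₚ.*-identityʳ a)) (sym (ℤₚ.*-identityʳ b))))
    (ℚᵘₚ.≃-sym (ℚₚ.toℚᵘ-homo-+ (fromℤ a) (fromℤ b))))

  fromℤ-* : ∀ a b → fromℤ (a ℤ.* b) ≡ fromℤ a * fromℤ b
  fromℤ-* a b = ℚₚ.toℚᵘ-injective (ℚᵘₚ.≃-trans
    (ℚᵘ.*≡* refl) (ℚᵘₚ.≃-sym (ℚₚ.toℚᵘ-homo-* (fromℤ a) (fromℤ b))))

  fromℤ-neg : ∀ a → fromℤ (ℤ.- a) ≡ - fromℤ a
  fromℤ-neg (+ zero)     = refl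
  fromℤ-neg (+ suc n)    = refl
  fromℤ-neg (ℤ.-[1+ n ]) = refl

  fromℤ-mono-≤ : ∀ {a b} → a ℤ.≤ b → fromℤ a ≤ fromℤ b
  fromℤ-mono-≤ h = ℚ.*≤* (ℤₚ.*-monoʳ-≤-nonNeg (+ 1) h)

  fromℤ-mono-< : ∀ {a b} → a ℤ.< b → fromℤ a < fromℤ b
  fromℤ-mono-< h = ℚ.*<* (ℤₚ.*-monoʳ-<-pos (+ 1) h)

  fromℤ-cancel-≤ : ∀ {a b} → fromℤ a ≤ fromℤ b → a ℤ.≤ b
  fromℤ-cancel-≤ {a} {b} (ℚ.*≤* h) = ℤₚ.*-cancelʳ-≤-pos a b (+ 1) h

  fromℤ-cancel-< : ∀ {a b} → fromℤ a < fromℤ b → a ℤ.< b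
  fromℤ-cancel-< {a} {b} (ℚ.*<* h) = ℤₚ.*-cancelʳ-<-nonNeg (+ 1) h

fromℕ : ℕ → ℚ
fromℕ k = fromℤ (+ k)

module _ where

  open import Data.Rational using (_+_; _*_; _-_; -_; _≤_; _<_)

  fromℤ-setSum : ∀ {n} (S : Subset n) f → fromℤ (ℤΣ.setSum S f) ≡ ℚΣ.setSum S (fromℤ ∘ f)
  fromℤ-setSum []            f = refl
  fromℤ-setSum (inside  ∷ S) f = trans (fromℤ-+ (f zero) _) (+-congʳ (fromℤ (f zero)) (fromℤ-setSum S (f ∘ suc)))
  fromℤ-setSum (outside ∷ S) f = trans (fromℤ-+ 0ℤ (ℤΣ.setSum S (f ∘ suc))) (+-congʳ 0ℚ (fromℤ-setSum S (f ∘ suc)))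

  fromℕ-setSum : ∀ {n} (S : Subset n) f → fromℕ (ℕΣ.setSum S f) ≡ ℚΣ.setSum S (fromℕ ∘ f)
  fromℕ-setSum []            f = refl
  fromℕ-setSum (inside  ∷ S) f = trans (fromℤ-+ (+ f zero) (+ ℕΣ.setSum S (f ∘ suc))) (+-congʳ (fromℕ (f zero)) (fromℕ-setSum S (f ∘ suc)))
  fromℕ-setSum (outside ∷ S) f = trans (fromℤ-+ 0ℤ (+ ℕΣ.setSum S (f ∘ suc))) (+-congʳ 0ℚ (fromℕ-setSum S (f ∘ suc)))

  ⟪_,_⟫ : ∀ {n} → (Fin n → ℚ) → (Fin n → ℚ) → ℚ
  ⟪ q , x ⟫ = sumℚ λ i → q i * x i

  χ : ∀ {n} → Subset n → Fin n → ℚ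
  χ S i = if lookup S i then 1ℚ else 0ℚ

  single : ∀ {n} → Fin n → ℚ → Fin n → ℚ
  single i α j = if lookup ⁅ i ⁆ j then α else 0ℚ

  single-≡ : ∀ {n} (i : Fin n) α → single i α i ≡ α
  single-≡ i α = cong (λ b → if b then α else 0ℚ) (∈⇒lookup (Subₚ.x∈⁅x⁆ i))

  single-≢ : ∀ {n} {i j : Fin n} α → j ≢ i → single i α j ≡ 0ℚ
  single-≢ {i = i} {j} α j≢i = cong (λ b → if b then α else 0ℚ) (∉⇒lookup {S = ⁅ i ⁆} (Subₚ.x≢y⇒x∉⁅y⁆ j≢i))

  single-0 : ∀ {n} (i j : Fin n) → single i 0ℚ j ≡ 0ℚ
  single-0 i j with lookup ⁅ i ⁆ j
  ... | true  = refl
  ... | false = refl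

  ⟪⟫-single : ∀ {n} q (i : Fin n) α → ⟪ q , single i α ⟫ ≡ q i * α
  ⟪⟫-single q i α = trans (ℚΣ.sum-cong-≗ (λ j → lemma j (lookup ⁅ i ⁆ j))) (ℚΣ.setSum-⁅⁆ i (λ j → q j * α))
    where
    lemma : ∀ j b → q j * (if b then α else 0ℚ) ≡ (if b then q j * α else 0ℚ)
    lemma j true  = refl
    lemma j false = ℚₚ.*-zeroʳ (q j)

  ⟪⟫-χ : ∀ {n} q (S : Subset n) → ⟪ q , χ S ⟫ ≡ ℚΣ.setSum S q
  ⟪⟫-χ q S = ℚΣ.sum-cong-≗ λ i → lemma i (lookup S i)
    where
    lemma : ∀ i b → q i * (if b then 1ℚ else 0ℚ) ≡ (if b then q i else 0ℚ)
    lemma i true  = ℚₚ.*-identityʳ (q i)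
    lemma i false = ℚₚ.*-zeroʳ (q i)

  ⟪⟫-cong : ∀ {n} (q : Fin n → ℚ) {x y} → (∀ i → x i ≡ y i) → ⟪ q , x ⟫ ≡ ⟪ q , y ⟫
  ⟪⟫-cong q h = ℚΣ.sum-cong-≗ λ i → cong (λ e → q i * e) (h i)

  ⟪⟫-+ : ∀ {n} (q x y : Fin n → ℚ) → ⟪ q , (λ i → x i + y i) ⟫ ≡ ⟪ q , x ⟫ + ⟪ q , y ⟫
  ⟪⟫-+ q x y = trans (ℚΣ.sum-cong-≗ λ i → ℚₚ.*-distribˡ-+ (q i) (x i) (y i)) (ℚΣ.∑-distrib-+ (λ i → q i * x i) (λ i → q i * y i))

  ⟪⟫-* : ∀ {n} (q : Fin n → ℚ) η x → ⟪ q , (λ i → η * x i) ⟫ ≡ η * ⟪ q , x ⟫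
  ⟪⟫-* {zero}  q η x = sym (ℚₚ.*-zeroʳ η)
  ⟪⟫-* {suc n} q η x = trans (cong₂ _+_ (lemma (q zero) η (x zero)) (⟪⟫-* (q ∘ suc) η (x ∘ suc)))
                             (sym (ℚₚ.*-distribˡ-+ η (q zero * x zero) _))
    where
    lemma : ∀ q η x → q * (η * x) ≡ η * (q * x)
    lemma = solve-∀ ℚ-ring

  ⟪⟫-0 : ∀ {n} (q : Fin n → ℚ) → ⟪ q , (λ _ → 0ℚ) ⟫ ≡ 0ℚ
  ⟪⟫-0 {zero}  q = refl
  ⟪⟫-0 {suc n} q = trans (cong₂ _+_ (ℚₚ.*-zeroʳ (q zero)) (⟪⟫-0 (q ∘ suc))) (ℚₚ.+-identityˡ 0ℚ)

≤∧≢⇒< : ∀ {p q} → p ℚ.≤ q → p ≢ q → p ℚ.< q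
≤∧≢⇒< {p} {q} p≤q p≢q with <⊎≥ p q
... | inj₁ p<q = p<q
... | inj₂ q≤p = ⊥-elim (p≢q (ℚₚ.≤-antisym p≤q q≤p))

*≡0-cancel : ∀ {p q} → 0ℚ ℚ.< p → p ℚ.* q ≡ 0ℚ → q ≡ 0ℚ
*≡0-cancel {p} {q} 0<p eq = ℚₚ.≤-antisym
  (0≤⇒≤ (subst (0ℚ ℚ.≤_) (sym (ℚₚ.+-identityˡ (ℚ.- q)))
    (0≤*-cancel 0<p (ℚₚ.≤-reflexive (sym (trans (sym (ℚₚ.neg-distribʳ-* p q)) (cong (λ e → ℚ.- e) eq)))))))
  (0≤*-cancel 0<p (ℚₚ.≤-reflexive (sym eq)))

0<⊓ : ∀ {p q} → 0ℚ ℚ.< p → 0ℚ ℚ.< q → 0ℚ ℚ.< p ℚ.⊓ q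
0<⊓ {p} {q} 0<p 0<q with ℚₚ.⊓-sel p q
... | inj₁ eq = subst (0ℚ ℚ.<_) (sym eq) 0<p
... | inj₂ eq = subst (0ℚ ℚ.<_) (sym eq) 0<q

-- A vanishing slack `s i` meets a vanishing rate `e i`, and every other slack is positive; the
-- minimum of finitely many positive steps is positive.
small-step : ∀ {k} (s e : Fin k → ℚ) → (∀ i → 0ℚ ℚ.≤ s i) → (∀ i → s i ≡ 0ℚ → e i ≡ 0ℚ) →
             ∃ λ η → 0ℚ ℚ.< η × (∀ i → η ℚ.* ℚ.∣ e i ∣ ℚ.≤ s i)
small-step {zero}  s e 0≤s tight = 1ℚ , ℚₚ.positive⁻¹ 1ℚ , λ ()
small-step {suc k} s e 0≤s tight with small-step (s ∘ suc) (e ∘ suc) (0≤s ∘ suc) (tight ∘ suc) | s zero ℚₚ.≟ 0ℚ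
... | η , 0<η , fits | yes s≡0 = η , 0<η , λ
  { zero    → ℚₚ.≤-reflexive (trans (cong (λ e → η ℚ.* ℚ.∣ e ∣) (tight zero s≡0)) (trans (ℚₚ.*-zeroʳ η) (sym s≡0)))
  ; (suc i) → fits i }
... | η , 0<η , fits | no s≢0 = η ℚ.⊓ η₀ , 0<⊓ 0<η 0<η₀ , λ
  { zero    → ℚₚ.≤-trans (shrink (ℚₚ.p⊓q≤q η η₀) (e zero)) (ℚₚ.≤-trans η₀*e≤ (ℚₚ.≤-reflexive η₀*d))
  ; (suc i) → ℚₚ.≤-trans (shrink (ℚₚ.p⊓q≤p η η₀) (e (suc i))) (fits i) }
  where
  -- The added 1 keeps the divisor positive even when `e zero` vanishes.
  d = ℚ.∣ e zero ∣ ℚ.+ 1ℚ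
  0<d : 0ℚ ℚ.< d
  0<d = subst (0ℚ ℚ.<_) (ℚₚ.+-comm 1ℚ ℚ.∣ e zero ∣) (0<+ (ℚₚ.positive⁻¹ 1ℚ) (ℚₚ.0≤∣p∣ (e zero)))
  instance
    d>0 : ℚ.Positive d
    d>0 = ℚ.positive 0<d
    d≢0 : ℚ.NonZero d
    d≢0 = ℚₚ.pos⇒nonZero d
  η₀ = s zero ℚ.* ℚ.1/ d
  0<s : 0ℚ ℚ.< s zero
  0<s = ≤∧≢⇒< (0≤s zero) (s≢0 ∘ sym)
  0<η₀ : 0ℚ ℚ.< η₀
  0<η₀ = 0<* 0<s (ℚₚ.positive⁻¹ (ℚ.1/ d) {{ℚₚ.1/pos⇒pos d}})
  η₀*d : η₀ ℚ.* d ≡ s zero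
  η₀*d = trans (ℚₚ.*-assoc (s zero) (ℚ.1/ d) d) (trans (cong (s zero ℚ.*_) (ℚₚ.*-inverseˡ d)) (ℚₚ.*-identityʳ (s zero)))
  η₀*e≤ : η₀ ℚ.* ℚ.∣ e zero ∣ ℚ.≤ η₀ ℚ.* d
  η₀*e≤ = by≤ (ℚₚ.<⇒≤ 0<η₀) (lemma η₀ ℚ.∣ e zero ∣)
    where
    lemma : ∀ a b → a ≡ a ℚ.* (b ℚ.+ 1ℚ) ℚ.- a ℚ.* b
    lemma = solve-∀ ℚ-ring
  shrink : ∀ {a b} → a ℚ.≤ b → ∀ x → a ℚ.* ℚ.∣ x ∣ ℚ.≤ b ℚ.* ℚ.∣ x ∣
  shrink a≤b x = ℚₚ.*-monoʳ-≤-nonNeg ℚ.∣ x ∣ {{ℚ.nonNegative (ℚₚ.0≤∣p∣ x)}} a≤b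

p≤∣p∣ : ∀ p → p ℚ.≤ ℚ.∣ p ∣
p≤∣p∣ p with ℚₚ.≤-total 0ℚ p
... | inj₁ 0≤p = ℚₚ.≤-reflexive (sym (ℚₚ.0≤p⇒∣p∣≡p 0≤p))
... | inj₂ p≤0 = ℚₚ.≤-trans p≤0 (ℚₚ.0≤∣p∣ p)

-p≤∣p∣ : ∀ p → ℚ.- p ℚ.≤ ℚ.∣ p ∣
-p≤∣p∣ p = subst (ℚ.- p ℚ.≤_) (ℚₚ.∣-p∣≡∣p∣ p) (p≤∣p∣ (ℚ.- p))

-- The linear program and its optimal vertices.

module LinearProgram (I : Instance) where

  open ColKP I
  open import Data.Rational using (_+_; _*_; _-_; -_; _≤_; _<_)

  W P : Fin n → ℚ
  W i = fromℕ (w i)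
  P i = fromℤ (p i)

  sign : Bool → ℚ
  sign b = if b then 1ℚ else - 1ℚ

  σ : Fin m → Fin n → ℚ
  σ c i = sign (does (κ i Fin.≟ c))

  color-form : ∀ c x → sumOver (colorClass c) x - sumOver (∁ (colorClass c)) x ≡ ⟪ σ c , x ⟫
  color-form c x = lemma x (colorClass c) (λ i → does (κ i Fin.≟ c)) (Vecₚ.lookup∘tabulate _)
    where
    lemma : ∀ {n} (x : Fin n → ℚ) C (g : Fin n → Bool) → (∀ i → lookup C i ≡ g i) →
            ℚΣ.setSum C x - ℚΣ.setSum (∁ C) x ≡ ⟪ sign ∘ g , x ⟫
    lemma x [] g eq = refl
    lemma x (inside ∷ C) g eq rewrite sym (eq zero) =
      trans (r (x zero) (ℚΣ.setSum C (x ∘ suc)) (ℚΣ.setSum (∁ C) (x ∘ suc))) (+-congʳ (1ℚ * x zero) (lemma (x ∘ suc) C (g ∘ suc) (eq ∘ suc)))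
      where
      r : ∀ a b c → (a + b) - (0ℚ + c) ≡ 1ℚ * a + (b - c)
      r = solve-∀ ℚ-ring
    lemma x (outside ∷ C) g eq rewrite sym (eq zero) =
      trans (r (x zero) (ℚΣ.setSum C (x ∘ suc)) (ℚΣ.setSum (∁ C) (x ∘ suc))) (+-congʳ (- 1ℚ * x zero) (lemma (x ∘ suc) C (g ∘ suc) (eq ∘ suc)))
      where
      r : ∀ a b c → (0ℚ + b) - (a + c) ≡ (- 1ℚ) * a + (b - c)
      r = solve-∀ ℚ-ring

  mkFeasible : ∀ {x} → ⟪ W , x ⟫ ≤ fromℕ b → (∀ c → ⟪ σ c , x ⟫ ≤ 1ℚ) →
               (∀ i → 0ℚ ≤ x i × x i ≤ 1ℚ) → LPFeasible x
  mkFeasible {x} cap col bnd = record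
    { capacity = cap
    ; color    = λ c → subst (_≤ 1ℚ) (sym (color-form c x)) (col c)
    ; bounds   = bnd }

  colorBound : ∀ {x} → LPFeasible x → ∀ c → ⟪ σ c , x ⟫ ≤ 1ℚ
  colorBound {x} f c = subst (_≤ 1ℚ) (color-form c x) (LPFeasible.color f c)

  module _ where

    open FourierMotzkin
    open Mem using () renaming (_∈_ to _∈ˡ_)

    capacityRow objectiveRow : Affine n
    capacityRow  = affine (λ i → - W i) 0ℚ (fromℕ b)
    objectiveRow = affine P (- 1ℚ) 0ℚ

    colorRow : Fin m → Affine n
    colorRow c = affine (λ i → - σ c i) 0ℚ 1ℚ

    boundRow : Fin n → Affine n
    boundRow i = affine (single i 1ℚ) 0ℚ 0ℚ

    -- The bounds `x i ≤ 1` are absent because `cap` supplies them at each elimination.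
    -- `objectiveRow` makes the extra coordinate `v` a lower bound on the objective, so the greatest
    -- `v` is the optimal value.
    rows : List (Affine n)
    rows = capacityRow ∷ objectiveRow ∷ List.map colorRow (List.allFin m) List.++ List.map boundRow (List.allFin n)

    -- Bounds the objective on the unit cube, so that the coordinate `v` has a greatest value.
    ceilingValue : ℚ
    ceilingValue = sumℚ λ i → ℚ.∣ P i ∣

    negated : ∀ {n} (q : Fin n → ℚ) c v x → eval (affine (λ i → - q i) 0ℚ c) v x ≡ c - ⟪ q , x ⟫
    negated q c v x = trans (eval-affine (λ i → - q i) 0ℚ c v x)
      (trans (cong (_+ (0ℚ * v + c)) (neg-sum q x)) (lemma ⟪ q , x ⟫ c v))
      where
      lemma : ∀ s c v → - s + (0ℚ * v + c) ≡ c - s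
      lemma = solve-∀ ℚ-ring
      neg-sum : ∀ {n} (q x : Fin n → ℚ) → ⟪ (λ i → - q i) , x ⟫ ≡ - ⟪ q , x ⟫
      neg-sum {zero}  q x = refl
      neg-sum {suc n} q x = trans (+-congʳ (- q zero * x zero) (neg-sum (q ∘ suc) (x ∘ suc))) (r (q zero) (x zero) ⟪ q ∘ suc , x ∘ suc ⟫)
        where
        r : ∀ a b c → - a * b + - c ≡ - (a * b + c)
        r = solve-∀ ℚ-ring

    eval-objective : ∀ v x → eval objectiveRow v x ≡ objective x - v
    eval-objective v x = trans (eval-affine P (- 1ℚ) 0ℚ v x) (lemma (objective x) v)
      where
      lemma : ∀ s v → s + (- 1ℚ * v + 0ℚ) ≡ s - v
      lemma = solve-∀ ℚ-ring

    eval-bound : ∀ v x i → eval (boundRow i) v x ≡ x i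
    eval-bound v x i = trans (eval-affine (single i 1ℚ) 0ℚ 0ℚ v x)
      (trans (cong (_+ (0ℚ * v + 0ℚ)) (trans (ℚΣ.sum-cong-≗ (λ j → ℚₚ.*-comm (single i 1ℚ j) (x j))) (⟪⟫-single x i 1ℚ))) (lemma (x i) v))
      where
      lemma : ∀ a v → a * 1ℚ + (0ℚ * v + 0ℚ) ≡ a
      lemma = solve-∀ ℚ-ring

    objective≤ceiling : ∀ x → (∀ i → 0ℚ ≤ x i × x i ≤ 1ℚ) → objective x ≤ ceilingValue
    objective≤ceiling x bnd = sumℚ-mono λ i →
      by≤ (0≤+ (0≤* (proj₁ (bnd i)) (≤⇒0≤ (p≤∣p∣ (P i)))) (0≤* (ℚₚ.0≤∣p∣ (P i)) (≤⇒0≤ (proj₂ (bnd i))))) (lemma (x i) (P i) ℚ.∣ P i ∣)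
      where
      lemma : ∀ x p a → x * (a - p) + a * (1ℚ - x) ≡ a - p * x
      lemma = solve-∀ ℚ-ring

    toMember : ∀ {v x} → LPFeasible x → v ≤ objective x → Member rows ceilingValue v x
    toMember {v} {x} f v≤ = member sat (λ i → proj₂ (bounds i)) (ℚₚ.≤-trans v≤ (objective≤ceiling x bounds))
      where
      open LPFeasible f
      sat : Satisfies rows v x
      sat (here refl)         = subst (0ℚ ≤_) (sym (negated W (fromℕ b) v x)) (≤⇒0≤ capacity)
      sat (there (here refl)) = subst (0ℚ ≤_) (sym (eval-objective v x)) (≤⇒0≤ v≤)
      sat (there (there g∈)) with Memₚ.∈-++⁻ (List.map colorRow (List.allFin m)) g∈
      ... | inj₁ h with Memₚ.∈-map⁻ colorRow h
      ...   | c , _ , refl = subst (0ℚ ≤_) (sym (negated (σ c) 1ℚ v x)) (≤⇒0≤ (colorBound f c))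
      sat (there (there g∈)) | inj₂ h with Memₚ.∈-map⁻ boundRow h
      ...   | i , _ , refl = subst (0ℚ ≤_) (sym (eval-bound v x i)) (proj₁ (bounds i))

    fromMember : ∀ {u v x} → Member rows u v x → LPFeasible x × v ≤ objective x
    fromMember {u} {v} {x} (member sat x≤1 _) =
      mkFeasible (0≤⇒≤ (subst (0ℚ ≤_) (negated W (fromℕ b) v x) (sat (here refl))))
        (λ c → 0≤⇒≤ (subst (0ℚ ≤_) (negated (σ c) 1ℚ v x)
                 (sat (there (there (Memₚ.∈-++⁺ˡ (Memₚ.∈-map⁺ colorRow (Memₚ.∈-allFin c))))))))
        (λ i → subst (0ℚ ≤_) (eval-bound v x i)
                 (sat (there (there (Memₚ.∈-++⁺ʳ (List.map colorRow (List.allFin m)) (Memₚ.∈-map⁺ boundRow (Memₚ.∈-allFin i)))))) ,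
               x≤1 i) ,
      0≤⇒≤ (subst (0ℚ ≤_) (eval-objective v x) (sat (there (here refl))))

    zero-feasible : LPFeasible (λ _ → 0ℚ)
    zero-feasible = mkFeasible
      (ℚₚ.≤-trans (ℚₚ.≤-reflexive (⟪⟫-0 W)) (fromℤ-mono-≤ (ℤ.+≤+ ℕ.z≤n)))
      (λ c → ℚₚ.≤-trans (ℚₚ.≤-reflexive (⟪⟫-0 (σ c))) (ℚₚ.nonNegative⁻¹ 1ℚ))
      (λ _ → ℚₚ.≤-refl , ℚₚ.nonNegative⁻¹ 1ℚ)

    -- If the optimum is a proper convex combination of feasible `y` and `z`, then both are optimal,
    -- since the objective is linear. Hence both are members at the same `v`, where `isExtreme`
    -- applies.
    optimal-vertex : ∃ OptimalExtremePoint
    optimal-vertex = x , record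
      { feasible = proj₁ (fromMember isMember)
      ; optimal  = below
      ; extreme  = λ y z fy fz t 0<t t<1 eq →
          let (obj-y , obj-z) = convex-extreme 0<t t<1 (below y fy) (below z fz) (objective-convex t y z eq)
              v≤ = proj₂ (fromMember isMember)
          in isExtreme (toMember fy (ℚₚ.≤-trans v≤ (ℚₚ.≤-reflexive (sym obj-y))))
                       (toMember fz (ℚₚ.≤-trans v≤ (ℚₚ.≤-reflexive (sym obj-z)))) 0<t t<1 eq }
      where
      open MaximalVertex (maximal-vertex rows ceilingValue (toMember zero-feasible ℚₚ.≤-refl))
      below : ∀ y → LPFeasible y → objective y ≤ objective x
      below y fy = ℚₚ.≤-trans (isMaximal (toMember fy ℚₚ.≤-refl)) (proj₂ (fromMember isMember))
      objective-convex : ∀ t y z → (∀ i → x i ≡ t * y i + (1ℚ - t) * z i) →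
                         objective x ≡ t * objective y + (1ℚ - t) * objective z
      objective-convex t y z eq = trans (⟪⟫-cong P eq)
        (trans (⟪⟫-+ P (λ i → t * y i) (λ i → (1ℚ - t) * z i)) (cong₂ _+_ (⟪⟫-* P t y) (⟪⟫-* P (1ℚ - t) z)))

  module Vertex {x : Fin n → ℚ} (vertex : OptimalExtremePoint x) where

    open OptimalExtremePoint vertex
    open LPFeasible feasible using (capacity; bounds)

    perturb : ∀ η δ → ⟪ W , δ ⟫ ≡ 0ℚ → (∀ c → η * ⟪ σ c , δ ⟫ ≤ 1ℚ - ⟪ σ c , x ⟫) →
              (∀ i → - (η * δ i) ≤ x i × η * δ i ≤ 1ℚ - x i) → LPFeasible (λ i → x i + η * δ i)
    perturb η δ Wδ≡0 col bnd = mkFeasible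
      (subst (_≤ fromℕ b) (sym (trans (split W) (trans (+-congʳ ⟪ W , x ⟫ (trans (cong (λ e → η * e) Wδ≡0) (ℚₚ.*-zeroʳ η))) (ℚₚ.+-identityʳ ⟪ W , x ⟫)))) capacity)
      (λ c → ℚₚ.≤-trans (ℚₚ.≤-reflexive (split (σ c))) (by≤ (≤⇒0≤ (col c)) (r₁ ⟪ σ c , x ⟫ (η * ⟪ σ c , δ ⟫))))
      (λ i → by≤ (≤⇒0≤ (proj₁ (bnd i))) (r₂ (x i) (η * δ i)) , by≤ (≤⇒0≤ (proj₂ (bnd i))) (r₁ (x i) (η * δ i)))
      where
      split : ∀ q → ⟪ q , (λ i → x i + η * δ i) ⟫ ≡ ⟪ q , x ⟫ + η * ⟪ q , δ ⟫
      split q = trans (⟪⟫-+ q x (λ i → η * δ i)) (+-congʳ ⟪ q , x ⟫ (⟪⟫-* q η δ))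
      r₁ : ∀ a b → 1ℚ - a - b ≡ 1ℚ - (a + b)
      r₁ = solve-∀ ℚ-ring
      r₂ : ∀ a b → a - (- b) ≡ a + b - 0ℚ
      r₂ = solve-∀ ℚ-ring

    -- A direction supported on the fractional entries that preserves the weight and the tight color
    -- constraints can be followed a little both ways. The vertex is the midpoint of the two
    -- resulting feasible points, so the direction is zero.
    rigid : ∀ δ → (∀ i → x i ≡ 0ℚ ⊎ x i ≡ 1ℚ → δ i ≡ 0ℚ) → ⟪ W , δ ⟫ ≡ 0ℚ →
            (∀ c → ⟪ σ c , x ⟫ ≡ 1ℚ → ⟪ σ c , δ ⟫ ≡ 0ℚ) → ∀ i → δ i ≡ 0ℚ
    rigid δ integral Wδ≡0 tight = ηδ≡0
      where
      zero-gap : ∀ {a} → 1ℚ - a ≡ 0ℚ → a ≡ 1ℚ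
      zero-gap {a} h = trans (lemma a) (trans (cong (λ e → 1ℚ - e) h) (ℚₚ.+-identityʳ 1ℚ))
        where
        lemma : ∀ a → a ≡ 1ℚ - (1ℚ - a)
        lemma = solve-∀ ℚ-ring
      lower = small-step x δ (proj₁ ∘ bounds) (λ i → integral i ∘ inj₁)
      upper = small-step (λ i → 1ℚ - x i) δ (λ i → ≤⇒0≤ (proj₂ (bounds i))) (λ i h → integral i (inj₂ (zero-gap h)))
      colors = small-step (λ c → 1ℚ - ⟪ σ c , x ⟫) (λ c → ⟪ σ c , δ ⟫) (λ c → ≤⇒0≤ (colorBound feasible c))
                 (λ c h → tight c (zero-gap h))
      -- One step length that respects the lower bounds, the upper bounds and the slacks of all
      -- colors at once.
      η = proj₁ lower ℚ.⊓ (proj₁ upper ℚ.⊓ proj₁ colors)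
      0<η : 0ℚ < η
      0<η = 0<⊓ (proj₁ (proj₂ lower)) (0<⊓ (proj₁ (proj₂ upper)) (proj₁ (proj₂ colors)))
      module _ {η₀ : ℚ} (η≤η₀ : η ≤ η₀) {e s : ℚ} (fits : η₀ * ℚ.∣ e ∣ ≤ s) where
        forth : η * e ≤ s
        forth = ℚₚ.≤-trans (by≤ (0≤+ (0≤* (≤⇒0≤ η≤η₀) (ℚₚ.0≤∣p∣ e)) (0≤* (ℚₚ.<⇒≤ 0<η) (≤⇒0≤ (p≤∣p∣ e)))) (lemma η η₀ e ℚ.∣ e ∣)) fits
          where
          lemma : ∀ a b e f → (b - a) * f + a * (f - e) ≡ b * f - a * e
          lemma = solve-∀ ℚ-ring
        back : - (η * e) ≤ s
        back = ℚₚ.≤-trans (by≤ (0≤+ (0≤* (≤⇒0≤ η≤η₀) (ℚₚ.0≤∣p∣ e)) (0≤* (ℚₚ.<⇒≤ 0<η) (≤⇒0≤ (-p≤∣p∣ e)))) (lemma η η₀ e ℚ.∣ e ∣)) fits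
          where
          lemma : ∀ a b e f → (b - a) * f + a * (f - (- e)) ≡ b * f - (- (a * e))
          lemma = solve-∀ ℚ-ring
      η≤lower : η ≤ proj₁ lower
      η≤lower = ℚₚ.p⊓q≤p (proj₁ lower) _
      η≤rest : η ≤ proj₁ upper ℚ.⊓ proj₁ colors
      η≤rest = ℚₚ.p⊓q≤q (proj₁ lower) _
      η≤upper : η ≤ proj₁ upper
      η≤upper = ℚₚ.≤-trans η≤rest (ℚₚ.p⊓q≤p (proj₁ upper) _)
      η≤colors : η ≤ proj₁ colors
      η≤colors = ℚₚ.≤-trans η≤rest (ℚₚ.p⊓q≤q (proj₁ upper) _)
      negate : ∀ {e s} → η * e ≤ s → - (- η * e) ≤ s
      negate {e} {s} = subst (_≤ s) (lemma η e)
        where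
        lemma : ∀ a b → a * b ≡ - (- a * b)
        lemma = solve-∀ ℚ-ring
      negate′ : ∀ {e s} → - (η * e) ≤ s → - η * e ≤ s
      negate′ {e} {s} = subst (_≤ s) (lemma η e)
        where
        lemma : ∀ a b → - (a * b) ≡ - a * b
        lemma = solve-∀ ℚ-ring
      y z : Fin n → ℚ
      y i = x i + η * δ i
      z i = x i + (- η) * δ i
      y-feasible : LPFeasible y
      y-feasible = perturb η δ Wδ≡0 (λ c → forth η≤colors (proj₂ (proj₂ colors) c))
        (λ i → back η≤lower (proj₂ (proj₂ lower) i) , forth η≤upper (proj₂ (proj₂ upper) i))
      z-feasible : LPFeasible z
      z-feasible = perturb (- η) δ Wδ≡0 (λ c → negate′ {⟪ σ c , δ ⟫} (back η≤colors (proj₂ (proj₂ colors) c)))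
        (λ i → negate {δ i} (forth η≤lower (proj₂ (proj₂ lower) i)) , negate′ {δ i} (back η≤upper (proj₂ (proj₂ upper) i)))
      midpoint : ∀ i → x i ≡ ℚ.½ * y i + (1ℚ - ℚ.½) * z i
      midpoint i = lemma (x i) η (δ i)
        where
        lemma : ∀ a b c → a ≡ ℚ.½ * (a + b * c) + (1ℚ - ℚ.½) * (a + (- b) * c)
        lemma = solve-∀ ℚ-ring
      y≡z : ∀ i → y i ≡ z i
      y≡z = extreme y z y-feasible z-feasible ℚ.½ (ℚₚ.positive⁻¹ ℚ.½) (ℚ.*<* (ℤ.+<+ (ℕ.s≤s (ℕ.s≤s ℕ.z≤n)))) midpoint
      ηδ≡0 : ∀ i → δ i ≡ 0ℚ
      ηδ≡0 i = *≡0-cancel (0<+ 0<η (ℚₚ.<⇒≤ 0<η))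
        (trans (lemma (x i) η (δ i)) (trans (cong (λ e → y i - e) (sym (y≡z i))) (ℚₚ.+-inverseʳ (y i))))
        where
        lemma : ∀ x a b → (a + a) * b ≡ (x + a * b) - (x + - a * b)
        lemma = solve-∀ ℚ-ring

-- Fractional entries of a vertex.

module VertexShape (I : Instance) {x : Fin (Instance.n I) → ℚ} (vertex : ColKP.OptimalExtremePoint I x) where

  open ColKP I
  open LinearProgram I
  open Vertex vertex
  open OptimalExtremePoint vertex using (feasible)
  open LPFeasible feasible using (bounds)
  open import Data.Rational using (_+_; _*_; _-_; -_; _≤_; _<_)

  Tight : Fin m → Set
  Tight c = ⟪ σ c , x ⟫ ≡ 1ℚ

  Fractional : Fin n → Set
  Fractional i = ¬ (x i ≡ 0ℚ ⊎ x i ≡ 1ℚ)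

  integral? : ∀ i → Dec (x i ≡ 0ℚ ⊎ x i ≡ 1ℚ)
  integral? i = (x i ℚₚ.≟ 0ℚ) Decidable.⊎-dec (x i ℚₚ.≟ 1ℚ)

  0<W : ∀ i → 0ℚ < W i
  0<W i = fromℤ-mono-< (ℤ.+<+ (0<w i))

  σ-same : ∀ {c i} → κ i ≡ c → σ c i ≡ 1ℚ
  σ-same {c} {i} eq with κ i Fin.≟ c
  ... | yes _  = refl
  ... | no  ne = ⊥-elim (ne eq)

  σ-other : ∀ {c i} → κ i ≢ c → σ c i ≡ - 1ℚ
  σ-other {c} {i} ne with κ i Fin.≟ c
  ... | yes eq = ⊥-elim (ne eq)
  ... | no  _  = refl

  σ-values : ∀ c i → σ c i ≡ 1ℚ ⊎ σ c i ≡ - 1ℚ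
  σ-values c i with κ i Fin.≟ c
  ... | yes _ = inj₁ refl
  ... | no  _ = inj₂ refl

  -- On each item the signs of two different colors cancel or are both -1, and `x` is nonnegative.
  opposed : ∀ {c c′} → c ≢ c′ → ⟪ σ c , x ⟫ + ⟪ σ c′ , x ⟫ ≤ 0ℚ
  opposed {c} {c′} c≢c′ = ℚₚ.≤-trans
    (ℚₚ.≤-reflexive (sym (ℚΣ.∑-distrib-+ (λ i → σ c i * x i) (λ i → σ c′ i * x i))))
    (ℚₚ.≤-trans (sumℚ-mono pointwise) (ℚₚ.≤-reflexive (ℚΣ.sum-replicate-zero n)))
    where
    pointwise : ∀ i → σ c i * x i + σ c′ i * x i ≤ 0ℚ
    pointwise i = case κ i Fin.≟ c of λ
      { (yes eq) → ℚₚ.≤-reflexive (trans (cong₂ (λ s t → s * x i + t * x i) (σ-same {c} eq) (σ-other {c′} (λ eq′ → c≢c′ (trans (sym eq) eq′)))) (cancel (x i)))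
      ; (no ne) → case σ-values c′ i of λ
        { (inj₁ e) → ℚₚ.≤-reflexive (trans (cong₂ (λ s t → s * x i + t * x i) (σ-other {c} ne) e) (cancel′ (x i)))
        ; (inj₂ e) → ℚₚ.≤-trans (ℚₚ.≤-reflexive (cong₂ (λ s t → s * x i + t * x i) (σ-other {c} ne) e))
                       (by≤ (0≤+ (proj₁ (bounds i)) (proj₁ (bounds i))) (double (x i))) } }
      where
      cancel : ∀ a → 1ℚ * a + - 1ℚ * a ≡ 0ℚ
      cancel = solve-∀ ℚ-ring
      cancel′ : ∀ a → - 1ℚ * a + 1ℚ * a ≡ 0ℚ
      cancel′ = solve-∀ ℚ-ring
      double : ∀ a → a + a ≡ 0ℚ - (- 1ℚ * a + - 1ℚ * a)
      double = solve-∀ ℚ-ring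

  tight-unique : ∀ {c c′} → Tight c → Tight c′ → c ≡ c′
  tight-unique {c} {c′} t t′ with c Fin.≟ c′
  ... | yes eq = eq
  ... | no  ne = ⊥-elim (ℚₚ.<-irrefl refl (ℚₚ.<-≤-trans (ℚₚ.positive⁻¹ (1ℚ + 1ℚ))
                   (subst₂ (λ a b → a + b ≤ 0ℚ) t t′ (opposed ne))))

  -- The items may coincide: a direction on two items is obtained with `l` equal to `j` and
  -- coefficient `c` equal to 0.
  rigid₃ : ∀ {i j l} → Fractional i → Fractional j → Fractional l → ∀ a b c →
           W i * a + W j * b + W l * c ≡ 0ℚ →
           (∀ d → Tight d → σ d i * a + σ d j * b + σ d l * c ≡ 0ℚ) →
           ∀ k → single i a k + single j b k + single l c k ≡ 0ℚ
  rigid₃ {i} {j} {l} fi fj fl a b c Wδ≡0 tight = rigid _ integral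
    (trans (expand W) Wδ≡0) (λ d t → trans (expand (σ d)) (tight d t))
    where
    expand : ∀ q → ⟪ q , (λ k → single i a k + single j b k + single l c k) ⟫ ≡ q i * a + q j * b + q l * c
    expand q = trans (⟪⟫-+ q (λ k → single i a k + single j b k) (single l c))
      (cong₂ _+_ (trans (⟪⟫-+ q (single i a) (single j b)) (cong₂ _+_ (⟪⟫-single q i a) (⟪⟫-single q j b))) (⟪⟫-single q l c))
    integral : ∀ k → x k ≡ 0ℚ ⊎ x k ≡ 1ℚ → single i a k + single j b k + single l c k ≡ 0ℚ
    integral k h = cong₂ _+_ (cong₂ _+_ (single-≢ a (avoid fi)) (single-≢ b (avoid fj))) (single-≢ c (avoid fl))
      where
      avoid : ∀ {i} → Fractional i → k ≢ i
      avoid fi refl = fi h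

  at-support₂ : ∀ {i j : Fin n} → i ≢ j → ∀ a b c → single i a i + single j b i + single j c i ≡ a
  at-support₂ {i} {j} i≢j a b c =
    trans (cong₂ _+_ (cong₂ _+_ (single-≡ i a) (single-≢ b i≢j)) (single-≢ c i≢j)) (lemma a)
    where
    lemma : ∀ a → a + 0ℚ + 0ℚ ≡ a
    lemma = solve-∀ ℚ-ring

  -- The exchange direction with entries `W j` at `i` and `- W i` at `j` preserves the weight.
  -- Without tight colors it would have to vanish, although `W j` is positive.
  fractional-pair⇒tight : ∀ {i j} → i ≢ j → Fractional i → Fractional j → ¬ (∀ c → ¬ Tight c)
  fractional-pair⇒tight {i} {j} i≢j fi fj slack = ℚₚ.<-irrefl
    (sym (trans (sym (at-support₂ i≢j (W j) (- W i) 0ℚ))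
      (rigid₃ fi fj fj (W j) (- W i) 0ℚ (lemma (W i) (W j)) (λ d t → ⊥-elim (slack d t)) i)))
    (0<W j)
    where
    lemma : ∀ a b → a * b + b * - a + b * 0ℚ ≡ 0ℚ
    lemma = solve-∀ ℚ-ring

  -- The cross product of (wᵢ, wⱼ, wₗ) and the signs is orthogonal to both; if
  -- its l-th entry vanishes then eᵢ − eⱼ is.
  no-fractional-triple : ∀ {c i j l} → Tight c → i ≢ j → i ≢ l → j ≢ l →
                         Fractional i → Fractional j → ¬ Fractional l
  no-fractional-triple {c} {i} {j} {l} tc i≢j i≢l j≢l fi fj fl = by-signs (σ-values c i) (σ-values c j)
    where
    sᵢ = σ c i
    sⱼ = σ c j
    sₗ = σ c l
    orthogonal : ∀ a b c s t u → a * (b * u - c * t) + b * (c * s - a * u) + c * (a * t - b * s) ≡ 0ℚ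
    orthogonal = solve-∀ ℚ-ring
    orthogonal′ : ∀ a b c s t u → s * (b * u - c * t) + t * (c * s - a * u) + u * (a * t - b * s) ≡ 0ℚ
    orthogonal′ = solve-∀ ℚ-ring
    difference : ∀ a b → a * 1ℚ + a * - 1ℚ + b * 0ℚ ≡ 0ℚ
    difference = solve-∀ ℚ-ring
    proportional : W i * sⱼ - W j * sᵢ ≡ 0ℚ
    proportional = trans
      (sym (trans (cong₂ _+_ (cong₂ _+_ (single-≢ (W j * sₗ - W l * sⱼ) (i≢l ∘ sym)) (single-≢ (W l * sᵢ - W i * sₗ) (j≢l ∘ sym))) (single-≡ l (W i * sⱼ - W j * sᵢ)))
                  (ℚₚ.+-identityˡ (W i * sⱼ - W j * sᵢ))))
      (rigid₃ fi fj fl (W j * sₗ - W l * sⱼ) (W l * sᵢ - W i * sₗ) (W i * sⱼ - W j * sᵢ)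
        (orthogonal (W i) (W j) (W l) sᵢ sⱼ sₗ)
        (λ d td → case tight-unique {d} {c} td tc of λ { refl → orthogonal′ (W i) (W j) (W l) sᵢ sⱼ sₗ }) l)
    alike : W i ≡ W j → sᵢ ≡ sⱼ → Data.Empty.⊥
    alike Wᵢ≡Wⱼ sᵢ≡sⱼ = ℚₚ.1≢0 (trans (sym (at-support₂ i≢j 1ℚ (- 1ℚ) 0ℚ))
      (rigid₃ fi fj fj 1ℚ (- 1ℚ) 0ℚ
        (trans (cong (λ e → e * 1ℚ + W j * - 1ℚ + W j * 0ℚ) Wᵢ≡Wⱼ) (difference (W j) (W j)))
        (λ d td → case tight-unique {d} {c} td tc of λ
          { refl → trans (cong (λ e → e * 1ℚ + sⱼ * - 1ℚ + sⱼ * 0ℚ) sᵢ≡sⱼ) (difference sⱼ sⱼ) }) i))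
    opposite : W i + W j ≡ 0ℚ → Data.Empty.⊥
    opposite eq = ℚₚ.<-irrefl (sym eq) (0<+ (0<W i) (ℚₚ.<⇒≤ (0<W j)))
    r₁ : ∀ a b → a ≡ (a * 1ℚ - b * 1ℚ) + b
    r₁ = solve-∀ ℚ-ring
    r₂ : ∀ a b → a ≡ - (a * - 1ℚ - b * - 1ℚ) + b
    r₂ = solve-∀ ℚ-ring
    r₃ : ∀ a b → a + b ≡ a * 1ℚ - b * - 1ℚ
    r₃ = solve-∀ ℚ-ring
    r₄ : ∀ a b → a + b ≡ - (a * - 1ℚ - b * 1ℚ)
    r₄ = solve-∀ ℚ-ring
    by-signs : sᵢ ≡ 1ℚ ⊎ sᵢ ≡ - 1ℚ → sⱼ ≡ 1ℚ ⊎ sⱼ ≡ - 1ℚ → Data.Empty.⊥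
    by-signs (inj₁ p) (inj₁ q) = alike (trans (r₁ (W i) (W j)) (trans (cong (_+ W j)
      (subst₂ (λ s t → W i * t - W j * s ≡ 0ℚ) p q proportional)) (ℚₚ.+-identityˡ (W j)))) (trans p (sym q))
    by-signs (inj₂ p) (inj₂ q) = alike (trans (r₂ (W i) (W j)) (trans (cong (λ e → - e + W j)
      (subst₂ (λ s t → W i * t - W j * s ≡ 0ℚ) p q proportional)) (ℚₚ.+-identityˡ (W j)))) (trans p (sym q))
    by-signs (inj₂ p) (inj₁ q) = opposite (trans (r₃ (W i) (W j)) (subst₂ (λ s t → W i * t - W j * s ≡ 0ℚ) p q proportional))
    by-signs (inj₁ p) (inj₂ q) = opposite (trans (r₄ (W i) (W j)) (cong (λ e → - e) (subst₂ (λ s t → W i * t - W j * s ≡ 0ℚ) p q proportional)))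

  Ones : Subset n
  Ones = onesOf x

  -- A uniform description of vertices with at most two fractional entries: missing ones get
  -- coefficient 0 on an arbitrary item, so `i` and `j` may coincide. `tightOr` retains that a
  -- genuine second entry requires a tight color.
  record Shape : Set where
    field
      i j     : Fin n
      α β     : ℚ
      0≤α     : 0ℚ ≤ α
      α<1     : α < 1ℚ
      0≤β     : 0ℚ ≤ β
      β<1     : β < 1ℚ
      form    : ∀ k → x k ≡ χ Ones k + single i α k + single j β k
      tightOr : β ≡ 0ℚ ⊎ ∃ Tight

    expand : ∀ q → ⟪ q , x ⟫ ≡ ℚΣ.setSum Ones q + q i * α + q j * β
    expand q = trans (⟪⟫-cong q form) (trans (⟪⟫-+ q (λ k → χ Ones k + single i α k) (single j β))
      (cong₂ _+_ (trans (⟪⟫-+ q (χ Ones) (single i α)) (cong₂ _+_ (⟪⟫-χ q Ones) (⟪⟫-single q i α))) (⟪⟫-single q j β)))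

  χ-Ones : ∀ k → χ Ones k ≡ (if does (x k ℚₚ.≟ 1ℚ) then 1ℚ else 0ℚ)
  χ-Ones k = cong (λ e → if e then 1ℚ else 0ℚ) (Vecₚ.lookup∘tabulate (λ i → does (x i ℚₚ.≟ 1ℚ)) k)

  χ-integral : ∀ k → x k ≡ 0ℚ ⊎ x k ≡ 1ℚ → x k ≡ χ Ones k
  χ-integral k h = trans (lemma h) (sym (χ-Ones k))
    where
    lemma : x k ≡ 0ℚ ⊎ x k ≡ 1ℚ → x k ≡ (if does (x k ℚₚ.≟ 1ℚ) then 1ℚ else 0ℚ)
    lemma h with x k ℚₚ.≟ 1ℚ
    lemma h         | yes eq = eq
    lemma (inj₁ eq) | no  _  = eq
    lemma (inj₂ eq) | no  ne = ⊥-elim (ne eq)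

  χ-fractional : ∀ {k} → Fractional k → χ Ones k ≡ 0ℚ
  χ-fractional {k} f = trans (χ-Ones k) lemma
    where
    lemma : (if does (x k ℚₚ.≟ 1ℚ) then 1ℚ else 0ℚ) ≡ 0ℚ
    lemma with x k ℚₚ.≟ 1ℚ
    ... | yes eq = ⊥-elim (f (inj₂ eq))
    ... | no  _  = refl

  fractional<1 : ∀ {i} → Fractional i → x i < 1ℚ
  fractional<1 {i} f = ≤∧≢⇒< (proj₂ (bounds i)) (f ∘ inj₂)

  some-item : Fin n
  some-item = lemma n
    where
    lemma : ∀ n → .{{ℕ.NonZero n}} → Fin n
    lemma (suc n) = zero

  shape : Shape
  shape with Finₚ.any? (λ i → Decidable.¬? (integral? i))
  ... | no none = record
    { i = some-item ; j = some-item ; α = 0ℚ ; β = 0ℚ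
    ; 0≤α = ℚₚ.≤-refl ; α<1 = ℚₚ.positive⁻¹ 1ℚ ; 0≤β = ℚₚ.≤-refl ; β<1 = ℚₚ.positive⁻¹ 1ℚ
    ; form = λ k → trans (χ-integral k (Decidable.decidable-stable (integral? k) λ f → none (k , f)))
        (sym (trans (cong₂ (λ a b → χ Ones k + a + b) (single-0 some-item k) (single-0 some-item k)) (lemma (χ Ones k))))
    ; tightOr = inj₁ refl }
    where
    lemma : ∀ a → a + 0ℚ + 0ℚ ≡ a
    lemma = solve-∀ ℚ-ring
  ... | yes (i , fi) with Finₚ.any? (λ j → Decidable.¬? (i Fin.≟ j) Decidable.×-dec Decidable.¬? (integral? j))
  ...   | no none = record
    { i = i ; j = i ; α = x i ; β = 0ℚ
    ; 0≤α = proj₁ (bounds i) ; α<1 = fractional<1 fi ; 0≤β = ℚₚ.≤-refl ; β<1 = ℚₚ.positive⁻¹ 1ℚ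
    ; form = form ; tightOr = inj₁ refl }
    where
    r₁ : ∀ a → 0ℚ + a + 0ℚ ≡ a
    r₁ = solve-∀ ℚ-ring
    r₂ : ∀ a → a + 0ℚ + 0ℚ ≡ a
    r₂ = solve-∀ ℚ-ring
    form : ∀ k → x k ≡ χ Ones k + single i (x i) k + single i 0ℚ k
    form k with k Fin.≟ i
    ... | yes refl = sym (trans (cong₂ _+_ (cong₂ _+_ (χ-fractional fi) (single-≡ i (x i))) (single-0 i i)) (r₁ (x i)))
    ... | no  k≢i  = sym (trans (cong₂ _+_ (cong₂ _+_ (sym (χ-integral k
                       (Decidable.decidable-stable (integral? k) λ f → none (k , k≢i ∘ sym , f)))) (single-≢ (x i) k≢i)) (single-0 i k)) (r₂ (x k)))
  ...   | yes (j , i≢j , fj) with Finₚ.any? (λ c → ⟪ σ c , x ⟫ ℚₚ.≟ 1ℚ)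
  ...     | no slack = ⊥-elim (fractional-pair⇒tight i≢j fi fj (λ c t → slack (c , t)))
  ...     | yes (c , tc) = record
    { i = i ; j = j ; α = x i ; β = x j
    ; 0≤α = proj₁ (bounds i) ; α<1 = fractional<1 fi ; 0≤β = proj₁ (bounds j) ; β<1 = fractional<1 fj
    ; form = form ; tightOr = inj₂ (c , tc) }
    where
    r₁ : ∀ a → 0ℚ + a + 0ℚ ≡ a
    r₁ = solve-∀ ℚ-ring
    r₂ : ∀ a → a + 0ℚ + 0ℚ ≡ a
    r₂ = solve-∀ ℚ-ring
    r₃ : ∀ a → 0ℚ + 0ℚ + a ≡ a
    r₃ = solve-∀ ℚ-ring
    form : ∀ k → x k ≡ χ Ones k + single i (x i) k + single j (x j) k
    form k with k Fin.≟ i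
    ... | yes refl = sym (trans (cong₂ _+_ (cong₂ _+_ (χ-fractional fi) (single-≡ i (x i))) (single-≢ (x j) i≢j)) (r₁ (x i)))
    ... | no  k≢i with k Fin.≟ j
    ...   | yes refl = sym (trans (cong₂ _+_ (cong₂ _+_ (χ-fractional fj) (single-≢ (x i) k≢i)) (single-≡ j (x j))) (r₃ (x j)))
    ...   | no  k≢j  = sym (trans (cong₂ _+_ (cong₂ _+_ (sym (χ-integral k (Decidable.decidable-stable (integral? k)
                         (no-fractional-triple tc i≢j (k≢i ∘ sym) (k≢j ∘ sym) fi fj)))) (single-≢ (x i) k≢i)) (single-≢ (x j) k≢j)) (r₂ (x k)))

-- Finite extrema and color counts.

module ℤExtrema = Data.List.Extrema ℤₚ.≤-totalOrder

fromℕ-suc : ∀ k → fromℕ (suc k) ≡ 1ℚ ℚ.+ fromℕ k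
fromℕ-suc k = fromℤ-+ (+ 1) (+ k)

maximumℤ-attained : ∀ {n} .{{_ : ℕ.NonZero n}} (f : Fin n → ℤ) → ∃ λ i → f i ≡ maximumℤ f
maximumℤ-attained {suc zero}    f = zero , refl
maximumℤ-attained {suc (suc n)} f with ℤₚ.⊔-sel (f zero) (maximumℤ (f ∘ suc)) | maximumℤ-attained (f ∘ suc)
... | inj₁ eq | _       = zero , sym eq
... | inj₂ eq | i , eq′ = suc i , trans eq′ (sym eq)

≤foldr-⊔ : ∀ {m} (f : Fin m → ℕ) c → f c ℕ.≤ Fn.foldr ℕ._⊔_ 0 f
≤foldr-⊔ f zero    = ℕₚ.m≤m⊔n (f zero) _
≤foldr-⊔ f (suc c) = ℕₚ.≤-trans (≤foldr-⊔ (f ∘ suc) c) (ℕₚ.m≤n⊔m (f zero) _)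

foldr-⊔-attained : ∀ {m} (f : Fin m → ℕ) → Fn.foldr ℕ._⊔_ 0 f ≡ 0 ⊎ ∃ λ c → f c ≡ Fn.foldr ℕ._⊔_ 0 f
foldr-⊔-attained {zero}  f = inj₁ refl
foldr-⊔-attained {suc m} f with ℕₚ.⊔-sel (f zero) (Fn.foldr ℕ._⊔_ 0 (f ∘ suc)) | foldr-⊔-attained (f ∘ suc)
... | inj₁ eq | _              = inj₂ (zero , sym eq)
... | inj₂ eq | inj₁ eq′       = inj₁ (trans eq eq′)
... | inj₂ eq | inj₂ (c , eq′) = inj₂ (suc c , trans eq′ (sym eq))

minimal-element : ∀ {n} (f : Fin n → ℤ) {S : Subset n} {i} → i ∈ S → ∃ λ j → j ∈ S × (∀ l → l ∈ S → f j ℤ.≤ f l)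
minimal-element {n} f {S} {i} i∈S = j ,
  (case ℤExtrema.argmin-sel f i xs of λ
    { (inj₁ eq) → subst (_∈ S) (sym eq) i∈S
    ; (inj₂ h)  → proj₂ (Memₚ.∈-filter⁻ (Subₚ._∈? S) {xs = List.allFin n} h) }) ,
  λ l l∈S → All.lookup (ℤExtrema.f[argmin]≤f[xs] {f = f} i xs) (Memₚ.∈-filter⁺ (Subₚ._∈? S) (Memₚ.∈-allFin l) l∈S)
  where
  xs = List.filter (Subₚ._∈? S) (List.allFin n)
  j  = ℤExtrema.argmin f i xs

removal-card : ∀ {n} {S : Subset n} {i} → i ∈ S → ∣ S ∣ ≡ ∣ S Sub.- i ∣ ℕ.+ 1
removal-card {S = S} {i} i∈S = trans (cong ∣_∣ (sym (remove-insert i∈S)))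
  (trans (∣∣≡setSum ((S Sub.- i) ∪ ⁅ i ⁆)) (trans (ℕΣ.setSum-insert (λ _ → 1) (removed∉ S i))
    (cong (ℕ._+ 1) (sym (∣∣≡setSum (S Sub.- i))))))

-- Infeasibility certificates: a positive combination of known inequalities that the ring solver
-- reduces to zero.
impossible : ∀ {e} → 0ℚ ℚ.< e → ¬ e ≡ 0ℚ
impossible 0<e eq = ℚₚ.<-irrefl (sym eq) 0<e

module Coloring (I : Instance) where

  open ColKP I
  open LinearProgram I
  open import Data.Rational using (_+_; _*_; _-_; -_; _≤_; _<_)

  weight≡ : ∀ S → fromℕ (weight S) ≡ ℚΣ.setSum S W
  weight≡ S = fromℕ-setSum S w

  profit≡ : ∀ S → fromℤ (profit S) ≡ ℚΣ.setSum S P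
  profit≡ S = fromℤ-setSum S p

  -- Each item of `S` contributes its sign plus 1, which is 2 inside the class and 0 outside. This
  -- translates between color constraints and color counts.
  color-sum : ∀ c S → ℚΣ.setSum S (σ c) + fromℕ ∣ S ∣ ≡ fromℕ (k c S) + fromℕ (k c S)
  color-sum c S = lemma S (colorClass c) (λ i → does (κ i Fin.≟ c)) (Vecₚ.lookup∘tabulate _)
    where
    r₁ : ∀ s t → (1ℚ + s) + (1ℚ + t) ≡ 1ℚ + 1ℚ + (s + t)
    r₁ = solve-∀ ℚ-ring
    r₂ : ∀ t → 1ℚ + 1ℚ + (t + t) ≡ (1ℚ + t) + (1ℚ + t)
    r₂ = solve-∀ ℚ-ring
    r₃ : ∀ s t → (- 1ℚ + s) + (1ℚ + t) ≡ s + t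
    r₃ = solve-∀ ℚ-ring
    lemma : ∀ {n} (S C : Subset n) (g : Fin n → Bool) → (∀ i → lookup C i ≡ g i) →
            ℚΣ.setSum S (sign ∘ g) + fromℕ ∣ S ∣ ≡ (fromℕ ∣ S ∩ C ∣) + (fromℕ ∣ S ∩ C ∣)
    lemma [] [] g eq = refl
    lemma (inside ∷ S) (inside ∷ C) g eq rewrite sym (eq zero) =
      trans (+-congʳ (1ℚ + ℚΣ.setSum S (sign ∘ g ∘ suc)) (fromℕ-suc ∣ S ∣))
      (trans (r₁ (ℚΣ.setSum S (sign ∘ g ∘ suc)) (fromℕ ∣ S ∣))
      (trans (+-congʳ (1ℚ + 1ℚ) (lemma S C (g ∘ suc) (eq ∘ suc)))
      (trans (r₂ (fromℕ ∣ S ∩ C ∣)) (sym (cong₂ _+_ (fromℕ-suc ∣ S ∩ C ∣) (fromℕ-suc ∣ S ∩ C ∣))))))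
    lemma (inside ∷ S) (outside ∷ C) g eq rewrite sym (eq zero) =
      trans (+-congʳ (- 1ℚ + ℚΣ.setSum S (sign ∘ g ∘ suc)) (fromℕ-suc ∣ S ∣))
      (trans (r₃ (ℚΣ.setSum S (sign ∘ g ∘ suc)) (fromℕ ∣ S ∣)) (lemma S C (g ∘ suc) (eq ∘ suc)))
    lemma (outside ∷ S) (_ ∷ C) g eq =
      trans (cong (_+ fromℕ ∣ S ∣) (ℚₚ.+-identityˡ (ℚΣ.setSum S (sign ∘ g ∘ suc)))) (lemma S C (g ∘ suc) (eq ∘ suc))

  colorFeasible⇒ : ∀ {S} → ColorFeasible S → ∀ c → 2 ℕ.* k c S ℕ.≤ ∣ S ∣ ℕ.+ 1
  colorFeasible⇒ {S} cf c = ℕₚ.≤-trans (ℕₚ.*-monoʳ-≤ 2 (≤foldr-⊔ (λ c → k c S) c)) cf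

  colorFeasible⇐ : ∀ {S} → (∀ c → 2 ℕ.* k c S ℕ.≤ ∣ S ∣ ℕ.+ 1) → ColorFeasible S
  colorFeasible⇐ {S} h with foldr-⊔-attained (λ c → k c S)
  ... | inj₁ eq       = subst (λ d → 2 ℕ.* d ℕ.≤ ∣ S ∣ ℕ.+ 1) (sym eq) ℕ.z≤n
  ... | inj₂ (c , eq) = subst (λ d → 2 ℕ.* d ℕ.≤ ∣ S ∣ ℕ.+ 1) eq (h c)

  fromℕ-2* : ∀ k → fromℕ (2 ℕ.* k) ≡ fromℕ k + fromℕ k
  fromℕ-2* k = trans (cong (λ e → fromℕ (k ℕ.+ e)) (ℕₚ.+-identityʳ k)) (fromℤ-+ (+ k) (+ k))

  χ-feasible : ∀ {T} → Feasible T → LPFeasible (χ T)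
  χ-feasible {T} (cf , wt) = mkFeasible
    (ℚₚ.≤-trans (ℚₚ.≤-reflexive (trans (⟪⟫-χ W T) (sym (weight≡ T)))) (fromℤ-mono-≤ (ℤ.+≤+ wt)))
    (λ c → ℚₚ.≤-trans (ℚₚ.≤-reflexive (⟪⟫-χ (σ c) T)) (by≤ (0≤+ (≤⇒0≤ (fromℤ-mono-≤ (ℤ.+≤+ (colorFeasible⇒ {T} cf c))))
        (≤⇒0≤ (ℚₚ.≤-reflexive (color-sum c T))))
      (trans (cong₂ (λ u v → u - v + (fromℕ (k c T) + fromℕ (k c T) - (ℚΣ.setSum T (σ c) + fromℕ ∣ T ∣)))
               (fromℤ-+ (+ ∣ T ∣) (+ 1)) (fromℕ-2* (k c T)))
             (r (fromℕ ∣ T ∣) (fromℕ (k c T)) (ℚΣ.setSum T (σ c))))))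
    (λ i → bnd (lookup T i))
    where
    r : ∀ t k s → t + 1ℚ - (k + k) + (k + k - (s + t)) ≡ 1ℚ - s
    r = solve-∀ ℚ-ring
    bnd : ∀ b → 0ℚ ≤ (if b then 1ℚ else 0ℚ) × (if b then 1ℚ else 0ℚ) ≤ 1ℚ
    bnd true  = ℚₚ.nonNegative⁻¹ 1ℚ , ℚₚ.≤-refl
    bnd false = ℚₚ.≤-refl , ℚₚ.nonNegative⁻¹ 1ℚ

  objective-χ : ∀ T → objective (χ T) ≡ fromℤ (profit T)
  objective-χ T = trans (⟪⟫-χ P T) (sym (profit≡ T))

  k-disjoint : ∀ {c c′} → c ≢ c′ → ∀ S → k c S ℕ.+ k c′ S ℕ.≤ ∣ S ∣
  k-disjoint {c} {c′} c≢c′ S = subst₂ ℕ._≤_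
    (trans (ℕΣ.∑-distrib-+ (λ i → if lookup S i then ι c i else 0) (λ i → if lookup S i then ι c′ i else 0))
           (sym (cong₂ ℕ._+_ (∣∩∣≡setSum S (colorClass c)) (∣∩∣≡setSum S (colorClass c′)))))
    (sym (∣∣≡setSum S)) (sumℕ-mono λ i → pointwise i (lookup S i))
    where
    ι : Fin m → Fin n → ℕ
    ι c i = indicator (lookup (colorClass c) i)
    exclusive : ∀ i → ι c i ℕ.+ ι c′ i ℕ.≤ 1
    exclusive i rewrite Vecₚ.lookup∘tabulate (λ i → does (κ i Fin.≟ c)) i | Vecₚ.lookup∘tabulate (λ i → does (κ i Fin.≟ c′)) i
      with κ i Fin.≟ c | κ i Fin.≟ c′
    ... | yes refl | yes refl = ⊥-elim (c≢c′ refl)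
    ... | yes _    | no  _    = ℕ.s≤s ℕ.z≤n
    ... | no  _    | yes _    = ℕ.s≤s ℕ.z≤n
    ... | no  _    | no  _    = ℕ.z≤n
    pointwise : ∀ i b → (if b then ι c i else 0) ℕ.+ (if b then ι c′ i else 0) ℕ.≤ (if b then 1 else 0)
    pointwise i true  = exclusive i
    pointwise i false = ℕ.z≤n

-- The guarantee of LP-Round.

module Rounding (I : Instance)
                (w≤b : ∀ i → Instance.w I i ℕ.≤ Instance.b I)
                (p≤pmax : ∀ i → Instance.p I i ℤ.≤ ColKP.pmax I)
                (0<pmax : 0ℤ ℤ.< ColKP.pmax I) where

  open ColKP I
  open LinearProgram I
  open Coloring I
  open import Data.Rational using (_+_; _*_; _-_; -_; _≤_; _<_)

  Pmax : ℚ
  Pmax = fromℤ pmax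

  0≤Pmax : 0ℚ ≤ Pmax
  0≤Pmax = ℚₚ.<⇒≤ (fromℤ-mono-< 0<pmax)

  P≤Pmax : ∀ i → 0ℚ ≤ Pmax - P i
  P≤Pmax i = ≤⇒0≤ (fromℤ-mono-≤ (p≤pmax i))

  module _ {x : Fin n → ℚ} (vertex : OptimalExtremePoint x) where

    open VertexShape I vertex
    open OptimalExtremePoint vertex
    open Shape shape renaming (i to f; j to g)
    open LPFeasible feasible using (capacity)

    0≤1-α : 0ℚ ≤ 1ℚ - α
    0≤1-α = ℚₚ.<⇒≤ (<⇒0< α<1)

    0≤1-β : 0ℚ ≤ 1ℚ - β
    0≤1-β = ℚₚ.<⇒≤ (<⇒0< β<1)

    Ones-weight : weight Ones ℕ.≤ b
    Ones-weight = ℤₚ.drop‿+≤+ (fromℤ-cancel-≤ (ℚₚ.≤-trans (ℚₚ.≤-reflexive (weight≡ Ones))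
      (ℚₚ.≤-trans (by≤ (0≤+ (0≤* (ℚₚ.<⇒≤ (0<W f)) 0≤α) (0≤* (ℚₚ.<⇒≤ (0<W g)) 0≤β))
        (trans (r (ℚΣ.setSum Ones W) (W f * α) (W g * β)) (cong (_- ℚΣ.setSum Ones W) (sym (expand W))))) capacity)))
      where
      r : ∀ s a b → a + b ≡ s + a + b - s
      r = solve-∀ ℚ-ring

    sign-lower : ∀ {c i γ} → 0ℚ ≤ γ → 0ℚ ≤ σ c i * γ + γ
    sign-lower {c} {i} {γ} 0≤γ with σ-values c i
    ... | inj₁ eq = subst (0ℚ ≤_) (trans (r γ) (cong (λ s → s * γ + γ) (sym eq))) (0≤+ 0≤γ 0≤γ)
      where
      r : ∀ a → a + a ≡ 1ℚ * a + a
      r = solve-∀ ℚ-ring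
    ... | inj₂ eq = ℚₚ.≤-reflexive (trans (r γ) (cong (λ s → s * γ + γ) (sym eq)))
      where
      r : ∀ a → 0ℚ ≡ - 1ℚ * a + a
      r = solve-∀ ℚ-ring

    -- A fractional item is worth at most `Pmax` per unit. `δ` will be 2 if `Ones` is kept, and 1 if
    -- an item has to be removed.
    objective-bound : ∀ {δ} → 0ℚ ≤ δ - (α + β) → objective x ≤ fromℤ (profit Ones) + Pmax * δ
    objective-bound {δ} h = by≤
      (0≤+ (0≤+ (0≤* (P≤Pmax f) 0≤α) (0≤* (P≤Pmax g) 0≤β)) (0≤* 0≤Pmax h))
      (trans (r Pmax (P f) (P g) α β δ (ℚΣ.setSum Ones P))
        (cong₂ (λ u v → u + Pmax * δ - v) (sym (profit≡ Ones)) (sym (expand P))))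
      where
      r : ∀ M pf pg a b d s → (M - pf) * a + (M - pg) * b + M * (d - (a + b)) ≡ s + M * d - (s + pf * a + pg * b)
      r = solve-∀ ℚ-ring

    -- If Ones is not color-feasible, then both fractional items compensate an
    -- excess of exactly 2 of the dominant color, so that α + β = 1.
    module Excess {c} (¬cf : ¬ ColorFeasible Ones) (dominant : Dominant c Ones) where

      s = ℚΣ.setSum Ones (σ c)
      K = fromℕ (k c Ones)
      N = fromℕ ∣ Ones ∣

      excess≥2 : ∣ Ones ∣ ℕ.+ 2 ℕ.≤ 2 ℕ.* k c Ones
      excess≥2 = subst₂ ℕ._≤_ (sym (ℕₚ.+-suc ∣ Ones ∣ 1)) (cong (2 ℕ.*_) (sym dominant)) (ℕₚ.≰⇒> ¬cf)

      s≡ : s ≡ K + K - N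
      s≡ = trans (r s N) (cong (_- N) (color-sum c Ones))
        where
        r : ∀ s n → s ≡ s + n - n
        r = solve-∀ ℚ-ring

      2≤s : 0ℚ ≤ s - (1ℚ + 1ℚ)
      2≤s = subst (0ℚ ≤_) (trans (cong₂ _-_ (fromℕ-2* (k c Ones)) (fromℤ-+ (+ ∣ Ones ∣) (+ 2)))
              (trans (r K N) (cong (_- (1ℚ + 1ℚ)) (sym s≡)))) (≤⇒0≤ (fromℤ-mono-≤ (ℤ.+≤+ excess≥2)))
        where
        r : ∀ k n → k + k - (n + (1ℚ + 1ℚ)) ≡ k + k - n - (1ℚ + 1ℚ)
        r = solve-∀ ℚ-ring

      lf : 0ℚ ≤ σ c f * α + α
      lf = sign-lower {c} {f} 0≤α

      lg : 0ℚ ≤ σ c g * β + β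
      lg = sign-lower {c} {g} 0≤β

      color≤1 : 0ℚ ≤ 1ℚ - (s + σ c f * α + σ c g * β)
      color≤1 = subst (λ e → 0ℚ ≤ 1ℚ - e) (expand (σ c)) (≤⇒0≤ (colorBound feasible c))

      -- The fractional items lower the left-hand side of the color constraint by at most `α + β`,
      -- which is less than 2, and the result must be at most 1.
      s<3 : 0ℚ < 1ℚ + (1ℚ + 1ℚ) - s
      s<3 = subst (0ℚ <_) (r s (σ c f * α) (σ c g * β) α β)
              (0<+ (0<+ (0<+ (0<+ (<⇒0< α<1) 0≤1-β) lf) lg) color≤1)
        where
        r : ∀ s a b α β → (1ℚ - α) + (1ℚ - β) + (a + α) + (b + β) + (1ℚ - (s + a + b)) ≡ 1ℚ + (1ℚ + 1ℚ) - s
        r = solve-∀ ℚ-ring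

      -- The number `s` is the integer `2 k c Ones` minus the size of `Ones`, at least 2 and less
      -- than 3.
      excess≡2 : 2 ℕ.* k c Ones ≡ ∣ Ones ∣ ℕ.+ 2
      excess≡2 = ℕₚ.≤-antisym (ℕₚ.≤-pred (subst (2 ℕ.* k c Ones ℕ.<_) (ℕₚ.+-suc ∣ Ones ∣ 2)
        (ℤₚ.drop‿+<+ (fromℤ-cancel-< (0<⇒< (subst (0ℚ <_) eq s<3)))))) excess≥2
        where
        r : ∀ k n → 1ℚ + (1ℚ + 1ℚ) - (k + k - n) ≡ n + (1ℚ + (1ℚ + 1ℚ)) - (k + k)
        r = solve-∀ ℚ-ring
        eq : 1ℚ + (1ℚ + 1ℚ) - s ≡ fromℕ (∣ Ones ∣ ℕ.+ 3) - fromℕ (2 ℕ.* k c Ones)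
        eq = trans (cong (λ e → 1ℚ + (1ℚ + 1ℚ) - e) s≡) (trans (r K N)
               (sym (cong₂ _-_ (fromℤ-+ (+ ∣ Ones ∣) (+ 3)) (fromℕ-2* (k c Ones)))))

      -- If `β` is 0, the color constraint gives `s ≤ 1 + α < 2`, contradicting `2≤s`. If another
      -- color is tight, `opposed` puts the left-hand side for `c` at most at -1, although it is at
      -- least `s - α - β`, which is positive.
      tight : Tight c
      tight with tightOr
      ... | inj₁ β≡0 = ⊥-elim (impossible
        (0<+ (0<+ (0<+ (0<+ (0<+ (<⇒0< α<1) 2≤s) lf) lg) color≤1) (≤⇒0≤ (ℚₚ.≤-reflexive β≡0)))
        (r s (σ c f * α) (σ c g * β) α β))
        where
        r : ∀ s a b α β → (1ℚ - α) + (s - (1ℚ + 1ℚ)) + (a + α) + (b + β) + (1ℚ - (s + a + b)) + (0ℚ - β) ≡ 0ℚ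
        r = solve-∀ ℚ-ring
      ... | inj₂ (c′ , t′) with c Fin.≟ c′
      ...   | yes refl = t′
      ...   | no  c≢c′ = ⊥-elim (impossible
        (0<+ (0<+ (0<+ (0<+ (0<+ (0<+ (<⇒0< α<1) 0≤1-β) 2≤s) lf) lg) (≤⇒0≤ (opposed c≢c′))) (ℚₚ.nonNegative⁻¹ 1ℚ))
        (trans (cong₂ (λ u v → (1ℚ - α) + (1ℚ - β) + (s - (1ℚ + 1ℚ)) + (σ c f * α + α) + (σ c g * β + β) + (0ℚ - (u + v)) + 1ℚ) (expand (σ c)) t′)
          (r s (σ c f * α) (σ c g * β) α β)))
        where
        r : ∀ s a b α β → (1ℚ - α) + (1ℚ - β) + (s - (1ℚ + 1ℚ)) + (a + α) + (b + β) + (0ℚ - (s + a + b + 1ℚ)) + 1ℚ ≡ 0ℚ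
        r = solve-∀ ℚ-ring

      -- If one of the fractional items had color `c`, the other alone, contributing more than -1,
      -- could not bring `s ≥ 2` down to 1. So both signs are -1, and tightness reads
      -- `2 - α - β = 1`.
      α+β≤1 : 0ℚ ≤ 1ℚ - (α + β)
      α+β≤1 with σ-values c f | σ-values c g
      ... | inj₁ p | _ = ⊥-elim (impossible
        (0<+ (0<+ (0<+ (0<+ (<⇒0< β<1) 2≤s) 0≤α) lg) color≤1)
        (trans (cong (λ e → (1ℚ - β) + (s - (1ℚ + 1ℚ)) + α + (σ c g * β + β) + (1ℚ - (s + e * α + σ c g * β))) p)
          (r s (σ c g * β) α β)))
        where
        r : ∀ s b α β → (1ℚ - β) + (s - (1ℚ + 1ℚ)) + α + (b + β) + (1ℚ - (s + 1ℚ * α + b)) ≡ 0ℚ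
        r = solve-∀ ℚ-ring
      ... | inj₂ _ | inj₁ q = ⊥-elim (impossible
        (0<+ (0<+ (0<+ (0<+ (<⇒0< α<1) 2≤s) 0≤β) lf) color≤1)
        (trans (cong (λ e → (1ℚ - α) + (s - (1ℚ + 1ℚ)) + β + (σ c f * α + α) + (1ℚ - (s + σ c f * α + e * β))) q)
          (r s (σ c f * α) α β)))
        where
        r : ∀ s a α β → (1ℚ - α) + (s - (1ℚ + 1ℚ)) + β + (a + α) + (1ℚ - (s + a + 1ℚ * β)) ≡ 0ℚ
        r = solve-∀ ℚ-ring
      ... | inj₂ p | inj₂ q = ℚₚ.≤-reflexive (trans (sym (trans (cong (λ e → e - 1ℚ) total) (ℚₚ.+-inverseʳ 1ℚ)))
          (trans (cong (λ e → e + - 1ℚ * α + - 1ℚ * β - 1ℚ) s≡2) (r α β)))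
        where
        total : s + - 1ℚ * α + - 1ℚ * β ≡ 1ℚ
        total = trans (cong₂ (λ u v → s + u * α + v * β) (sym p) (sym q)) (trans (sym (expand (σ c))) tight)
        r : ∀ a b → 1ℚ + 1ℚ + - 1ℚ * a + - 1ℚ * b - 1ℚ ≡ 1ℚ - (a + b)
        r = solve-∀ ℚ-ring
        r′ : ∀ n → n + (1ℚ + 1ℚ) - n ≡ 1ℚ + 1ℚ
        r′ = solve-∀ ℚ-ring
        s≡2 : s ≡ 1ℚ + 1ℚ
        s≡2 = trans s≡ (trans (cong (_- N) (trans (sym (fromℕ-2* (k c Ones))) (trans (cong fromℕ excess≡2) (fromℤ-+ (+ ∣ Ones ∣) (+ 2))))) (r′ N))

      module Removal {i} (i∈ : i ∈ Ones ∩ colorClass c) where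

        S₀ : Subset n
        S₀ = Ones Sub.- i

        i∈Ones : i ∈ Ones
        i∈Ones = proj₁ (Subₚ.x∈p∩q⁻ Ones (colorClass c) i∈)

        size : ∣ Ones ∣ ≡ ∣ S₀ ∣ ℕ.+ 1
        size = removal-card i∈Ones

        class-size : k c Ones ≡ k c S₀ ℕ.+ 1
        class-size = trans (cong (k c) (sym (remove-insert i∈Ones)))
          (trans (∣∩∣≡setSum (S₀ ∪ ⁅ i ⁆) C) (trans (ℕΣ.setSum-insert (λ j → indicator (lookup C j)) (removed∉ Ones i))
            (cong₂ ℕ._+_ (sym (∣∩∣≡setSum S₀ C)) (cong indicator (∈⇒lookup (proj₂ (Subₚ.x∈p∩q⁻ Ones C i∈)))))))
          where C = colorClass c

        balanced : 2 ℕ.* k c S₀ ≡ ∣ S₀ ∣ ℕ.+ 1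
        balanced = ℕₚ.+-cancelʳ-≡ 2 (2 ℕ.* k c S₀) (∣ S₀ ∣ ℕ.+ 1)
          (trans (sym (trans (cong (2 ℕ.*_) class-size) (ℕₚ.*-distribˡ-+ 2 (k c S₀) 1))) (trans excess≡2 (cong (ℕ._+ 2) size)))

        -- By `balanced`, the class of `c` has exactly one item more than all other classes
        -- together, so any other class has fewer than half of the items.
        colorFeasible : ColorFeasible S₀
        colorFeasible = colorFeasible⇐ {S₀} λ c′ → case c Fin.≟ c′ of λ
          { (yes refl) → ℕₚ.≤-reflexive balanced
          ; (no  c≢c′) → ℕₚ.≤-trans
              (ℕₚ.+-cancelˡ-≤ (∣ S₀ ∣ ℕ.+ 1) (2 ℕ.* k c′ S₀) ∣ S₀ ∣
                (ℕₚ.≤-trans (subst₂ ℕ._≤_ (trans (ℕₚ.*-distribˡ-+ 2 (k c S₀) (k c′ S₀)) (cong (ℕ._+ 2 ℕ.* k c′ S₀) balanced))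
                   (cong (∣ S₀ ∣ ℕ.+_) (ℕₚ.+-identityʳ ∣ S₀ ∣)) (ℕₚ.*-monoʳ-≤ 2 (k-disjoint c≢c′ S₀)))
                  (ℕₚ.+-monoˡ-≤ ∣ S₀ ∣ (ℕₚ.m≤m+n ∣ S₀ ∣ 1))))
              (ℕₚ.m≤m+n ∣ S₀ ∣ 1) }

        weight≤ : weight S₀ ℕ.≤ b
        weight≤ = ℕₚ.≤-trans (setSumℕ-⊆ w (Subₚ.p─q⊆p Ones ⁅ i ⁆)) Ones-weight

        profit-drop : fromℤ (profit Ones) ≡ fromℤ (profit S₀) + P i
        profit-drop = trans (cong (fromℤ ∘ profit) (sym (remove-insert i∈Ones)))
          (trans (cong fromℤ (ℤΣ.setSum-insert p (removed∉ Ones i))) (fromℤ-+ (profit S₀) (p i)))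

    repaired : ∀ {S₀} → Repair (onesOf x) S₀ → Feasible S₀ × objective x ≤ fromℤ (profit S₀) + (Pmax + Pmax)
    repaired (keep cf) = (cf , Ones-weight) , subst (λ e → objective x ≤ fromℤ (profit Ones) + e) (r Pmax)
        (objective-bound {1ℚ + 1ℚ} (subst (0ℚ ≤_) (r′ α β) (0≤+ 0≤1-α 0≤1-β)))
      where
      r : ∀ a → a * (1ℚ + 1ℚ) ≡ a + a
      r = solve-∀ ℚ-ring
      r′ : ∀ a b → 1ℚ - a + (1ℚ - b) ≡ 1ℚ + 1ℚ - (a + b)
      r′ = solve-∀ ℚ-ring
    repaired (drop c i ¬cf dominant i∈ _) = (colorFeasible , weight≤) ,
      ℚₚ.≤-trans (objective-bound {1ℚ} α+β≤1)
        (by≤ (P≤Pmax i) (trans (r (fromℤ (profit S₀)) (P i) Pmax)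
          (cong (λ e → fromℤ (profit S₀) + (Pmax + Pmax) - (e + Pmax * 1ℚ)) (sym profit-drop))))
      where
      open Excess {c} ¬cf dominant
      open Removal {i} i∈
      r : ∀ s p M → M - p ≡ s + (M + M) - (s + p + M * 1ℚ)
      r = solve-∀ ℚ-ring

    repair-exists : ∃ (Repair (onesOf x))
    repair-exists with 2 ℕ.* d (onesOf x) ℕ.≤? ∣ onesOf x ∣ ℕ.+ 1
    ... | yes cf = _ , keep cf
    ... | no ¬cf with foldr-⊔-attained (λ c → k c (onesOf x))
    ...   | inj₁ d≡0 = ⊥-elim (¬cf (subst (λ d → 2 ℕ.* d ℕ.≤ ∣ onesOf x ∣ ℕ.+ 1) (sym d≡0) ℕ.z≤n))
    ...   | inj₂ (c , dominant) with Subₚ.nonempty? (onesOf x ∩ colorClass c)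
    ...     | yes (i , i∈) = let (j , j∈ , min) = minimal-element p i∈ in
                             _ , drop c j ¬cf dominant j∈ min
    -- An empty dominant class would mean that `d` is 0, and then the set would be color-feasible.
    ...     | no empty = ⊥-elim (¬cf (subst (λ d → 2 ℕ.* d ℕ.≤ ∣ onesOf x ∣ ℕ.+ 1)
                (trans (sym (trans (cong ∣_∣ (Subₚ.Empty-unique empty)) (Subₚ.∣⊥∣≡0 n))) dominant) ℕ.z≤n))

  singleton-feasible : ∀ i → Feasible ⁅ i ⁆
  singleton-feasible i =
    colorFeasible⇐ {⁅ i ⁆} (λ c → ℕₚ.≤-trans
      (ℕₚ.*-monoʳ-≤ 2 (ℕₚ.≤-trans (Subₚ.∣p∩q∣≤∣p∣ ⁅ i ⁆ (colorClass c)) (ℕₚ.≤-reflexive (Subₚ.∣⁅x⁆∣≡1 i))))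
      (ℕₚ.≤-reflexive (cong (ℕ._+ 1) (sym (Subₚ.∣⁅x⁆∣≡1 i))))) ,
    subst (ℕ._≤ b) (sym (ℕΣ.setSum-⁅⁆ i w)) (w≤b i)

  record Guarantee (L : Subset n) : Set where
    field
      isFeasible : Feasible L
      pmax≤      : pmax ℤ.≤ profit L
      bound      : ∀ T → Feasible T → profit T ℤ.≤ + 3 ℤ.* profit L

  lpRound-guarantee : ∀ {L} → LPRound L → Guarantee L
  lpRound-guarantee {L} record { x* = x ; x*-vertex = vertex ; S₀ = S₀ ; repair = repair ; r = r ; r-max = r-max ; result = result } =
    assemble result
    where
    profit-r : profit ⁅ r ⁆ ≡ pmax
    profit-r = trans (ℤΣ.setSum-⁅⁆ r p) r-max
    rep = repaired vertex repair
    triple : ∀ {L} → profit S₀ ℤ.≤ profit L → pmax ℤ.≤ profit L → ∀ T → Feasible T → profit T ℤ.≤ + 3 ℤ.* profit L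
    triple {L} h₁ h₂ T fT = fromℤ-cancel-≤ (ℚₚ.≤-trans
      (ℚₚ.≤-trans (ℚₚ.≤-reflexive (sym (objective-χ T))) (OptimalExtremePoint.optimal vertex (χ T) (χ-feasible {T} fT)))
      (ℚₚ.≤-trans (proj₂ rep) (ℚₚ.≤-trans (by≤ (0≤+ (≤⇒0≤ (fromℤ-mono-≤ h₁)) (0≤+ (≤⇒0≤ (fromℤ-mono-≤ h₂)) (≤⇒0≤ (fromℤ-mono-≤ h₂))))
        (lemma (fromℤ (profit L)) (fromℤ (profit S₀)) Pmax)) (ℚₚ.≤-reflexive (sym (fromℤ-* (+ 3) (profit L)))))))
      where
      lemma : ∀ l s M → l - s + (l - M + (l - M)) ≡ (1ℚ + (1ℚ + 1ℚ)) * l - (s + (M + M))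
      lemma = solve-∀ ℚ-ring
    assemble : ∀ {L} → MoreProfitable S₀ ⁅ r ⁆ L → Guarantee L
    assemble (left h) = record
      { isFeasible = proj₁ rep
      ; pmax≤ = subst (ℤ._≤ profit S₀) profit-r h
      ; bound = triple {S₀} ℤₚ.≤-refl (subst (ℤ._≤ profit S₀) profit-r h) }
    assemble (right h) = record
      { isFeasible = singleton-feasible r
      ; pmax≤ = ℤₚ.≤-reflexive (sym profit-r)
      ; bound = triple {⁅ r ⁆} h (ℤₚ.≤-reflexive (sym profit-r)) }

  lpRound-exists : ∃ LPRound
  lpRound-exists = choose (proj₂ optimal-vertex) (proj₂ (repair-exists (proj₂ optimal-vertex)))
                          (proj₂ (maximumℤ-attained p)) (ℤₚ.≤-total _ _)
    where
    choose : ∀ {x S₀ r} → OptimalExtremePoint x → Repair (onesOf x) S₀ → p r ≡ pmax →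
             profit ⁅ r ⁆ ℤ.≤ profit S₀ ⊎ profit S₀ ℤ.≤ profit ⁅ r ⁆ → ∃ LPRound
    choose vertex repair r-max (inj₁ h) =
      _ , record { x*-vertex = vertex ; repair = repair ; r-max = r-max ; result = left h }
    choose vertex repair r-max (inj₂ h) =
      _ , record { x*-vertex = vertex ; repair = repair ; r-max = r-max ; result = right h }

-- Table entries and color counts under insertion.

AtMost : Maybe ℕ → ℕ → Set
AtMost x v = ∃ λ u → x ≡ just u × u ℕ.≤ v

atMost-≤ : ∀ {x u v} → u ℕ.≤ v → AtMost x u → AtMost x v
atMost-≤ u≤v (t , eq , t≤u) = t , eq , ℕₚ.≤-trans t≤u u≤v

-- The explicit motive `C` allows the conditionals in `relax`, `visit` and the bounds of the range
-- to be analysed in place.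
if-elim : ∀ {P A : Set} (C : A → Set) (P? : Dec P) {x y : A} →
          (P → C x) → (¬ P → C y) → C (if does P? then x else y)
if-elim C (yes p) f g = f p
if-elim C (no ¬p) f g = g ¬p

foldr-⊔-least : ∀ {m} (f : Fin m → ℕ) {u} → (∀ c → f c ℕ.≤ u) → Fn.foldr ℕ._⊔_ 0 f ℕ.≤ u
foldr-⊔-least {zero}  f h = ℕ.z≤n
foldr-⊔-least {suc m} f h = ℕₚ.⊔-lub (h zero) (foldr-⊔-least (f ∘ suc) (h ∘ suc))

module ColorCounts (I : Instance) where

  open ColKP I

  k-insert : ∀ c {S x} → x ∉ S → k c (S ∪ ⁅ x ⁆) ≡ k c S ℕ.+ indicator (does (κ x Fin.≟ c))
  k-insert c {S} {x} x∉S = trans (∣∩∣≡setSum (S ∪ ⁅ x ⁆) C)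
    (trans (ℕΣ.setSum-insert (λ j → indicator (lookup C j)) x∉S)
      (cong₂ ℕ._+_ (sym (∣∩∣≡setSum S C)) (cong indicator (Vecₚ.lookup∘tabulate (λ i → does (κ i Fin.≟ c)) x))))
    where C = colorClass c

  k-insert-same : ∀ {S x} → x ∉ S → k (κ x) (S ∪ ⁅ x ⁆) ≡ suc (k (κ x) S)
  k-insert-same {S} {x} x∉S with κ x Fin.≟ κ x | k-insert (κ x) {S} x∉S
  ... | yes _ | eq = trans eq (ℕₚ.+-comm (k (κ x) S) 1)
  ... | no ne | _  = ⊥-elim (ne refl)

  k-insert-other : ∀ {c S x} → κ x ≢ c → x ∉ S → k c (S ∪ ⁅ x ⁆) ≡ k c S
  k-insert-other {c} {S} {x} ne x∉S with κ x Fin.≟ c | k-insert c {S} x∉S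
  ... | yes eq | _  = ⊥-elim (ne eq)
  ... | no  _  | eq = trans eq (ℕₚ.+-identityʳ (k c S))

  k-absent : ∀ {c S} → (∀ {x} → x ∈ S → κ x ≢ c) → k c S ≡ 0
  k-absent {c} {S} absent = trans (cong ∣_∣ (Subₚ.Empty-unique {p = S ∩ colorClass c} λ (x , x∈) →
      let (x∈S , x∈C) = Subₚ.x∈p∩q⁻ S (colorClass c) x∈ in absent x∈S (colored x x∈C))) (Subₚ.∣⊥∣≡0 n)
    where
    colored : ∀ x → x ∈ colorClass c → κ x ≡ c
    colored x x∈C with κ x Fin.≟ c | trans (sym (Vecₚ.lookup∘tabulate (λ i → does (κ i Fin.≟ c)) x)) (∈⇒lookup x∈C)
    ... | yes eq | _ = eq
    ... | no  _  | ()

  k≤d : ∀ c S → k c S ℕ.≤ d S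
  k≤d c S = ≤foldr-⊔ (λ c → k c S) c

  k≤size : ∀ c S → k c S ℕ.≤ ∣ S ∣
  k≤size c S = Subₚ.∣p∩q∣≤∣p∣ S (colorClass c)

  d≤size : ∀ S → d S ℕ.≤ ∣ S ∣
  d≤size S = foldr-⊔-least (λ c → k c S) λ c → k≤size c S

  -- Only the class of `x` grows, and by one, so the maximum grows exactly if that class was
  -- dominant. The left-hand side is the update of `d′` in `packTo`.
  d-insert : ∀ {S x} → x ∉ S →
             (if does (k (κ x) S ℕ.≟ d S) then suc (d S) else d S) ≡ d (S ∪ ⁅ x ⁆)
  d-insert {S} {x} x∉S = if-elim (_≡ d (S ∪ ⁅ x ⁆)) (k (κ x) S ℕ.≟ d S)
    (λ eq → ℕₚ.≤-antisym
      (subst (ℕ._≤ d (S ∪ ⁅ x ⁆)) (trans (k-insert-same x∉S) (cong suc eq)) (k≤d (κ x) (S ∪ ⁅ x ⁆)))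
      (foldr-⊔-least (λ c → k c (S ∪ ⁅ x ⁆)) λ c → case κ x Fin.≟ c of λ
        { (yes refl) → ℕₚ.≤-reflexive (trans (k-insert-same x∉S) (cong suc eq))
        ; (no  ne)   → ℕₚ.≤-trans (ℕₚ.≤-reflexive (k-insert-other ne x∉S)) (ℕₚ.m≤n⇒m≤1+n (k≤d c S)) }))
    (λ ne → ℕₚ.≤-antisym
      (foldr-⊔-least (λ c → k c S) λ c → ℕₚ.≤-trans (ℕₚ.m≤m+n (k c S) _)
        (ℕₚ.≤-trans (ℕₚ.≤-reflexive (sym (k-insert c x∉S))) (k≤d c (S ∪ ⁅ x ⁆))))
      (foldr-⊔-least (λ c → k c (S ∪ ⁅ x ⁆)) λ c → case κ x Fin.≟ c of λ
        { (yes refl) → ℕₚ.≤-trans (ℕₚ.≤-reflexive (k-insert-same x∉S)) (ℕₚ.≤∧≢⇒< (k≤d (κ x) S) ne)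
        ; (no  ne′)  → ℕₚ.≤-trans (ℕₚ.≤-reflexive (k-insert-other ne′ x∉S)) (k≤d c S) }))

  ∣∣-insert : ∀ {n} {S : Subset n} {x} → x ∉ S → ∣ S ∪ ⁅ x ⁆ ∣ ≡ suc ∣ S ∣
  ∣∣-insert {S = S} {x} x∉S = trans (∣∣≡setSum (S ∪ ⁅ x ⁆)) (trans (ℕΣ.setSum-insert (λ _ → 1) x∉S)
    (trans (cong (ℕ._+ 1) (sym (∣∣≡setSum S))) (ℕₚ.+-comm ∣ S ∣ 1)))

  weight-insert : ∀ {S x} → x ∉ S → weight (S ∪ ⁅ x ⁆) ≡ weight S ℕ.+ w x
  weight-insert = ℕΣ.setSum-insert w

-- Correctness of the dynamic program.

module DynamicProgram (I : Instance) (π : Permutation′ (Instance.n I)) (grouped : ColKP.GroupedByColor I π)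
                      (p̂ : Fin (Instance.n I) → ℤ) (zmin zmax : ℤ)
                      (zmin≤0 : zmin ℤ.≤ 0ℤ) (0≤zmax : 0ℤ ℤ.≤ zmax) where

  open ColKP I
  open ColorCounts I
  open Mem using () renaming (_∈_ to _∈ˡ_)

  item : Fin n → Fin n
  item = π ⟨$⟩ʳ_

  item-injective : ∀ {i j} → item i ≡ item j → i ≡ j
  item-injective {i} {j} eq = trans (sym (Perm.inverseˡ π)) (trans (cong (π Perm.⟨$⟩ˡ_) eq) (Perm.inverseˡ π))

  open DP item p̂ zmin zmax

  ⊓∞-right : ∀ x v → AtMost (x ⊓∞ just v) v
  ⊓∞-right nothing  v = v , refl , ℕₚ.≤-refl
  ⊓∞-right (just u) v = u ℕ.⊓ v , refl , ℕₚ.m⊓n≤n u v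

  ⊓∞-left : ∀ {x u} v → AtMost x u → AtMost (x ⊓∞ just v) u
  ⊓∞-left v (t , refl , t≤u) = t ℕ.⊓ v , refl , ℕₚ.≤-trans (ℕₚ.m⊓n≤m t v) t≤u

  ⊓∞-source : ∀ x v {u} → x ⊓∞ just v ≡ just u → x ≡ just u ⊎ u ≡ v
  ⊓∞-source nothing  v refl = inj₂ refl
  ⊓∞-source (just t) v refl with ℕₚ.⊓-sel t v
  ... | inj₁ eq = inj₁ (cong just (sym eq))
  ... | inj₂ eq = inj₂ eq

  relax-reaches : ∀ s v g → AtMost (relax s v g s) v
  relax-reaches s v g = if-elim (λ x → AtMost x v) (s ≟ₛ s) (λ _ → ⊓∞-right (g s) v) (λ ne → ⊥-elim (ne refl))

  relax-decreases : ∀ s v g s′ {u} → AtMost (g s′) u → AtMost (relax s v g s′) u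
  relax-decreases s v g s′ {u} h = if-elim (λ x → AtMost x u) (s′ ≟ₛ s) (λ _ → ⊓∞-left v h) (λ _ → h)

  relax-source : ∀ s v g s′ {u} → relax s v g s′ ≡ just u → g s′ ≡ just u ⊎ (s′ ≡ s × u ≡ v)
  relax-source s v g s′ {u} = if-elim (λ x → x ≡ just u → g s′ ≡ just u ⊎ (s′ ≡ s × u ≡ v)) (s′ ≟ₛ s)
    (λ e h → Data.Sum.map₂ (e ,_) (⊓∞-source (g s′) v h)) (λ _ → inj₁)

  visit-decreases : ∀ i s x g s′ {u} → AtMost (g s′) u → AtMost (visit i s x g s′) u
  visit-decreases i s nothing  g s′ h = h
  visit-decreases i s (just v) g s′ {u} h = if-elim (λ (g : Layer) → AtMost (g s′) u) (canPack? i s v)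
    (λ _ → relax-decreases (packTo i s) (v ℕ.+ w (item i)) (relax (skipTo i s) v g) s′ h′) (λ _ → h′)
    where h′ = relax-decreases (skipTo i s) v g s′ h

  visit-skip : ∀ i s v g → AtMost (visit i s (just v) g (skipTo i s)) v
  visit-skip i s v g = if-elim (λ (g : Layer) → AtMost (g (skipTo i s)) v) (canPack? i s v)
    (λ _ → relax-decreases (packTo i s) (v ℕ.+ w (item i)) (relax (skipTo i s) v g) (skipTo i s) h) (λ _ → h)
    where h = relax-reaches (skipTo i s) v g

  visit-pack : ∀ i s v g → CanPack i s v → AtMost (visit i s (just v) g (packTo i s)) (v ℕ.+ w (item i))
  visit-pack i s v g can = if-elim (λ (g : Layer) → AtMost (g (packTo i s)) (v ℕ.+ w (item i))) (canPack? i s v)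
    (λ _ → relax-reaches (packTo i s) (v ℕ.+ w (item i)) (relax (skipTo i s) v g)) (λ cannot → ⊥-elim (cannot can))

  -- The updates made by `visit`, as a relation. Completeness (`sweep-reaches`) and the recovery of
  -- a source (`sweep-source`) are stated for the same steps.
  data Transition (i : Fin n) (s : State) (v : ℕ) : State → ℕ → Set where
    skipped : Transition i s v (skipTo i s) v
    packed  : CanPack i s v → Transition i s v (packTo i s) (v ℕ.+ w (item i))

  visit-source : ∀ i s x g s′ {u} → visit i s x g s′ ≡ just u →
                 g s′ ≡ just u ⊎ ∃ λ v → x ≡ just v × Transition i s v s′ u
  visit-source i s nothing  g s′ h = inj₁ h
  visit-source i s (just v) g s′ {u} = if-elim
    (λ (f : Layer) → f s′ ≡ just u → g s′ ≡ just u ⊎ ∃ λ v′ → just v ≡ just v′ × Transition i s v′ s′ u) (canPack? i s v)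
    (λ can h → case relax-source (packTo i s) (v ℕ.+ w (item i)) (relax (skipTo i s) v g) s′ h of λ
      { (inj₁ h′)            → from-skip h′
      ; (inj₂ (refl , refl)) → inj₂ (v , refl , packed can) })
    (λ _ → from-skip)
    where
    from-skip : relax (skipTo i s) v g s′ ≡ just u → g s′ ≡ just u ⊎ ∃ λ v′ → just v ≡ just v′ × Transition i s v′ s′ u
    from-skip h = Data.Sum.map₂ (λ { (refl , refl) → v , refl , skipped }) (relax-source (skipTo i s) v g s′ h)

  module _ (i : Fin n) (T : Layer) where

    sweep : Layer → List State → Layer
    sweep = List.foldl (λ g s → visit i s (T s) g)

    sweep-decreases : ∀ xs g s′ {u} → AtMost (g s′) u → AtMost (sweep g xs s′) u
    sweep-decreases []       g s′ h = h
    sweep-decreases (s ∷ xs) g s′ h = sweep-decreases xs _ s′ (visit-decreases i s (T s) g s′ h)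

    sweep-reaches : ∀ {xs s v} g {s′ u} → s ∈ˡ xs → T s ≡ just v → Transition i s v s′ u → AtMost (sweep g xs s′) u
    sweep-reaches {s ∷ xs} {s} {v} g {s′} {u} (here refl) eq tr = sweep-decreases xs _ s′ (lemma tr)
      where
      lemma : Transition i s v s′ u → AtMost (visit i s (T s) g s′) u
      lemma tr rewrite eq with tr
      ... | skipped    = visit-skip i s v g
      ... | packed can = visit-pack i s v g can
    sweep-reaches {s ∷ xs} g (there s∈) eq tr = sweep-reaches {xs} _ s∈ eq tr

    sweep-source : ∀ xs g s′ {u} → sweep g xs s′ ≡ just u →
                   g s′ ≡ just u ⊎ ∃₂ λ s v → T s ≡ just v × Transition i s v s′ u
    sweep-source []       g s′ h = inj₁ h
    sweep-source (s ∷ xs) g s′ h with sweep-source xs _ s′ h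
    ... | inj₂ r  = inj₂ r
    ... | inj₁ h′ with visit-source i s (T s) g s′ h′
    ...   | inj₁ h″ = inj₁ h″
    ...   | inj₂ (v , eq , tr) = inj₂ (s , v , eq , tr)

  table-reaches : ∀ {j s v s′ u} .(j<n : j ℕ.< n) → s ∈ˡ states → table j (ℕₚ.<⇒≤ j<n) s ≡ just v →
                  Transition (fromℕ< j<n) s v s′ u → AtMost (table (suc j) j<n s′) u
  table-reaches {j} j<n = sweep-reaches (fromℕ< j<n) (table j (ℕₚ.<⇒≤ j<n)) (λ _ → nothing)

  table-source : ∀ {j s′ u} .(j<n : j ℕ.< n) → table (suc j) j<n s′ ≡ just u →
                 ∃₂ λ s v → table j (ℕₚ.<⇒≤ j<n) s ≡ just v × Transition (fromℕ< j<n) s v s′ u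
  table-source {j} {s′} j<n h with sweep-source (fromℕ< j<n) (table j (ℕₚ.<⇒≤ j<n)) states (λ _ → nothing) s′ h
  -- Every layer starts out infinite everywhere, so a finite entry must stem from a transition.
  ... | inj₂ r = r

  -- The counter `a` refers to the color of the last processed item, which `a≡` expresses as the `i`
  -- with `suc (toℕ i) ≡ j`; this is vacuous in layer 0. The field `a≤t` places `a` in the index
  -- range in every layer.
  record Describes (j : ℕ) (s : State) (S : Subset n) : Set where
    field
      t≡     : proj₁ s ≡ ∣ S ∣
      d≡     : proj₁ (proj₂ s) ≡ d S
      a≤t    : proj₁ (proj₂ (proj₂ s)) ℕ.≤ proj₁ s
      a≡     : ∀ i → suc (toℕ i) ≡ j → proj₁ (proj₂ (proj₂ s)) ≡ k (κ (item i)) S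
      z≡     : proj₂ (proj₂ (proj₂ s)) ≡ ℤΣ.setSum S p̂
      prefix : ∀ {x} → x ∈ S → ∃ λ i → toℕ i ℕ.< j × item i ≡ x

  blockCount≤ : ∀ i a → blockCount i a ℕ.≤ a
  blockCount≤ i a with sameAsPrevious (κ ∘ item) i
  ... | true  = ℕₚ.≤-refl
  ... | false = ℕ.z≤n

  -- If the previous item has the same color, `a` already counts that color. Otherwise the color is
  -- new: an earlier item `l` of this color would, by `grouped`, force it on the predecessor of `i`,
  -- which lies at or after `l`.
  blockCount≡ : ∀ {s S} i → Describes (toℕ i) s S → blockCount i (proj₁ (proj₂ (proj₂ s))) ≡ k (κ (item i)) S
  blockCount≡ {s} {S} i D = lemma i (Describes.a≡ D) (Describes.prefix D)
    where
    a = proj₁ (proj₂ (proj₂ s))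
    previous : ∀ {n′} (col : Fin n′ → Fin m) (i : Fin n′) → sameAsPrevious col i ≡ true →
               ∃ λ j → suc (toℕ j) ≡ toℕ i × col i ≡ col j
    previous col (suc i) h with col (suc i) Fin.≟ col (inject₁ i)
    ... | yes eq = inject₁ i , cong suc (Finₚ.toℕ-inject₁ i) , eq
    different : ∀ {n′} (col : Fin n′ → Fin m) (i l : Fin n′) → sameAsPrevious col i ≡ false → toℕ l ℕ.< toℕ i →
                ∃ λ j → suc (toℕ j) ≡ toℕ i × col i ≢ col j
    different col (suc i) l h _ with col (suc i) Fin.≟ col (inject₁ i)
    ... | no ne = inject₁ i , cong suc (Finₚ.toℕ-inject₁ i) , ne
    lemma : ∀ i → (∀ j → suc (toℕ j) ≡ toℕ i → a ≡ k (κ (item j)) S) →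
            (∀ {x} → x ∈ S → ∃ λ l → toℕ l ℕ.< toℕ i × item l ≡ x) → blockCount i a ≡ k (κ (item i)) S
    lemma i a≡ prefix with sameAsPrevious (κ ∘ item) i in eq
    ... | true = let (j , j+1≡i , same) = previous (κ ∘ item) i eq in
                 trans (a≡ j j+1≡i) (cong (λ c → k c S) (sym same))
    ... | false = sym (k-absent {κ (item i)} {S} λ {x} x∈S → fresh x (prefix x∈S))
      where
      fresh : ∀ x → (∃ λ l → toℕ l ℕ.< toℕ i × item l ≡ x) → κ x ≢ κ (item i)
      fresh x (l , l<i , refl) κ≡ with different (κ ∘ item) i l eq l<i
      ... | j , j+1≡i , ne with Finₚ.<-cmp l j
      ...   | tri≈ _ refl _ = ne (sym κ≡)
      ...   | tri< l<j _ _  = ne (sym (trans (grouped l j i l<j (subst (toℕ j ℕ.<_) j+1≡i ℕₚ.≤-refl) κ≡) κ≡))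
      ...   | tri> _ _ j<l  = ℕₚ.<-irrefl refl (ℕₚ.<-≤-trans (subst (toℕ l ℕ.<_) (sym j+1≡i) l<i) j<l)

  describes-start : Describes 0 origin Sub.⊥
  describes-start = record
    { t≡ = sym (Subₚ.∣⊥∣≡0 n)
    ; d≡ = sym (ℕₚ.n≤0⇒n≡0 (subst (d Sub.⊥ ℕ.≤_) (Subₚ.∣⊥∣≡0 n) (d≤size Sub.⊥)))
    ; a≤t = ℕ.z≤n ; a≡ = λ _ () ; z≡ = sym (ℤΣ.setSum-⊥ n p̂) ; prefix = λ h → ⊥-elim (Subₚ.∉⊥ h) }

  describes-skip : ∀ {s S} i → Describes (toℕ i) s S → Describes (suc (toℕ i)) (skipTo i s) S
  describes-skip {s} {S} i D = record
    { t≡ = t≡ ; d≡ = d≡ ; a≤t = ℕₚ.≤-trans (blockCount≤ i _) a≤t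
    ; a≡ = λ j eq → trans (blockCount≡ i D) (cong (λ l → k (κ (item l)) S) (Finₚ.toℕ-injective (sym (ℕₚ.suc-injective eq))))
    ; z≡ = z≡ ; prefix = λ h → let (l , l<i , eq) = prefix h in l , ℕₚ.m<n⇒m<1+n l<i , eq }
    where open Describes D

  unpacked : ∀ {s S} i → Describes (toℕ i) s S → item i ∉ S
  unpacked i D h with Describes.prefix D h
  ... | l , l<i , eq = ℕₚ.<-irrefl (cong toℕ (item-injective eq)) l<i

  describes-pack : ∀ {s S} i → Describes (toℕ i) s S → Describes (suc (toℕ i)) (packTo i s) (S ∪ ⁅ item i ⁆)
  describes-pack {s} {S} i D = record
    { t≡ = trans (cong suc t≡) (sym (∣∣-insert i∉S))
    ; d≡ = trans (cong₂ (λ a d → if does (a ℕ.≟ d) then suc d else d) (blockCount≡ i D) d≡) (d-insert i∉S)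
    ; a≤t = ℕ.s≤s (ℕₚ.≤-trans (blockCount≤ i _) a≤t)
    ; a≡ = λ j eq → trans (cong suc (blockCount≡ i D)) (trans (sym (k-insert-same i∉S))
        (cong (λ l → k (κ (item l)) (S ∪ ⁅ item i ⁆)) (Finₚ.toℕ-injective (sym (ℕₚ.suc-injective eq)))))
    ; z≡ = trans (cong (ℤ._+ p̂ (item i)) z≡) (sym (ℤΣ.setSum-insert p̂ i∉S))
    ; prefix = λ {x} h → case Subₚ.x∈p∪q⁻ S ⁅ item i ⁆ h of λ
        { (inj₁ x∈S) → let (l , l<i , eq) = prefix x∈S in l , ℕₚ.m<n⇒m<1+n l<i , eq
        ; (inj₂ x∈i) → i , ℕₚ.≤-refl , sym (Subₚ.x∈⁅y⁆⇒x≡y (item i) x∈i) } }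
    where
    open Describes D
    i∉S = unpacked i D

  at : ∀ {j} .(j<n : j ℕ.< n) {s S} → Describes j s S → Describes (toℕ (fromℕ< j<n)) s S
  at j<n {s} {S} = subst (λ j → Describes j s S) (sym (Finₚ.toℕ-fromℕ< j<n))

  at⁻¹ : ∀ {j} .(j<n : j ℕ.< n) {s S} → Describes (suc (toℕ (fromℕ< j<n))) s S → Describes (suc j) s S
  at⁻¹ j<n {s} {S} = subst (λ j → Describes (suc j) s S) (Finₚ.toℕ-fromℕ< j<n)

  InRange : ℤ → Set
  InRange z = zmin ℤ.≤ z × z ℤ.≤ zmax

  record Sound (j : ℕ) .(j≤n : j ℕ.≤ n) (s : State) (S : Subset n) : Set where
    field
      describes : Describes j s S
      value     : table j j≤n s ≡ just (weight S)
      in-range  : InRange (proj₂ (proj₂ (proj₂ s)))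

  -- The equations stored in `skip` and `pack` make each entry equal to its predecessor, plus the
  -- weight of a packed item. Hence the recovered set weighs exactly what the entry says.
  backtrack-sound : ∀ {j s S} .(j≤n : j ℕ.≤ n) → Backtrack j j≤n s S → Sound j j≤n s S
  backtrack-sound _ start = record
    { describes = describes-start ; value = origin-value ; in-range = zmin≤0 , 0≤zmax }
    where
    origin-value : table 0 ℕ.z≤n origin ≡ just (weight Sub.⊥)
    origin-value = cong just (sym (ℕΣ.setSum-⊥ n w))
  backtrack-sound _ (skip {S = S} j<n bt eq eq′) = record
    { describes = at⁻¹ j<n {S = S} (describes-skip (fromℕ< j<n) (at j<n describes))
    ; value = trans eq′ (trans (sym eq) value) ; in-range = in-range }
    where open Sound (backtrack-sound _ bt)
  backtrack-sound _ (pack {S = S} {v} j<n bt eq can eq′) = record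
    { describes = at⁻¹ j<n (describes-pack (fromℕ< j<n) D)
    ; value = trans eq′ (cong just (trans (cong (ℕ._+ w (item (fromℕ< j<n))) (just-injective (trans (sym eq) value)))
                                          (sym (weight-insert (unpacked (fromℕ< j<n) D)))))
    ; in-range = proj₁ can }
    where
    open Sound (backtrack-sound _ bt)
    D = at j<n describes

  backtrack-exists : ∀ j .(j≤n : j ℕ.≤ n) {s v} → table j j≤n s ≡ just v → ∃ (Backtrack j j≤n s)
  backtrack-exists zero j≤n {s} {v} = if-elim (λ x → x ≡ just v → ∃ (Backtrack zero j≤n s)) (s ≟ₛ origin)
    (λ { refl _ → Sub.⊥ , start }) (λ _ ())
  backtrack-exists (suc j) j<n h with table-source j<n h
  ... | s , v , eq , skipped    = let (S , bt) = backtrack-exists j (ℕₚ.<⇒≤ j<n) eq in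
                                  S , skip j<n bt eq h
  ... | s , v , eq , packed can = let (S , bt) = backtrack-exists j (ℕₚ.<⇒≤ j<n) eq in
                                  S ∪ ⁅ item (fromℕ< j<n) ⁆ , pack j<n bt eq can h

  ∈-intervalℤ : ∀ {lo hi z} → lo ℤ.≤ z → z ℤ.≤ hi → z ∈ˡ intervalℤ lo hi
  ∈-intervalℤ {lo} {hi} {z} lo≤z z≤hi = Memₚ.∈-filter⁺ (ℤ._≤? hi)
    (subst (_∈ˡ List.map (λ j → lo ℤ.+ + j) (List.upTo (suc ℤ.∣ hi ℤ.- lo ∣)))
      (trans (cong (λ e → lo ℤ.+ e) abs-z) (cancel lo z))
      (Memₚ.∈-map⁺ (λ j → lo ℤ.+ + j) (Memₚ.∈-upTo⁺ (ℕ.s≤s (ℤₚ.drop‿+≤+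
        (subst₂ ℤ._≤_ (sym abs-z) (sym abs-hi) (ℤₚ.+-monoˡ-≤ (ℤ.- lo) z≤hi))))))) z≤hi
    where
    cancel : ∀ a b → a ℤ.+ (b ℤ.- a) ≡ b
    cancel = ℤSolver.solve-∀
    abs-z : + ℤ.∣ z ℤ.- lo ∣ ≡ z ℤ.- lo
    abs-z = ℤₚ.0≤i⇒+∣i∣≡i (ℤₚ.i≤j⇒0≤j-i lo≤z)
    abs-hi : + ℤ.∣ hi ℤ.- lo ∣ ≡ hi ℤ.- lo
    abs-hi = ℤₚ.0≤i⇒+∣i∣≡i (ℤₚ.i≤j⇒0≤j-i (ℤₚ.≤-trans lo≤z z≤hi))

  -- The sweep visits only listed states, so membership is needed before any transition out of a
  -- state can be used.
  ∈-states : ∀ {j s S} → Describes j s S → InRange (proj₂ (proj₂ (proj₂ s))) → s ∈ˡ states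
  ∈-states {S = S} D (lo≤z , z≤hi) =
    Memₚ.∈-cartesianProduct⁺ (index t≤n)
      (Memₚ.∈-cartesianProduct⁺ (index (ℕₚ.≤-trans (ℕₚ.≤-reflexive d≡) (ℕₚ.≤-trans (d≤size S) (Subₚ.∣p∣≤n S))))
        (Memₚ.∈-cartesianProduct⁺ (index (ℕₚ.≤-trans a≤t t≤n)) (∈-intervalℤ lo≤z z≤hi)))
    where
    open Describes D
    t≤n = ℕₚ.≤-trans (ℕₚ.≤-reflexive t≡) (Subₚ.∣p∣≤n S)
    index : ∀ {j} → j ℕ.≤ n → j ∈ˡ List.upTo (suc n)
    index h = Memₚ.∈-upTo⁺ (ℕ.s≤s h)

  -- The program meets the prefixes of `T` in processing order, and all their sums must stay in
  -- range. Quantifying over all subsets avoids any reference to that order.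
  Admissible : Subset n → Set
  Admissible T = ∀ {S} → S ⊆ T → InRange (ℤΣ.setSum S p̂)

  module Complete {T : Subset n} (T-weight : weight T ℕ.≤ b) (admissible : Admissible T) where

    -- `S` is the part of `T` among the first `j` items. The entry is only bounded by the weight of
    -- `S`, because a lighter set may share the state; this bound still suffices for the capacity
    -- test of the next packing.
    record Tracked (j : ℕ) .(j≤n : j ℕ.≤ n) : Set where
      field
        {s}       : State
        {S}       : Subset n
        S⊆T       : S ⊆ T
        covers    : ∀ i → toℕ i ℕ.< j → item i ∈ T → item i ∈ S
        describes : Describes j s S
        value     : AtMost (table j j≤n s) (weight S)

    earlier : ∀ {j} .(j<n : j ℕ.< n) l → toℕ l ℕ.< suc j → l ≢ fromℕ< j<n → toℕ l ℕ.< j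
    earlier j<n l l<1+j l≢j = ℕₚ.≤∧≢⇒< (ℕₚ.≤-pred l<1+j)
      λ l≡j → l≢j (Finₚ.toℕ-injective (trans l≡j (sym (Finₚ.toℕ-fromℕ< j<n))))

    tracked : ∀ j .(j≤n : j ℕ.≤ n) → Tracked j j≤n
    tracked zero _ = record
      { s = origin ; S = Sub.⊥ ; S⊆T = λ h → ⊥-elim (Subₚ.∉⊥ h) ; covers = λ _ () ; describes = describes-start
      ; value = 0 , refl , ℕ.z≤n }
    tracked (suc j) j<n with tracked j (ℕₚ.<⇒≤ j<n)
    ... | record { s = s ; S = S ; S⊆T = S⊆T ; covers = covers ; describes = D ; value = v , eq , v≤ }
        with item (fromℕ< j<n) Subₚ.∈? T
    ...   | no i∉T = record
            { s = skipTo i s ; S = S ; S⊆T = S⊆T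
            ; covers = λ l l<1+j l∈T → covers l (earlier j<n l l<1+j λ { refl → i∉T l∈T }) l∈T
            ; describes = at⁻¹ j<n (describes-skip i (at j<n D))
            ; value = atMost-≤ v≤ (table-reaches j<n s∈ eq skipped) }
      where
      i = fromℕ< j<n
      s∈ = ∈-states D (subst InRange (sym (Describes.z≡ D)) (admissible S⊆T))
    ...   | yes i∈T = record
            { s = packTo i s ; S = S′ ; S⊆T = S′⊆T
            ; covers = λ l l<1+j l∈T → case l Fin.≟ i of λ
                { (yes refl) → Subₚ.x∈p∪q⁺ (inj₂ (Subₚ.x∈⁅x⁆ (item i)))
                ; (no l≢i)   → Subₚ.x∈p∪q⁺ (inj₁ (covers l (earlier j<n l l<1+j l≢i) l∈T)) }
            ; describes = D′
            ; value = atMost-≤ v′≤ (table-reaches j<n s∈ eq (packed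
                (subst InRange (trans (ℤΣ.setSum-insert p̂ i∉S) (cong (ℤ._+ p̂ (item i)) (sym (Describes.z≡ D)))) (admissible S′⊆T) ,
                 ℕₚ.≤-trans v′≤ (ℕₚ.≤-trans (setSumℕ-⊆ w S′⊆T) T-weight)))) }
      where
      i = fromℕ< j<n
      S′ = S ∪ ⁅ item i ⁆
      i∉S = unpacked i (at j<n D)
      D′ = at⁻¹ j<n (describes-pack i (at j<n D))
      s∈ = ∈-states D (subst InRange (sym (Describes.z≡ D)) (admissible S⊆T))
      S′⊆T : S′ ⊆ T
      S′⊆T h = case Subₚ.x∈p∪q⁻ S ⁅ item i ⁆ h of λ
        { (inj₁ x∈S) → S⊆T x∈S
        ; (inj₂ x∈i) → subst (_∈ T) (sym (Subₚ.x∈⁅y⁆⇒x≡y (item i) x∈i)) i∈T }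
      v′≤ : v ℕ.+ w (item i) ℕ.≤ weight S′
      v′≤ = ℕₚ.≤-trans (ℕₚ.+-monoˡ-≤ (w (item i)) v≤) (ℕₚ.≤-reflexive (sym (weight-insert i∉S)))

    terminal-state : ColorFeasible T → ∃ λ a → Terminal (∣ T ∣ , d T , a , ℤΣ.setSum T p̂)
    terminal-state cf with tracked n ℕₚ.≤-refl
    ... | record { s = t , _ , a , z ; S = S ; S⊆T = S⊆T ; covers = covers ; describes = D ; value = v , eq , v≤ } =
      a , (v , subst (λ s → table n ℕₚ.≤-refl s ≡ just v) state-eq eq ,
           ℕₚ.≤-trans v≤ (ℕₚ.≤-trans (setSumℕ-⊆ w S⊆T) T-weight)) , cf
      where
      open Describes D
      T⊆S : T ⊆ S
      T⊆S {x} x∈T = subst (_∈ S) (Perm.inverseʳ π) (covers (π Perm.⟨$⟩ˡ x) (Finₚ.toℕ<n _) (subst (_∈ T) (sym (Perm.inverseʳ π)) x∈T))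
      S≡T : S ≡ T
      S≡T = Subₚ.⊆-antisym S⊆T T⊆S
      state-eq : (t , _ , a , z) ≡ (∣ T ∣ , d T , a , ℤΣ.setSum T p̂)
      state-eq = subst (λ T → (t , _ , a , z) ≡ (∣ T ∣ , d T , a , ℤΣ.setSum T p̂)) S≡T
        (cong₂ _,_ t≡ (cong₂ _,_ d≡ (cong (a ,_) z≡)))

  terminal? : ∀ s → Dec (Terminal s)
  terminal? s@(t , d , _ , _) = finite? (table n ℕₚ.≤-refl s) Decidable.×-dec (2 ℕ.* d ℕ.≤? t ℕ.+ 1)
    where
    finite? : ∀ x → Dec (∃ λ v → x ≡ just v × v ℕ.≤ b)
    finite? nothing  = no λ ()
    finite? (just v) = Decidable.map′ (λ v≤b → v , refl , v≤b) (λ { (_ , refl , v≤b) → v≤b }) (v ℕ.≤? b)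

  -- `maximal` ranges over all terminal states, but the search only over listed ones. A finite entry
  -- can be backtracked to a set that its state describes, so the state is listed.
  terminal∈states : ∀ {s} → Terminal s → s ∈ˡ states
  terminal∈states ((v , eq , _) , _) = ∈-states (Sound.describes sound) (Sound.in-range sound)
    where sound = backtrack-sound ℕₚ.≤-refl (proj₂ (backtrack-exists n ℕₚ.≤-refl eq))

  empty-terminal : ∃ Terminal
  empty-terminal = _ , proj₂ (Complete.terminal-state {Sub.⊥}
    (subst (ℕ._≤ b) (sym (ℕΣ.setSum-⊥ n w)) ℕ.z≤n)
    (λ {S} S⊆⊥ → subst (λ S → InRange (ℤΣ.setSum S p̂)) (sym (Subₚ.⊆-antisym S⊆⊥ (Subₚ.⊆-min S)))
      (subst InRange (sym (ℤΣ.setSum-⊥ n p̂)) (zmin≤0 , 0≤zmax)))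
    (subst (λ d → 2 ℕ.* d ℕ.≤ ∣ Sub.⊥ {n} ∣ ℕ.+ 1) (Describes.d≡ describes-start) ℕ.z≤n))

  returns-exists : ∃ Returns
  returns-exists = proj₁ bt , record { terminal = best-terminal ; maximal = λ {t} {d} {a} {z} → best-maximal {t , d , a , z} ; backtrack = proj₂ bt }
    where
    z-of : State → ℤ
    z-of s = proj₂ (proj₂ (proj₂ s))
    candidates = List.filter terminal? states
    s₀ = proj₁ empty-terminal
    best = ℤExtrema.argmax z-of s₀ candidates
    best-terminal : Terminal best
    best-terminal with ℤExtrema.argmax-sel z-of s₀ candidates
    ... | inj₁ eq = subst Terminal (sym eq) (proj₂ empty-terminal)
    ... | inj₂ h  = proj₂ (Memₚ.∈-filter⁻ terminal? {xs = states} h)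
    best-maximal : ∀ {s} → Terminal s → z-of s ℤ.≤ z-of best
    best-maximal {s} ts = All.lookup (ℤExtrema.f[xs]≤f[argmax] {f = z-of} s₀ candidates) (Memₚ.∈-filter⁺ terminal? (terminal∈states {s} ts) ts)
    bt : ∃ (Backtrack n ℕₚ.≤-refl best)
    bt = backtrack-exists n ℕₚ.≤-refl (proj₁ (proj₂ (proj₁ best-terminal)))

  returns-feasible : ∀ {Ŝ} → Returns Ŝ → Feasible Ŝ
  returns-feasible {Ŝ} record { terminal = (v , eq , v≤b) , balanced ; backtrack = bt } =
    subst₂ (λ d t → 2 ℕ.* d ℕ.≤ t ℕ.+ 1) d≡ t≡ balanced ,
    subst (ℕ._≤ b) (just-injective (trans (sym eq) value)) v≤b
    where
    open Sound (backtrack-sound ℕₚ.≤-refl bt)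
    open Describes describes

  returns-maximal : ∀ {Ŝ T} → Returns Ŝ → Feasible T → Admissible T → ℤΣ.setSum T p̂ ℤ.≤ ℤΣ.setSum Ŝ p̂
  returns-maximal {Ŝ} {T} record { maximal = maximal ; backtrack = bt } (cf , wt) admissible =
    subst (ℤΣ.setSum T p̂ ℤ.≤_) z≡ (maximal (proj₂ (Complete.terminal-state {T} wt admissible cf)))
    where
    open Sound (backtrack-sound ℕₚ.≤-refl bt)
    open Describes describes

-- Existence of a grouping by color.

module Sorting where

  -- Selection sort: an item of least color goes first, and the others, numbered through `punchIn`,
  -- are sorted recursively. The cast of colors to ℤ gives access to `minimal-element`.
  sorting-permutation : ∀ {n m} (f : Fin n → Fin m) →
    ∃ λ (π : Permutation′ n) → ∀ i j → i Fin.≤ j → f (π ⟨$⟩ʳ i) Fin.≤ f (π ⟨$⟩ʳ j)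
  sorting-permutation {zero}  f = Perm.id , λ ()
  sorting-permutation {suc n} f with minimal-element (λ i → + toℕ (f i)) {Sub.⊤} {zero} Subₚ.∈⊤
  ... | i₀ , _ , least with sorting-permutation (f ∘ punchIn i₀)
  ...   | π , sorted = Perm.insert zero i₀ π , λ
    { zero    j       _   → ℤₚ.drop‿+≤+ (least (Perm.insert zero i₀ π ⟨$⟩ʳ j) Subₚ.∈⊤)
    ; (suc i) (suc j) i≤j → subst₂ (λ a b → f a Fin.≤ f b) (sym (Perm.insert-punchIn zero i₀ π i))
                              (sym (Perm.insert-punchIn zero i₀ π j)) (sorted i j (ℕₚ.≤-pred i≤j)) }

  -- In sorted order, a color between two equal colors is squeezed to the same value.
  grouping-exists : (I : Instance) → ∃ (ColKP.GroupedByColor I)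
  grouping-exists I with sorting-permutation (Instance.κ I)
  ... | π , sorted = π , λ i j l i<j j<l same → Finₚ.≤-antisym
    (subst (κ (π ⟨$⟩ʳ j) Fin.≤_) (sym same) (sorted j l (ℕₚ.<⇒≤ j<l))) (sorted i j (ℕₚ.<⇒≤ i<j))
    where open Instance I

-- Rounding and the scaling factor.

module Floor where

  open import Data.Rational using (_+_; _*_; _-_; -_; _≤_; _<_; floor; ceiling)

  floor-≤ : ∀ q → fromℤ (floor q) ≤ q
  floor-≤ q@record{} = ℚ.*≤* (ℤₚ.≤-trans (ℤDM.[n/d]*d≤n (ℚ.↥ q) (ℚ.↧ q)) (ℤₚ.≤-reflexive (sym (ℤₚ.*-identityʳ (ℚ.↥ q)))))

  <-floor+1 : ∀ q → q < fromℤ (floor q) + 1ℚ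
  <-floor+1 q@record{} = subst (q <_) (trans (cong fromℤ (ℤₚ.+-comm (+ 1) (floor q))) (fromℤ-+ (floor q) (+ 1)))
    (ℚ.*<* (subst₂ ℤ._<_ (sym (ℤₚ.*-identityʳ (ℚ.↥ q)))
      (cong (λ e → ℤ.suc e ℤ.* ℚ.↧ q) (sym (ℤDM.div-pos-is-/ℕ (ℚ.↥ q) (ℚ.↧ₙ q))))
      (ℤDM.n<s[n/ℕd]*d (ℚ.↥ q) (ℚ.↧ₙ q))))

  ≤-ceiling : ∀ q → q ≤ fromℤ (ceiling q)
  ≤-ceiling q@record{} = by≤ (≤⇒0≤ (floor-≤ (- q))) (trans (lemma q (fromℤ (floor (- q)))) (cong (_- q) (sym (fromℤ-neg (floor (- q))))))
    where
    lemma : ∀ q f → - q - f ≡ - f - q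
    lemma = solve-∀ ℚ-ring

  floor-nonneg : ∀ {q} → 0ℚ ≤ q → 0ℤ ℤ.≤ floor q
  floor-nonneg {q} 0≤q = subst (0ℤ ℤ.≤_) (ℤₚ.pred-suc (floor q)) (ℤₚ.i<j⇒i≤pred[j]
    (fromℤ-cancel-< (subst (0ℚ <_) (trans (ℚₚ.+-comm (fromℤ (floor q)) 1ℚ) (sym (fromℤ-+ (+ 1) (floor q))))
      (ℚₚ.≤-<-trans 0≤q (<-floor+1 q)))))

module _ where

  open import Data.Rational using (_+_; _*_; _-_; -_; _≤_; _<_)

  scale-setSum : ∀ {n} η (S : Subset n) f → η * ℚΣ.setSum S f ≡ ℚΣ.setSum S (λ i → η * f i)
  scale-setSum η []            f = ℚₚ.*-zeroʳ η
  scale-setSum η (inside  ∷ S) f = trans (ℚₚ.*-distribˡ-+ η (f zero) (ℚΣ.setSum S (f ∘ suc)))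
                                         (+-congʳ (η * f zero) (scale-setSum η S (f ∘ suc)))
  scale-setSum η (outside ∷ S) f = trans (ℚₚ.*-distribˡ-+ η 0ℚ (ℚΣ.setSum S (f ∘ suc)))
                                         (cong₂ _+_ (ℚₚ.*-zeroʳ η) (scale-setSum η S (f ∘ suc)))

  setSumℚ-mono : ∀ {n} (S : Subset n) {f g : Fin n → ℚ} → (∀ i → f i ≤ g i) → ℚΣ.setSum S f ≤ ℚΣ.setSum S g
  setSumℚ-mono S {f} {g} h = sumℚ-mono λ i → lemma i (lookup S i)
    where
    lemma : ∀ i b → (if b then f i else 0ℚ) ≤ (if b then g i else 0ℚ)
    lemma i true  = h i
    lemma i false = ℚₚ.≤-refl

  sum-constant : ∀ n c → sumℚ {n} (λ _ → c) ≡ fromℕ n * c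
  sum-constant zero    c = sym (ℚₚ.*-zeroˡ c)
  sum-constant (suc n) c = trans (+-congʳ c (sum-constant n c)) (trans (lemma (fromℕ n) c) (cong (_* c) (sym (fromℕ-suc n))))
    where
    lemma : ∀ a c → c + a * c ≡ (1ℚ + a) * c
    lemma = solve-∀ ℚ-ring

  /-cancel : ∀ i k .{{_ : ℕ.NonZero k}} → (i ℚ./ k) * fromℕ k ≡ fromℤ i
  /-cancel i (suc k) = ℚₚ.toℚᵘ-injective (ℚᵘₚ.≃-trans (ℚₚ.toℚᵘ-homo-* (i ℚ./ suc k) (fromℕ (suc k)))
    (ℚᵘₚ.≃-trans (ℚᵘₚ.*-congʳ {ℚ.toℚᵘ (fromℕ (suc k))} (ℚₚ.toℚᵘ-fromℚᵘ (ℚᵘ.mkℚᵘ i k)))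
      (ℚᵘ.*≡* (lemma i (+ suc k)))))
    where
    lemma : ∀ a b → a ℤ.* b ℤ.* + 1 ≡ a ℤ.* (b ℤ.* + 1)
    lemma = ℤSolver.solve-∀

∈-allSubsets : ∀ {n} (S : Subset n) → S Mem.∈ allSubsets n
∈-allSubsets []            = here refl
∈-allSubsets (inside  ∷ S) = Memₚ.∈-++⁺ˡ (Memₚ.∈-map⁺ (inside ∷_) (∈-allSubsets S))
∈-allSubsets {suc n} (outside ∷ S) =
  Memₚ.∈-++⁺ʳ (List.map (inside ∷_) (allSubsets n)) (Memₚ.∈-map⁺ (outside ∷_) (∈-allSubsets S))

-- The optimum is attained.

module Optimum (I : Instance) where

  open ColKP I

  empty-feasible : Feasible Sub.⊥
  empty-feasible =
    subst (λ d → 2 ℕ.* d ℕ.≤ ∣ Sub.⊥ {n} ∣ ℕ.+ 1) (sym (ℕₚ.n≤0⇒n≡0 (subst (d Sub.⊥ ℕ.≤_) (Subₚ.∣⊥∣≡0 n) (d≤size Sub.⊥)))) ℕ.z≤n ,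
    subst (ℕ._≤ b) (sym (ℕΣ.setSum-⊥ n w)) ℕ.z≤n
    where open ColorCounts I

  ≤OPT : ∀ {S} → Feasible S → profit S ℤ.≤ OPT
  ≤OPT {S} f = All.lookup (ℤExtrema.xs≤max 0ℤ (List.map profit (List.filter feasible? (allSubsets n))))
    (Memₚ.∈-map⁺ profit (Memₚ.∈-filter⁺ feasible? (∈-allSubsets S) f))

  OPT-attained : ∃ λ S → Feasible S × profit S ≡ OPT
  OPT-attained with ℤExtrema.argmax-sel id 0ℤ (List.map profit (List.filter feasible? (allSubsets n)))
  ... | inj₁ eq = Sub.⊥ , empty-feasible , trans (ℤΣ.setSum-⊥ n p) (sym eq)
  ... | inj₂ h with Memₚ.∈-map⁻ profit h
  ...   | S , S∈ , eq = S , proj₂ (Memₚ.∈-filter⁻ feasible? {xs = allSubsets n} S∈) , sym eq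

-- Scaled profits: range and approximation.

module ScaledProfits (I : Instance)
                     (-pmax≤p : ∀ i → ℤ.- ColKP.pmax I ℤ.≤ Instance.p I i)
                     (p≤pmax : ∀ i → Instance.p I i ℤ.≤ ColKP.pmax I)
                     (0<pmax : 0ℤ ℤ.< ColKP.pmax I)
                     {L : Subset (Instance.n I)} (pmax≤L : ColKP.pmax I ℤ.≤ ColKP.profit I L)
                     (UB-valid : ∀ T → ColKP.Feasible I T → ColKP.profit I T ℤ.≤ + 3 ℤ.* ColKP.profit I L)
                     {ε : ℚ} (0<ε : 0ℚ ℚ.< ε) (ε<1 : ε ℚ.< 1ℚ) where

  open ColKP I
  open LinearProgram I using (P)
  open Coloring I using (profit≡)
  open Scaling ε (profit L)
  open Floor
  open import Data.Rational using (_+_; _*_; _-_; -_; _≤_; _<_; floor; ceiling)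

  LB Pmax N : ℚ
  LB   = fromℤ (profit L)
  Pmax = fromℤ pmax
  N    = fromℕ n

  0<Pmax : 0ℚ < Pmax
  0<Pmax = fromℤ-mono-< 0<pmax

  0<LB : 0ℚ < LB
  0<LB = fromℤ-mono-< (ℤₚ.<-≤-trans 0<pmax pmax≤L)

  0<N : 0ℚ < N
  0<N = fromℤ-mono-< (ℤ.+<+ (ℕ.>-nonZero⁻¹ n))

  N*scale : N * scale ≡ ε * LB
  N*scale = trans (lemma N ε (profit L ℚ./ n)) (cong (λ e → ε * e) (/-cancel (profit L) n))
    where
    lemma : ∀ a e b → a * (e * b) ≡ e * (b * a)
    lemma = solve-∀ ℚ-ring

  0<scale : 0ℚ < scale
  0<scale = ℚₚ.*-cancelˡ-<-nonNeg N {{ℚ.nonNegative (ℚₚ.<⇒≤ 0<N)}}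
    (subst₂ _<_ (sym (ℚₚ.*-zeroʳ N)) (sym N*scale) (0<* 0<ε 0<LB))

  scale-nonZero : ℚ.NonZero scale
  scale-nonZero = ℚₚ.pos⇒nonZero scale {{ℚ.positive 0<scale}}

  module _ .{{scale≢0 : ℚ.NonZero scale}} where

    scale*÷ : ∀ q → scale * (q ℚ.÷ scale) ≡ q
    scale*÷ q = trans (lemma scale q (ℚ.1/ scale)) (trans (cong (λ e → q * e) (ℚₚ.*-inverseʳ scale)) (ℚₚ.*-identityʳ q))
      where
      lemma : ∀ s q i → s * (q * i) ≡ q * (s * i)
      lemma = solve-∀ ℚ-ring

    ≤÷ : ∀ {z q} → scale * z ≤ q → z ≤ q ℚ.÷ scale
    ≤÷ {z} {q} h = ℚₚ.*-cancelˡ-≤-pos scale {{ℚ.positive 0<scale}} (subst (scale * z ≤_) (sym (scale*÷ q)) h)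

    ÷≤ : ∀ {z q} → q ≤ scale * z → q ℚ.÷ scale ≤ z
    ÷≤ {z} {q} h = ℚₚ.*-cancelˡ-≤-pos scale {{ℚ.positive 0<scale}} (subst (_≤ scale * z) (sym (scale*÷ q)) h)

    Q : Fin n → ℚ
    Q i = scale * fromℤ (p̂ i)

    Q≤P : ∀ i → Q i ≤ P i
    Q≤P i = subst (Q i ≤_) (scale*÷ (P i)) (ℚₚ.*-monoˡ-≤-nonNeg scale {{ℚ.nonNegative (ℚₚ.<⇒≤ 0<scale)}} (floor-≤ (P i ℚ.÷ scale)))

    P≤Q+scale : ∀ i → P i ≤ Q i + scale
    P≤Q+scale i = subst₂ _≤_ (scale*÷ (P i)) (lemma scale (fromℤ (p̂ i)))
      (ℚₚ.*-monoˡ-≤-nonNeg scale {{ℚ.nonNegative (ℚₚ.<⇒≤ 0<scale)}} (ℚₚ.<⇒≤ (<-floor+1 (P i ℚ.÷ scale))))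
      where
      lemma : ∀ s a → s * (a + 1ℚ) ≡ s * a + s
      lemma = solve-∀ ℚ-ring

    scaled : Subset n → ℤ
    scaled S = ℤΣ.setSum S p̂

    scale*scaled : ∀ S → scale * fromℤ (scaled S) ≡ ℚΣ.setSum S Q
    scale*scaled S = trans (cong (λ e → scale * e) (fromℤ-setSum S p̂)) (scale-setSum scale S (fromℤ ∘ p̂))

    scaled≤profit : ∀ S → scale * fromℤ (scaled S) ≤ fromℤ (profit S)
    scaled≤profit S = subst₂ _≤_ (sym (scale*scaled S)) (sym (profit≡ S)) (setSumℚ-mono S Q≤P)

    -- The comparison is made index by index over all `n` items, whatever their membership in `S`
    -- and `T`, so an allowance of `c` per index totals `N * c`.
    sum-bound : ∀ (S T : Subset n) f g c → (∀ i → (if lookup S i then f i else 0ℚ) ≤ (if lookup T i then g i else 0ℚ) + c) →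
                ℚΣ.setSum S f ≤ ℚΣ.setSum T g + N * c
    sum-bound S T f g c h = ℚₚ.≤-trans (sumℚ-mono h) (ℚₚ.≤-reflexive
      (trans (ℚΣ.∑-distrib-+ (λ i → if lookup T i then g i else 0ℚ) (λ _ → c)) (+-congʳ (ℚΣ.setSum T g) (sum-constant n c))))

    profit≤scaled : ∀ S → fromℤ (profit S) ≤ scale * fromℤ (scaled S) + ε * LB
    profit≤scaled S = subst₂ _≤_ (sym (profit≡ S)) (cong₂ _+_ (sym (scale*scaled S)) N*scale)
      (sum-bound S S P Q scale λ i → lemma i (lookup S i))
      where
      lemma : ∀ i b → (if b then P i else 0ℚ) ≤ (if b then Q i else 0ℚ) + scale
      lemma i true  = P≤Q+scale i
      lemma i false = by≤ (ℚₚ.<⇒≤ 0<scale) (r scale)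
        where
        r : ∀ s → s ≡ 0ℚ + s - 0ℚ
        r = solve-∀ ℚ-ring

    -Pmax≤P : ∀ i → 0ℚ ≤ P i + Pmax
    -Pmax≤P i = subst (λ e → 0ℚ ≤ e) (trans (cong (λ e → P i - e) (fromℤ-neg pmax)) (r (P i) Pmax)) (≤⇒0≤ (fromℤ-mono-≤ (-pmax≤p i)))
      where
      r : ∀ a b → a - (- b) ≡ a + b
      r = solve-∀ ℚ-ring

    -- Rounding down loses at most n · scale = ε LB ≤ LB in total, and this is
    -- compensated by the slack of -pmax on the items of L.
    scaled-lower : ∀ S → - (N * Pmax) ≤ scale * fromℤ (scaled S)
    scaled-lower S = by≤ (0≤+ (≤⇒0≤ L≤S) (0≤* (ℚₚ.<⇒≤ (<⇒0< ε<1)) (ℚₚ.<⇒≤ 0<LB)))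
      (trans (cong₂ (λ u v → ℚΣ.setSum S Q + v - u + (1ℚ - ε) * LB) (sym (profit≡ L))
               (trans (r₁ N scale Pmax) (cong (λ e → e + N * Pmax) N*scale)))
        (trans (r₂ (ℚΣ.setSum S Q) ε LB N Pmax) (cong (_- - (N * Pmax)) (sym (scale*scaled S)))))
      where
      r₁ : ∀ n s m → n * (s + m) ≡ n * s + n * m
      r₁ = solve-∀ ℚ-ring
      r₂ : ∀ q e l n m → q + (e * l + n * m) - l + (1ℚ - e) * l ≡ q - (- (n * m))
      r₂ = solve-∀ ℚ-ring
      0≤scale = ℚₚ.<⇒≤ 0<scale
      lemma : ∀ i b b′ → (if b then P i else 0ℚ) ≤ (if b′ then Q i else 0ℚ) + (scale + Pmax)
      lemma i true  true  = by≤ (0≤+ (≤⇒0≤ (P≤Q+scale i)) (ℚₚ.<⇒≤ 0<Pmax)) (r (P i) (Q i) scale Pmax)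
        where
        r : ∀ p q s m → q + s - p + m ≡ q + (s + m) - p
        r = solve-∀ ℚ-ring
      lemma i true  false = by≤ (0≤+ 0≤scale (≤⇒0≤ (fromℤ-mono-≤ (p≤pmax i)))) (r (P i) scale Pmax)
        where
        r : ∀ p s m → s + (m - p) ≡ 0ℚ + (s + m) - p
        r = solve-∀ ℚ-ring
      lemma i false true  = by≤ (0≤+ (≤⇒0≤ (P≤Q+scale i)) (-Pmax≤P i)) (r (P i) (Q i) scale Pmax)
        where
        r : ∀ p q s m → q + s - p + (p + m) ≡ q + (s + m) - 0ℚ
        r = solve-∀ ℚ-ring
      lemma i false false = by≤ (0≤+ 0≤scale (ℚₚ.<⇒≤ 0<Pmax)) (r scale Pmax)
        where
        r : ∀ s m → s + m ≡ 0ℚ + (s + m) - 0ℚ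
        r = solve-∀ ℚ-ring
      L≤S : ℚΣ.setSum L P ≤ ℚΣ.setSum S Q + N * (scale + Pmax)
      L≤S = sum-bound L S P Q (scale + Pmax) λ i → lemma i (lookup L i) (lookup S i)

    module _ {S T : Subset n} (S⊆T : S ⊆ T) (T-feasible : Feasible T) where

      -- Since `S` need not be feasible, it is compared with `T`. Leaving out an item of `T` gains
      -- at most `c`: this is 0 if all profits are nonnegative and `Pmax` otherwise, matching the
      -- two cases of `zmax`.
      subset-profit : ∀ c → (∀ i → 0ℚ ≤ P i + c) → 0ℚ ≤ c → scale * fromℤ (scaled S) ≤ fromℤ UB + N * c
      subset-profit c h 0≤c = ℚₚ.≤-trans (scaled≤profit S) (ℚₚ.≤-trans (ℚₚ.≤-reflexive (profit≡ S))
        (ℚₚ.≤-trans (sum-bound S T P P c λ i → lemma i (i Subₚ.∈? S))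
          (ℚₚ.+-monoˡ-≤ (N * c) (ℚₚ.≤-trans (ℚₚ.≤-reflexive (sym (profit≡ T))) (fromℤ-mono-≤ (UB-valid T T-feasible))))))
        where
        r₁ : ∀ a c → c ≡ a + c - a
        r₁ = solve-∀ ℚ-ring
        r₂ : ∀ a → a ≡ a - 0ℚ
        r₂ = solve-∀ ℚ-ring
        r₃ : ∀ a → a ≡ 0ℚ + a - 0ℚ
        r₃ = solve-∀ ℚ-ring
        lemma : ∀ i → Dec (i ∈ S) → (if lookup S i then P i else 0ℚ) ≤ (if lookup T i then P i else 0ℚ) + c
        lemma i (yes i∈S) rewrite ∈⇒lookup i∈S | ∈⇒lookup (S⊆T i∈S) = by≤ 0≤c (r₁ (P i) c)
        lemma i (no  i∉S) rewrite ∉⇒lookup i∉S with lookup T i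
        ... | true  = by≤ (h i) (r₂ (P i + c))
        ... | false = by≤ 0≤c (r₃ c)

      below-zmax : scaled S ℤ.≤ zmax
      below-zmax = if-elim (scaled S ℤ.≤_) allNonneg?
        (λ p≥0 → ceil (subst (scale * fromℤ (scaled S) ≤_) (r (fromℤ UB) N)
          (subset-profit 0ℚ (λ i → subst (0ℚ ≤_) (sym (ℚₚ.+-identityʳ (P i))) (fromℤ-mono-≤ (p≥0 i))) ℚₚ.≤-refl)))
        (λ _ → ceil (subst (scale * fromℤ (scaled S) ≤_)
          (sym (trans (fromℤ-+ UB (+ n ℤ.* pmax)) (+-congʳ (fromℤ UB) (fromℤ-* (+ n) pmax))))
          (subset-profit Pmax -Pmax≤P (ℚₚ.<⇒≤ 0<Pmax))))
        where
        r : ∀ u n → u + n * 0ℚ ≡ u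
        r = solve-∀ ℚ-ring
        ceil : ∀ {q z} → scale * fromℤ z ≤ q → z ℤ.≤ ceiling (q ℚ.÷ scale)
        ceil {q} h = fromℤ-cancel-≤ (ℚₚ.≤-trans (≤÷ h) (≤-ceiling (q ℚ.÷ scale)))

    above-zmin : ∀ S → zmin ℤ.≤ scaled S
    above-zmin S = if-elim (ℤ._≤ scaled S) allNonneg?
      (λ p≥0 → nonneg (λ i → floor-nonneg {P i ℚ.÷ scale} (≤÷ {0ℚ} {P i} (subst (_≤ P i) (sym (ℚₚ.*-zeroʳ scale)) (fromℤ-mono-≤ (p≥0 i))))))
      (λ _ → fromℤ-cancel-≤ (ℚₚ.≤-trans (floor-≤ (fromℤ (ℤ.- (+ n ℤ.* pmax)) ℚ.÷ scale))
        (÷≤ (subst (_≤ scale * fromℤ (scaled S)) (sym (trans (fromℤ-neg (+ n ℤ.* pmax)) (cong (λ e → - e) (fromℤ-* (+ n) pmax)))) (scaled-lower S)))))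
      where
      nonneg : (∀ i → 0ℤ ℤ.≤ p̂ i) → 0ℤ ℤ.≤ scaled S
      nonneg h = fromℤ-cancel-≤ (ℚₚ.≤-trans (ℚₚ.≤-reflexive (sym (trans (ℚΣ.sum-cong-≗ (λ i → lemma (lookup S i))) (ℚΣ.sum-replicate-zero n))))
        (ℚₚ.≤-trans (setSumℚ-mono S (λ i → fromℤ-mono-≤ (h i))) (ℚₚ.≤-reflexive (sym (fromℤ-setSum S p̂)))))
        where
        lemma : ∀ b → (if b then 0ℚ else 0ℚ) ≡ 0ℚ
        lemma true  = refl
        lemma false = refl

    in-range : ∀ {S T} → S ⊆ T → Feasible T → zmin ℤ.≤ scaled S × scaled S ℤ.≤ zmax
    in-range {S} {T} S⊆T f = above-zmin S , below-zmax {S} {T} S⊆T f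

    zero-in-range : zmin ℤ.≤ 0ℤ × 0ℤ ℤ.≤ zmax
    zero-in-range = subst (λ z → zmin ℤ.≤ z × z ℤ.≤ zmax) (ℤΣ.setSum-⊥ n p̂)
      (in-range {Sub.⊥} {Sub.⊥} id (Optimum.empty-feasible I))

    -- With `λ` the scaling factor, the chain is p(S) ≥ λ p̂(S) ≥ λ p̂(T) ≥ p(T) - ε LB ≥ p(T) - ε
    -- p(T), the last step by `LB ≤ p(T)`.
    approximation : ∀ {S T} → profit L ℤ.≤ profit T → scaled T ℤ.≤ scaled S → (1ℚ - ε) * fromℤ (profit T) ≤ fromℤ (profit S)
    approximation {S} {T} L≤T T≤S = by≤
      (0≤+ (0≤+ (0≤+ (≤⇒0≤ (scaled≤profit S)) (0≤* (ℚₚ.<⇒≤ 0<scale) (≤⇒0≤ (fromℤ-mono-≤ T≤S))))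
        (≤⇒0≤ (profit≤scaled T))) (0≤* (ℚₚ.<⇒≤ 0<ε) (≤⇒0≤ (fromℤ-mono-≤ L≤T))))
      (r (fromℤ (profit S)) (fromℤ (profit T)) LB ε scale (fromℤ (scaled S)) (fromℤ (scaled T)))
      where
      r : ∀ s t l e λ′ zs zt → s - λ′ * zs + λ′ * (zs - zt) + (λ′ * zt + e * l - t) + e * (t - l) ≡ s - (1ℚ - e) * t
      r = solve-∀ ℚ-ring

-- Existence of runs and quality of every run.

module Approximation (I : Instance)
                     (w≤b : ∀ i → Instance.w I i ℕ.≤ Instance.b I)
                     (p-bounds : ∀ i → (ℤ.- ColKP.pmax I) ℤ.< Instance.p I i × Instance.p I i ℤ.≤ ColKP.pmax I)
                     (0<pmax : 0ℤ ℤ.< ColKP.pmax I)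
                     {ε : ℚ} (0<ε : 0ℚ ℚ.< ε) (ε<1 : ε ℚ.< 1ℚ) where

  open ColKP I
  open Rounding I w≤b (proj₂ ∘ p-bounds) 0<pmax

  module Run {L : Subset n} (lpRound : LPRound L) where

    open Guarantee (lpRound-guarantee lpRound)
    open Scaling ε (profit L)
    open ScaledProfits I (ℤₚ.<⇒≤ ∘ proj₁ ∘ p-bounds) (proj₂ ∘ p-bounds) 0<pmax {L} pmax≤ bound 0<ε ε<1

    module _ (π : Permutation′ n) (grouped : GroupedByColor π) where

      run : F1 ε _
      run = record
        { L = L ; lpRound = lpRound ; scale≢0 = scale-nonZero ; π = π ; grouped = grouped
        ; returns = proj₂ (DynamicProgram.returns-exists I π grouped p̂ zmin zmax
                             (proj₁ zero-in-range) (proj₂ zero-in-range)) }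
        where instance _ = scale-nonZero

      -- The instance is irrelevant, so the result applies to whichever proof of nonzeroness a given
      -- run carries.
      module _ .{{scale≢0 : ℚ.NonZero scale}} where

        open DynamicProgram I π grouped p̂ zmin zmax (proj₁ zero-in-range) (proj₂ zero-in-range)

        near-optimal : ∀ {Ŝ} → DP.Returns (π ⟨$⟩ʳ_) p̂ zmin zmax Ŝ →
                       Feasible Ŝ × (1ℚ ℚ.- ε) ℚ.* fromℤ OPT ℚ.≤ fromℤ (profit Ŝ)
        near-optimal {Ŝ} returns = returns-feasible returns , compare (Optimum.OPT-attained I)
          where
          compare : (∃ λ T → Feasible T × profit T ≡ OPT) → (1ℚ ℚ.- ε) ℚ.* fromℤ OPT ℚ.≤ fromℤ (profit Ŝ)
          compare (T , T-feasible , eq) = subst (λ z → (1ℚ ℚ.- ε) ℚ.* fromℤ z ℚ.≤ fromℤ (profit Ŝ)) eq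
            -- `LB` is at most the profit of the optimal set `T` because `L` is itself feasible.
            (approximation {Ŝ} {T} (subst (profit L ℤ.≤_) (sym eq) (Optimum.≤OPT I {L} isFeasible))
              (returns-maximal {Ŝ} {T} returns T-feasible (λ S⊆T → in-range S⊆T T-feasible)))

-- Since `F1` is a relation that leaves ties and choices open, the existence of a run is asserted
-- along with the guarantee for every run, which would otherwise be vacuous for an input without
-- runs.
proposition5p1 : (I : Instance) → let open ColKP I in
    (∀ i → w i ℕ.≤ b) →
    (∀ i → (ℤ.- pmax) ℤ.< p i × p i ℤ.≤ pmax) →
    0ℤ ℤ.< pmax →
    (ε : ℚ) → 0ℚ ℚ.< ε → ε ℚ.< 1ℚ →
    ∃ (F1 ε) ×
    (∀ Ŝ → F1 ε Ŝ →
    Feasible Ŝ × (1ℚ ℚ.- ε) ℚ.* fromℤ OPT ℚ.≤ fromℤ (profit Ŝ))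
proposition5p1 I w≤b p-bounds 0<pmax ε 0<ε ε<1 =
  (_ , Run.run (proj₂ lpRound-exists) (proj₁ (Sorting.grouping-exists I)) (proj₂ (Sorting.grouping-exists I))) ,
  λ Ŝ f → let open ColKP.F1 f in Run.near-optimal lpRound π grouped returns
  where
  open Approximation I w≤b p-bounds 0<pmax 0<ε ε<1
  open Rounding I w≤b (proj₂ ∘ p-bounds) 0<pmax using (lpRound-exists)
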